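{- Let $K$ be an infinite field, $k\ge1$, $\vec s=(n_1,\dots,n_k)$ a tuple of positive integers, and $n=\min(n_1,\dots,n_k)-1$. The moduli space of kernel sequences $\mathcal M(\vec s)=\Psi(\mathcal U)$ is a constructible set contained in the incidence variety $\mathbf{Gr}^{\mathrm{simp}}(\vec s)$. If $K'_0(\vec s)>0$, the projection $\mathcal M(\vec s)\to\operatorname{Gr}(K'_0(\vec s),C_0)$ is dominant. Moreover $\mathcal M(\vec s)$ is irreducible and unirational.
   Context: Notation: $[p]=\{0,\dots,p\}$. Put $M_a(p)=n_a-1-n+p$ (so $M_a(p)\ge p$) and $I_p=\prod_{a=1}^k[M_a(p)]$ for $p\ge 0$. Let $\delta_i^q:[q-1]\to[q]$ be the increasing injection missing $i$ and $\sigma_i^q:[q+1]\to[q]$ the nondecreasing surjection taking the value $i$ twice. $I_\bullet$ is the functor from the simplicial category to sets with $I_\bullet([p])=I_p$, $I_\bullet(\delta_i^p)=\prod_{a}\delta_i^{M_a(p)}:I_{p-1}\to I_p$ and $I_\bullet(\sigma_i^p)=\prod_a\sigma_i^{M_a(p)}:I_{p+1}\to I_p$. The diagonal simplicial tensor module $X_\bullet=X_\bullet(\vec s;K)$ has $X_p=K^{I_p}$ (functions $I_p\to K$), with a nondecreasing map $\alpha:[p]\to[q]$ acting by $T\mapsto T\circ I_\bullet(\alpha)$. $C_\bullet=K[\boldsymbol\Delta^n]$ is the simplicial $K$-vector space with $C_p$ having as basis the nondecreasing maps $\alpha:[p]\to[n]$, with $d_i(\alpha)=\alpha\circ\delta_i^p$;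 $S_p=\dim C_p=\binom{n+p+1}{p+1}$. For $T\in X_n$ the realization map is $f_T:C_\bullet\to X_\bullet$, $f_{T,p}(\alpha)=T\circ I_\bullet(\alpha)$; its matrix $M_{T,p}$ has rows indexed by $m\in I_p$, columns by $\alpha$, and entries $T(I_\bullet(\alpha)(m))$. The generic rank $R'_p(\vec s)$ is the rank of $M_{T,p}$ over the function field $K(v_u:u\in I_n)$ when $T$ is the symbolic tensor with independent indeterminate entries $T(u)=v_u$; and $K'_p(\vec s)=S_p-R'_p(\vec s)$. Regard $X_n$ as an affine space (variety) over $K$. $\mathcal U\subset X_n$ is the non-empty Zariski-open locus where $\operatorname{rank}M_{T,p}=R'_p(\vec s)$ for all $0\le p\le n$. $\operatorname{Gr}(r,V)$ is the Grassmannian of $r$-dimensional subspaces of $V$, and $\operatorname{Gr}(\vec s)=\prod_{0\le p\le n,\ K'_p(\vec s)>0}\operatorname{Gr}(K'_p(\vec s),C_p)$. The moduli map is the algebraic map $\Psi:\mathcal U\to\operatorname{Gr}(\vec s)$, $T\mapsto(\ker f_{T,p})_p$ (over those $p$ with $K'_p(\vec s)>0$), and $\mathcal M(\vec s)=\Psi(\mathcal U)$ is its image (as the image of a morphism of varieties over $K$). The incidence variety $\mathbf{Gr}^{\mathrm{simp}}(\vec s)\subset\operatorname{Gr}(\vec s)$ is the closed subvariety of tuples $(L_p)_p$ satisfying $d_i(L_p)\subseteq L_{p-1}$ for all $1\le p\le n$, $0\le i\le p$ with $K'_p(\vec s)>0$ (with $L_{p-1}=0$ if $K'_{p-1}(\vec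 s)=0$). Unirational means dominated by (a dense open subset of) an affine space via a rational map. -}

module Defs where

open import Level using (_⊔_; suc; 0ℓ)
open import Algebra.Bundles using (CommutativeRing; RawRing)
open import Algebra.Apartness.Bundles using (HeytingField; HeytingCommutativeRing)
import Algebra.Definitions.RawSemiring as RawSemiringDefs
open import Data.Bool.Base using (if_then_else_)
open import Data.Nat.Base as ℕ using (ℕ; _∸_; _⊓_)
open import Data.Fin.Base as Fin
  using (Fin; zero; toℕ; splitAt; join; punchIn; pinch; _↑ˡ_)
open import Data.Fin.Properties using (_≟_; _≤?_; all?; splitAt-↑ˡ; splitAt-↑ʳ; join-splitAt)
open import Data.List.Base as List using (List; filter; cartesianProductWith; allFin)
open import Data.List.Relation.Unary.All as ListAll using ()
open import Data.List.Relation.Unary.Any using (Any)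
open import Data.Product.Base using (∃-syntax; Σ-syntax; _×_; _,_)
open import Data.Sum.Base as Sum using (_⊎_; inj₁; inj₂)
open import Data.Unit.Base using (⊤)
open import Data.Vec.Base as Vec using (Vec; lookup; tabulate; foldr₁)
open import Data.Vec.Functional using (Vector)
open import Data.Vec.Properties using (≡-dec)
open import Data.Vec.Relation.Unary.All as All using (All)
open import Function.Base using (_∘_; id)
open import Function.Bundles using (_⇔_)
open import Relation.Binary.PropositionalEquality.Core
  using (_≡_; _≢_; refl; sym; trans; cong)
open import Relation.Nullary using (¬_; does)
open import Relation.Nullary.Decidable using (_→-dec_)
open import Relation.Unary using (Pred; Decidable; _∈_; _∉_; _⊆_)

------------------------------------------------------------------------
-- Fields
--
-- In the presence of excluded middle a Heyting field is a field in the
-- usual sense, with x # y the same as ¬ (x ≈ y).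

commutativeRing : ∀ {c ℓ₁ ℓ₂} → HeytingField c ℓ₁ ℓ₂ → CommutativeRing c ℓ₁
commutativeRing F =
  HeytingCommutativeRing.commutativeRing (HeytingField.heytingCommutativeRing F)

rawRing : ∀ {c ℓ₁ ℓ₂} → HeytingField c ℓ₁ ℓ₂ → RawRing c ℓ₁
rawRing F = CommutativeRing.rawRing (commutativeRing F)

IsInfinite : ∀ {c ℓ₁ ℓ₂} → HeytingField c ℓ₁ ℓ₂ → Set (c ⊔ ℓ₁)
IsInfinite F = (xs : List Carrier) → ∃[ x ] ListAll.All (λ y → ¬ (x ≈ y)) xs
  where open HeytingField F

IsAlgebraicallyClosed : ∀ {c ℓ₁ ℓ₂} → HeytingField c ℓ₁ ℓ₂ → Set (c ⊔ ℓ₁)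
IsAlgebraicallyClosed F =
  ∀ d (a : Vector Carrier (ℕ.suc d)) →
  ∃[ x ] ((x ^ ℕ.suc d) + sum (λ i → a i * (x ^ toℕ i))) ≈ 0#
  where
  open RawRing (rawRing F)
  open RawSemiringDefs rawSemiring using (_^_; sum)

------------------------------------------------------------------------
-- Polynomial rings: the free commutative algebra on a type of variables

module Polynomials {c ℓ} (R : CommutativeRing c ℓ) where

  private module R = CommutativeRing R

  infix  8 :-_
  infixl 7 _:*_
  infixl 6 _:+_
  infix  4 _≈ₚ_

  data Poly (V : Set) : Set c where
    con  : R.Carrier → Poly V
    var  : V → Poly V
    _:+_ : Poly V → Poly V → Poly V
    _:*_ : Poly V → Poly V → Poly V
    :-_  : Poly V → Poly V

  -- The congruence generated by the laws of commutative R-algebras.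
  data _≈ₚ_ {V : Set} : Poly V → Poly V → Set (c ⊔ ℓ) where
    ≈-refl  : ∀ {f} → f ≈ₚ f
    ≈-sym   : ∀ {f g} → f ≈ₚ g → g ≈ₚ f
    ≈-trans : ∀ {f g h} → f ≈ₚ g → g ≈ₚ h → f ≈ₚ h
    +-cong  : ∀ {f f′ g g′} → f ≈ₚ f′ → g ≈ₚ g′ → f :+ g ≈ₚ f′ :+ g′
    *-cong  : ∀ {f f′ g g′} → f ≈ₚ f′ → g ≈ₚ g′ → f :* g ≈ₚ f′ :* g′
    neg-cong : ∀ {f f′} → f ≈ₚ f′ → :- f ≈ₚ :- f′
    +-assoc : ∀ f g h → (f :+ g) :+ h ≈ₚ f :+ (g :+ h)
    +-comm  : ∀ f g → f :+ g ≈ₚ g :+ f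
    +-identityˡ : ∀ f → con R.0# :+ f ≈ₚ f
    +-inverseˡ  : ∀ f → :- f :+ f ≈ₚ con R.0#
    *-assoc : ∀ f g h → (f :* g) :* h ≈ₚ f :* (g :* h)
    *-comm  : ∀ f g → f :* g ≈ₚ g :* f
    *-identityˡ : ∀ f → con R.1# :* f ≈ₚ f
    distribˡ : ∀ f g h → f :* (g :+ h) ≈ₚ (f :* g) :+ (f :* h)
    con-cong : ∀ {a b} → a R.≈ b → con a ≈ₚ con b
    con-+ : ∀ a b → con (a R.+ b) ≈ₚ con a :+ con b
    con-* : ∀ a b → con (a R.* b) ≈ₚ con a :* con b

  evaluate : ∀ {c′ ℓ′} (A : RawRing c′ ℓ′) → (R.Carrier → RawRing.Carrier A) →
             ∀ {V} → Poly V → (V → RawRing.Carrier A) → RawRing.Carrier A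
  evaluate A φ f ρ = go f
    where
    open RawRing A
    go : Poly _ → Carrier
    go (con a)  = φ a
    go (var v)  = ρ v
    go (f :+ g) = go f + go g
    go (f :* g) = go f * go g
    go (:- f)   = - go f

  -- Fractions whose denominator is regular (not a zero divisor).  Over a
  -- field R, where R[V] is an integral domain, the regular elements are
  -- exactly the nonzero ones and this is the function field R(V).
  Regular : ∀ {V} → Poly V → Set (c ⊔ ℓ)
  Regular f = ∀ g → f :* g ≈ₚ con R.0# → g ≈ₚ con R.0#

  record Fraction (V : Set) : Set (c ⊔ ℓ) where
    constructor frac
    field
      num : Poly V
      den : Poly V
      den-regular : Regular den

  Regular-1 : ∀ {V} → Regular {V} (con R.1#)
  Regular-1 g e = ≈-trans (≈-sym (*-identityˡ g)) e

  Regular-* : ∀ {V} {f g : Poly V} → Regular f → Regular g → Regular (f :* g)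
  Regular-* rf rg h e = rg h (rf _ (≈-trans (≈-sym (*-assoc _ _ _)) e))

  fromPoly : ∀ {V} → Poly V → Fraction V
  fromPoly f = frac f (con R.1#) Regular-1

  functionField : Set → RawRing (c ⊔ ℓ) (c ⊔ ℓ)
  functionField V = record
    { Carrier = Fraction V
    ; _≈_ = λ { (frac a b _) (frac a′ b′ _) → a :* b′ ≈ₚ a′ :* b }
    ; _+_ = λ { (frac a b r) (frac a′ b′ r′) →
                frac (a :* b′ :+ a′ :* b) (b :* b′) (Regular-* r r′) }
    ; _*_ = λ { (frac a b r) (frac a′ b′ r′) →
                frac (a :* a′) (b :* b′) (Regular-* r r′) }
    ; -_  = λ { (frac a b r) → frac (:- a) b r }
    ; 0#  = fromPoly (con R.0#)
    ; 1#  = fromPoly (con R.1#)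
    }

------------------------------------------------------------------------
-- Linear algebra

module LinearAlgebra {c ℓ} (A : RawRing c ℓ) where

  open RawRing A
  open RawSemiringDefs rawSemiring using (_^_; sum)

  -- Columns are indexed by Fin N, rows by an arbitrary type.
  Matrix : Set → ℕ → Set c
  Matrix Row N = Row → Fin N → Carrier

  combination : ∀ {X : Set} {r} → Vector Carrier r → (Fin r → X → Carrier) →
                X → Carrier
  combination a b x = sum (λ j → a j * b j x)

  LinearlyIndependent : ∀ {X : Set} {r} → (Fin r → X → Carrier) → Set (c ⊔ ℓ)
  LinearlyIndependent b =
    ∀ a → (∀ x → combination a b x ≈ 0#) → ∀ j → a j ≈ 0#

  InSpan : ∀ {X : Set} {r} → (Fin r → X → Carrier) → (X → Carrier) → Set (c ⊔ ℓ)
  InSpan b y = ∃[ a ] (∀ x → y x ≈ combination a b x)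

  -- Some r columns form a basis of the column space.
  HasRank : ∀ {Row N} → Matrix Row N → ℕ → Set (c ⊔ ℓ)
  HasRank {N = N} M r =
    Σ[ J ∈ (Fin r → Fin N) ]
      LinearlyIndependent (λ j x → M x (J j)) ×
      (∀ l → InSpan (λ j x → M x (J j)) (λ x → M x l))

  _∈Ker_ : ∀ {Row N} → Vector Carrier N → Matrix Row N → Set ℓ
  y ∈Ker M = ∀ x → sum (λ j → y j * M x j) ≈ 0#

  det : ∀ {n} → (Fin n → Fin n → Carrier) → Carrier
  det {ℕ.zero}  M = 1#
  det {ℕ.suc n} M =
    sum (λ j → ((- 1#) ^ toℕ j) * (M zero j * det (λ i l → M (Fin.suc i) (punchIn j l))))

  -- A point of Gr(r , A^m), given by a basis of the subspace; two bases
  -- represent the same point when their spans agree.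
  record Gr (r m : ℕ) : Set (c ⊔ ℓ) where
    field
      basis       : Fin r → Vector Carrier m
      independent : LinearlyIndependent basis

  _∈Gr_ : ∀ {r m} → Vector Carrier m → Gr r m → Set (c ⊔ ℓ)
  y ∈Gr L = InSpan (Gr.basis L) y

  -- Plücker coordinates, for arbitrary (not only increasing) tuples of
  -- indices; they are alternating in the tuple.
  plücker : ∀ {r m} → Gr r m → Vec (Fin m) r → Carrier
  plücker L J = det (λ i l → Gr.basis L i (lookup J l))

------------------------------------------------------------------------
-- Varieties inside a finite product ∏ᵢ Gr(rᵢ , mᵢ) over K
--
-- Points have coordinates in an extension Ω of K (to be algebraically
-- closed), whereas all equations, and hence the Zariski topology, are
-- over K.

module GrassmannianProduct
  {c ℓ₁ ℓ₂ c′ ℓ₁′ ℓ₂′}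
  (K : HeytingField c ℓ₁ ℓ₂) (Ω : HeytingField c′ ℓ₁′ ℓ₂′)
  (φ : HeytingField.Carrier K → HeytingField.Carrier Ω)
  {I : Set} (r m : I → ℕ)
  where

  private module K = HeytingField K
  open RawRing (rawRing Ω)
  open LinearAlgebra (rawRing Ω)
  open Polynomials (commutativeRing K)

  Point : Set (c′ ⊔ ℓ₁′)
  Point = ∀ i → Gr (r i) (m i)

  Coordinate : Set
  Coordinate = Σ[ i ∈ I ] Vec (Fin (m i)) (r i)

  coordinates : Point → Coordinate → Carrier
  coordinates L (i , J) = plücker (L i) J

  ⟦_⟧ : ∀ {V} → Poly V → (V → Carrier) → Carrier
  ⟦_⟧ = evaluate (rawRing Ω) φ

  -- Homogeneous of degree d i in the Plücker coordinates of the i-th factor.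
  data IsMultihomogeneous : (I → ℕ) → Poly Coordinate → Set (c ⊔ ℓ₁) where
    con  : ∀ a → IsMultihomogeneous (λ _ → 0) (con a)
    var  : ∀ {d i} J → d i ≡ 1 → (∀ j → j ≢ i → d j ≡ 0) →
           IsMultihomogeneous d (var (i , J))
    _:+_ : ∀ {d f g} → IsMultihomogeneous d f → IsMultihomogeneous d g →
           IsMultihomogeneous d (f :+ g)
    _:*_ : ∀ {d e f g} → IsMultihomogeneous d f → IsMultihomogeneous e g →
           IsMultihomogeneous (λ i → d i ℕ.+ e i) (f :* g)
    :-_  : ∀ {d f} → IsMultihomogeneous d f → IsMultihomogeneous d (:- f)
    resp : ∀ {d e f g} → (∀ i → d i ≡ e i) → f ≈ₚ g →
           IsMultihomogeneous d f → IsMultihomogeneous e g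

  record ClosedSet : Set (suc (c ⊔ ℓ₁)) where
    field
      Equation    : Pred (Poly Coordinate) (c ⊔ ℓ₁)
      homogeneous : ∀ {f} → Equation f → ∃[ d ] IsMultihomogeneous d f

  zeros : ClosedSet → Pred Point (c ⊔ ℓ₁ ⊔ ℓ₁′)
  zeros Z L = ∀ f → ClosedSet.Equation Z f → ⟦ f ⟧ (coordinates L) ≈ 0#

  -- X lies in the closure of Y (used for Y ⊆ X).
  IsDenseIn : ∀ {y x} → Pred Point y → Pred Point x → Set _
  IsDenseIn Y X = ∀ Z → Y ⊆ zeros Z → X ⊆ zeros Z

  -- A finite union of locally closed sets.
  IsConstructible : ∀ {x} → Pred Point x → Set _
  IsConstructible X =
    Σ[ pieces ∈ List (ClosedSet × ClosedSet) ]
      (∀ L → (L ∈ X) ⇔ Any (λ { (Z , W) → L ∈ zeros Z × L ∉ zeros W }) pieces)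

  IsIrreducible : ∀ {x} → Pred Point x → Set _
  IsIrreducible X =
    (∃[ L ] L ∈ X) ×
    (∀ Z W → (∀ {L} → L ∈ X → L ∈ zeros Z ⊎ L ∈ zeros W) →
     (X ⊆ zeros Z) ⊎ (X ⊆ zeros W))

  HasCoordinates : Point → (Coordinate → Carrier) → Set _
  HasCoordinates L h =
    ∀ i → ∃[ u ] (¬ (u ≈ 0#)) × (∀ J → h (i , J) ≈ u * plücker (L i) J)

  -- A rational map from affine N-space over K: polynomial formulas for the
  -- Plücker coordinates, valid on the dense open set where domain ≠ 0.
  record RationalMap (N : ℕ) : Set (c ⊔ ℓ₁ ⊔ c′ ⊔ ℓ₁′) where
    field
      domain     : Poly (Fin N)
      nonempty   : ¬ (domain ≈ₚ con K.0#)
      components : Coordinate → Poly (Fin N)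

    Domain : Pred (Vector Carrier N) ℓ₁′
    Domain t = ¬ (⟦ domain ⟧ t ≈ 0#)

    _↦_ : Vector Carrier N → Point → Set _
    t ↦ L = HasCoordinates L (λ J → ⟦ components J ⟧ t)

    field
      defined : ∀ t → t ∈ Domain → ∃[ L ] (t ↦ L)

    Image : Pred Point _
    Image L = ∃[ t ] (t ∈ Domain × (t ↦ L))

  IsUnirational : ∀ {x} → Pred Point x → Set _
  IsUnirational X =
    ∃[ N ] Σ[ F ∈ RationalMap N ]
      (RationalMap.Image F ⊆ X) × IsDenseIn (RationalMap.Image F) X

------------------------------------------------------------------------
-- The diagonal simplicial structure
--
-- A map α : [p] → [q] is a vector, [p] being Fin (suc p).

-- I∙ acts on each factor by [p] ↦ [p + g], α ↦ α ⋆ id_{[g-1]} (join with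
-- the identity on the last g elements).  The lemmas below show that it
-- is functorial and sends δᵢ, σᵢ to δᵢ, σᵢ.
extend : ∀ {p q} g → (Fin p → Fin q) → Fin (p ℕ.+ g) → Fin (q ℕ.+ g)
extend {p} {q} g α = join q g ∘ Sum.map₁ α ∘ splitAt p

extend-id : ∀ {p} g (i : Fin (p ℕ.+ g)) → extend {p} g id i ≡ i
extend-id {p} g i with splitAt p i in eq
... | inj₁ j = trans (cong (join p g) (sym eq)) (join-splitAt p g i)
... | inj₂ j = trans (cong (join p g) (sym eq)) (join-splitAt p g i)

extend-∘ : ∀ {p q r} g (β : Fin q → Fin r) (α : Fin p → Fin q) i →
           extend g (β ∘ α) i ≡ extend g β (extend g α i)
extend-∘ {p} {q} {r} g β α i with splitAt p i
... | inj₁ j = cong (join r g ∘ Sum.map₁ β) (sym (splitAt-↑ˡ q (α j) g))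
... | inj₂ j = cong (join r g ∘ Sum.map₁ β) (sym (splitAt-↑ʳ q g j))

extend-δ : ∀ {p} g (i : Fin (ℕ.suc p)) j →
           extend g (punchIn i) j ≡ punchIn (i ↑ˡ g) j
extend-δ {p} g zero j with splitAt p j in eq
... | inj₁ l = cong Fin.suc (trans (cong (join p g) (sym eq)) (join-splitAt p g j))
... | inj₂ l = cong Fin.suc (trans (cong (join p g) (sym eq)) (join-splitAt p g j))
extend-δ {ℕ.suc p} g (Fin.suc i) zero = refl
extend-δ {ℕ.suc p} g (Fin.suc i) (Fin.suc j) with splitAt p j | extend-δ g i j
... | inj₁ l | e = cong Fin.suc e
... | inj₂ l | e = cong Fin.suc e

extend-σ : ∀ {p} g (i : Fin p) j →
           extend g (pinch i) j ≡ pinch (i ↑ˡ g) j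
extend-σ {ℕ.suc p} g i zero = refl
extend-σ {ℕ.suc p} g zero (Fin.suc j) with splitAt (ℕ.suc p) j in eq
... | inj₁ l = trans (cong (join (ℕ.suc p) g) (sym eq)) (join-splitAt (ℕ.suc p) g j)
... | inj₂ l = trans (cong (join (ℕ.suc p) g) (sym eq)) (join-splitAt (ℕ.suc p) g j)
extend-σ {ℕ.suc p} g (Fin.suc i) (Fin.suc j) with splitAt (ℕ.suc p) j | extend-σ g i j
... | inj₁ l | e = cong Fin.suc e
... | inj₂ l | e = cong Fin.suc e

-- Fin-vectors of a given length, and the nondecreasing ones among them.
allVecs : ∀ q p → List (Vec (Fin q) p)
allVecs q ℕ.zero    = Vec.[] List.∷ List.[]
allVecs q (ℕ.suc p) = cartesianProductWith Vec._∷_ (allFin q) (allVecs q p)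

Nondecreasing : ∀ {q p} → Pred (Vec (Fin q) p) 0ℓ
Nondecreasing α = ∀ i j → i Fin.≤ j → lookup α i Fin.≤ lookup α j

nondecreasing? : ∀ {q p} → Decidable (Nondecreasing {q} {p})
nondecreasing? α =
  all? λ i → all? λ j → (i ≤? j) →-dec (lookup α i ≤? lookup α j)

module Diagonal {k} (s : Vec ℕ (ℕ.suc k)) where

  n : ℕ
  n = foldr₁ _⊓_ s ∸ 1

  -- M n_a p is M_a(p) = n_a - 1 - n + p; the subtractions are exact for
  -- positive n_a occurring in s.
  gap : ℕ → ℕ
  gap n_a = n_a ∸ 1 ∸ n

  M : ℕ → ℕ → ℕ
  M n_a p = p ℕ.+ gap n_a

  I : ℕ → Set
  I p = All (λ n_a → Fin (ℕ.suc (M n_a p))) s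

  I∙ : ∀ {p q} → (Fin (ℕ.suc p) → Fin (ℕ.suc q)) → I p → I q
  I∙ α = All.map (λ {n_a} → extend (gap n_a) α)

  -- The basis of C_p.
  basis : ∀ p → List (Vec (Fin (ℕ.suc n)) (ℕ.suc p))
  basis p = filter nondecreasing? (allVecs (ℕ.suc n) (ℕ.suc p))

  S : ℕ → ℕ
  S p = List.length (basis p)

  column : ∀ p → Fin (S p) → Vec (Fin (ℕ.suc n)) (ℕ.suc p)
  column p = List.lookup (basis p)

  -- The matrix M_{T,p} of the realization map f_{T,p}.
  realization : ∀ {a} {A : Set a} → (I n → A) → ∀ p → I p → Fin (S p) → A
  realization T p m j = T (I∙ (lookup (column p j)) m)

  module _ {c ℓ} (A : RawRing c ℓ) where

    open RawRing A
    open RawSemiringDefs rawSemiring using (sum)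

    -- d_i : C_{p+1} → C_p, the linear extension of α ↦ α ∘ δ_i.
    face : ∀ p → Fin (ℕ.suc (ℕ.suc p)) →
           Vector Carrier (S (ℕ.suc p)) → Vector Carrier (S p)
    face p i y j = sum λ l →
      if does (≡-dec _≟_ (tabulate (lookup (column (ℕ.suc p) l) ∘ punchIn i))
                         (column p j))
      then y l else 0#

  IsGenericRank : ∀ {c ℓ₁ ℓ₂} → HeytingField c ℓ₁ ℓ₂ → ℕ → ℕ → Set (c ⊔ ℓ₁)
  IsGenericRank K p = HasRank (realization (λ u → fromPoly (var u)) p)
    where
    open Polynomials (commutativeRing K)
    open LinearAlgebra (functionField (I n))

  module Moduli
    {c ℓ₁ ℓ₂ c′ ℓ₁′ ℓ₂′}
    (K : HeytingField c ℓ₁ ℓ₂) (Ω : HeytingField c′ ℓ₁′ ℓ₂′)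
    (φ : HeytingField.Carrier K → HeytingField.Carrier Ω)
    (R′ : ℕ → ℕ)   -- the generic ranks
    where

    open RawRing (rawRing Ω)
    open LinearAlgebra (rawRing Ω)

    K′ : ℕ → ℕ
    K′ p = S p ∸ R′ p

    record Degree : Set where
      constructor degree
      field
        p         : ℕ
        .bound    : p ℕ.≤ n
        .positive : 0 ℕ.< K′ p

    module GrProduct =
      GrassmannianProduct K Ω φ {Degree} (K′ ∘ Degree.p) (S ∘ Degree.p)

    open GrProduct using (Point)

    𝓤 : Pred (I n → Carrier) (c′ ⊔ ℓ₁′)
    𝓤 T = ∀ p → p ℕ.≤ n → HasRank (realization T p) (R′ p)

    -- The graph of the moduli map Ψ.
    _Ψ↦_ : (I n → Carrier) → Point → Set (c′ ⊔ ℓ₁′)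
    T Ψ↦ L = ∀ d y → (y ∈Gr L d) ⇔ (y ∈Ker realization T (Degree.p d))

    𝓜 : Pred Point (c′ ⊔ ℓ₁′)
    𝓜 L = ∃[ T ] (T ∈ 𝓤 × T Ψ↦ L)

    Grˢⁱᵐᵖ : Pred Point (c′ ⊔ ℓ₁′)
    Grˢⁱᵐᵖ L =
      ∀ p (p<n : p ℕ.< n) (h : 0 ℕ.< K′ (ℕ.suc p)) i y →
      y ∈Gr L (degree (ℕ.suc p) p<n h) →
      ((p≤n : p ℕ.≤ n) (h′ : 0 ℕ.< K′ p) → face (rawRing Ω) p i y ∈Gr L (degree p p≤n h′)) ×
      (K′ p ≡ 0 → ∀ j → face (rawRing Ω) p i y j ≈ 0#)

    module Gr₀ = GrassmannianProduct K Ω φ {⊤} (λ _ → K′ 0) (λ _ → S 0)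

    project₀ : 0 ℕ.< K′ 0 → Point → Gr₀.Point
    project₀ h L _ = L (degree 0 ℕ.z≤n h)

    ProjectionIsDominant : 0 ℕ.< K′ 0 → Set _
    ProjectionIsDominant h =
      Gr₀.IsDenseIn (λ W → ∃[ L ] (L ∈ 𝓜 × W ≡ project₀ h L)) (λ _ → ⊤)

{-# OPTIONS --safe #-}
-- For a fixed choice of one R′ p × R′ p minor of every realization matrix,
-- Cramer's rule gives a basis of the kernels that is polynomial in T wherever
-- the chosen minors do not vanish: this parametrization of 𝓜 by an affine space
-- makes it unirational, hence irreducible.  Density statements are checked on
-- lines in the space of tensors, where a polynomial has finitely many zeros.
--
-- A point L lies in 𝓜 if and only if the tensors T whose kernels contain L, a
-- linear space cut out by equations in the Plücker coordinates of L, include one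
-- with the generic ranks.  On the strata of constant rank of that linear system Cramer's
-- rule parametrizes its solutions, which makes 𝓜 constructible.
--
-- Some n_a equals n + 1, so the entries of the matrix in degree 0 are distinct
-- coordinates of T; its kernel is therefore an arbitrary subspace.
module Submission where

open import Defs
open import Algebra.Apartness.Bundles using (HeytingField)
open import Algebra.Morphism.Structures using (IsRingHomomorphism)
open import Axiom.ExcludedMiddle using (ExcludedMiddle)
open import Data.Nat.Base using (ℕ; suc; _<_; _≤_)
open import Data.Product.Base using (_×_)
open import Data.Vec.Base using (Vec)
open import Data.Vec.Relation.Unary.All using (All)
open import Relation.Unary using (_⊆_)

open import Algebra.Bundles using (CommutativeRing; RawRing)
import Algebra.Definitions.RawSemiring as RawSemiringDefs
import Algebra.Morphism.Construct.Identity as Identity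
import Algebra.Properties.Ring as RingProperties
import Algebra.Properties.Semiring.Exp as SemiringExp
import Algebra.Properties.Semiring.Sum as SemiringSum
import Algebra.Solver.Ring.NaturalCoefficients.Default as SemiringSolver
open import Data.Bool.Base using (true; false; if_then_else_)
open import Data.Empty using (⊥-elim)
open import Data.Fin.Base as Fin
  using (Fin; zero; suc; toℕ; fromℕ<; punchIn; punchOut; splitAt; _↑ˡ_; _↑ʳ_; remQuot; combine)
open import Data.Fin.Properties
  using (_≟_; <⇒≢; 0≢1+n; suc-injective; toℕ-injective; toℕ-cast; toℕ-fromℕ<; toℕ≤pred[n];
         injective⇒≤; pigeonhole; punchIn-injective; punchIn-mono-≤; punchInᵢ≢i; punchIn-punchOut;
         punchOut-injective; splitAt-↑ˡ; splitAt-↑ʳ; ↑ˡ-injective; ↑ʳ-injective; remQuot-combine)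
open import Data.List.Base as List using (List; _++_; allFin; cartesianProductWith)
open import Data.List.Membership.Propositional using (_∈_; find; lose)
open import Data.List.Membership.Propositional.Properties
  using (∈-allFin; ∈-cartesianProductWith⁺; ∈-filter⁺; ∈-filter⁻; ∈-lookup; ∈-upTo⁺)
open import Data.List.Relation.Unary.All as ListAll using ()
import Data.List.Relation.Unary.All.Properties as ListAll
open import Data.List.Relation.Unary.AllPairs as AllPairs using ()
open import Data.List.Relation.Unary.Any as ListAny using (Any)
import Data.List.Relation.Unary.Any.Properties as ListAny
open import Data.List.Relation.Unary.Unique.Propositional using (Unique)
import Data.List.Relation.Unary.Unique.Propositional.Properties as Unique
open import Data.Nat.Base as ℕ using (zero; _∸_; _⊓_; z≤n; s≤s)
import Data.Nat.Properties as ℕ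
open import Data.Product.Base using (Σ-syntax; ∃-syntax; _,_; proj₁; proj₂; uncurry)
open import Data.Sum.Base using (_⊎_; inj₁; inj₂; [_,_]′)
import Data.Unit.Base as Unit
open import Data.Unit.Polymorphic.Base using (⊤; tt)
open import Data.Vec.Base as Vec using (lookup; tabulate; foldr₁)
open import Data.Vec.Functional as Vector using (Vector)
open import Data.Vec.Properties using (lookup∘tabulate; ∷-injective; ≡-dec)
open import Data.Vec.Relation.Unary.All as All using ()
open import Data.Vec.Relation.Unary.Any as VecAny using ()
open import Function.Base using (_∘_; id)
open import Function.Bundles using (_⇔_; mk⇔; Equivalence)
open import Function.Definitions using (Injective)
open import Level using (_⊔_; Lift; lift)
open import Relation.Binary.PropositionalEquality.Core as ≡ using (_≡_; _≢_)
import Relation.Binary.Reasoning.Setoid as SetoidReasoning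
open import Relation.Nullary using (¬_; does; Dec; yes; no; recompute)
open import Relation.Unary using (Pred) renaming (_∈_ to _∈ᵖ_)

-- Rank can only drop under specialization, even at tensors where the coefficients of the generic
-- column relations have poles: all minors of size `R′ p + 1` vanish at every tensor. Hence one
-- nonzero minor of size `R′ p` already forces rank `R′ p`, `𝓤` is covered by the charts on which
-- chosen minors are nonzero, and two charts give the same kernels on their overlap. To carry an
-- equation from the image of one fixed chart to a point `L` of `𝓜`, choose a second chart through a
-- tensor over `L` and find tensors lying in both. Two obstacles shape the formulation. A subspace
-- is given by a basis, so its Plücker coordinates are known only up to one nonzero factor in each
-- Grassmannian; every transfer of an equation between representatives goes through
-- multihomogeneity. And points have coordinates in `Ω` while equations have coefficients in `K`: to
-- describe `𝓜` by equations, a tensor over `L` must be replaced by one that is polynomial in the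
-- Plücker coordinates of `L` with coefficients in `K`.

module RawCramer {c ℓ} (A : RawRing c ℓ) where

  open Vector using (_∷_)
  open RawRing A
  open LinearAlgebra A
  open RawSemiringDefs rawSemiring using (_^_; sum)

  sign : ∀ {n} → Fin n → Carrier
  sign j = (- 1#) ^ toℕ j

  minor : ∀ {X : Set} {r} → (Fin r → X) → (Fin r → X → Carrier) → Carrier
  minor J w = det (λ i l → w i (J l))

  -- The generalized cross product of `r` rows in `suc r` columns: signed maximal minors with one
  -- column left out, orthogonal to each of the rows.
  cofactors : ∀ {X : Set} {r} → (Fin r → X → Carrier) → (Fin (suc r) → X) → Vector Carrier (suc r)
  cofactors w U i = sign i * minor (U ∘ punchIn i) w

  δ[_,_]_ : ∀ {N} → Fin N → Fin N → Carrier → Carrier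
  δ[ i , j ] a = if does (i ≟ j) then a else 0#

  -- Repeated indices in `U` add up, so that pairing with a vector is always pairing along `U`.
  -- Repetitions do occur: one row of a realization matrix can contain the same indeterminate in
  -- several columns.
  scatter : ∀ {q N} → (Fin q → Fin N) → Vector Carrier q → Vector Carrier N
  scatter U a x = sum (λ i → δ[ U i , x ] a i)

  -- By expansion along the first row, the product of a row v with this
  -- vector is the minor of v ∷ w in the columns l ∷ J.
  cramer : ∀ {r N} → (Fin r → Fin N → Carrier) → (Fin r → Fin N) → Fin N → Vector Carrier N
  cramer w J l = scatter (l ∷ J) (cofactors w (l ∷ J))

-- Determinants as alternating multilinear functions of the rows

module Determinant {c ℓ} (R : CommutativeRing c ℓ) where

  open Vector using ([]; _∷_)
  open CommutativeRing R hiding (zero; rawRing)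
  open RingProperties ring using (-‿involutive; +-inverseˡ-unique; -1*x≈-x)
  open LinearAlgebra (CommutativeRing.rawRing R)
  open SemiringSum semiring using (sum; sum-cong-≋; ∑-distrib-+; ∑-comm; sum-remove;
                                   *-distribˡ-sum; *-distribʳ-sum; sum-replicate-zero)
  open SemiringSolver commutativeSemiring using (solve; _:=_; _:+_; _:*_; con)
  open SetoidReasoning setoid

  open RawCramer (CommutativeRing.rawRing R) using (sign; minor)

  sign-square : ∀ {n} (j : Fin n) → sign j * sign j ≈ 1#
  sign-square zero    = *-identityˡ 1#
  sign-square (suc j) = begin
    (- 1# * sign j) * (- 1# * sign j) ≈⟨ solve 2 (λ m s → (m :* s) :* (m :* s) := (m :* m) :* (s :* s)) refl (- 1#) (sign j) ⟩
    (- 1# * - 1#) * (sign j * sign j) ≈⟨ *-cong (trans (-1*x≈-x (- 1#)) (-‿involutive 1#)) (sign-square j) ⟩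
    1# * 1#                           ≈⟨ *-identityˡ 1# ⟩
    1#                                ∎

  sum-zero : ∀ {n} {f : Vector Carrier n} → (∀ i → f i ≈ 0#) → sum f ≈ 0#
  sum-zero {n} z = trans (sum-cong-≋ z) (sum-replicate-zero n)

  x*0≈0 : ∀ {y} x → y ≈ 0# → x * y ≈ 0#
  x*0≈0 x y≈0 = trans (*-congˡ y≈0) (zeroʳ x)

  0*x≈0 : ∀ {x} y → x ≈ 0# → x * y ≈ 0#
  0*x≈0 y x≈0 = trans (*-congʳ x≈0) (zeroˡ y)

  ∑-comm-*ˡ : ∀ {m n} (a : Vector Carrier m) (f : Fin m → Fin n → Carrier) →
              sum (λ j → a j * sum (f j)) ≈ sum (λ t → sum (λ j → a j * f j t))
  ∑-comm-*ˡ a f = trans (sum-cong-≋ λ j → *-distribˡ-sum (a j) (f j)) (∑-comm λ j t → a j * f j t)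

  ∑-comm-*ʳ : ∀ {m n} (a : Vector Carrier m) (f : Fin m → Fin n → Carrier) →
              sum (λ j → sum (f j) * a j) ≈ sum (λ t → sum (λ j → f j t * a j))
  ∑-comm-*ʳ a f = trans (sum-cong-≋ λ j → *-distribʳ-sum (a j) (f j)) (∑-comm λ j t → f j t * a j)

  det-cong : ∀ {n} {M N : Fin n → Fin n → Carrier} →
             (∀ i j → M i j ≈ N i j) → det M ≈ det N
  det-cong {zero}  e = refl
  det-cong {suc n} e = sum-cong-≋ λ j →
    *-congˡ {sign j} (*-cong (e zero j) (det-cong λ i l → e (suc i) (punchIn j l)))

  module _ {X : Set} where

    Congruent : ∀ {r} → ((Fin r → X → Carrier) → Carrier) → Set (c ⊔ ℓ)
    Congruent F = ∀ {v w} → (∀ i x → v i x ≈ w i x) → F v ≈ F w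

    -- Combinations of arbitrary length put additivity, homogeneity and (length zero) vanishing at
    -- the zero row into one law.
    HeadLinear : ∀ {r} → ((Fin (suc r) → X → Carrier) → Carrier) → Set (c ⊔ ℓ)
    HeadLinear F = ∀ {q} (a : Vector Carrier q) b w →
                   F (combination a b ∷ w) ≈ sum (λ j → a j * F (b j ∷ w))

    Multilinear : ∀ r → ((Fin r → X → Carrier) → Carrier) → Set (c ⊔ ℓ)
    Multilinear zero    F = ⊤
    Multilinear (suc r) F = HeadLinear F × (∀ h → Multilinear r (λ w → F (h ∷ w)))

    record IsAlternating r (F : (Fin r → X → Carrier) → Carrier) : Set (c ⊔ ℓ) where
      field
        cong        : Congruent F
        multilinear : Multilinear r F
        equalRows   : ∀ w i j → i ≢ j → (∀ x → w i x ≈ w j x) → F w ≈ 0#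

    ∷-cong : ∀ {r} {h h′ : X → Carrier} {w w′ : Fin r → X → Carrier} →
             (∀ x → h x ≈ h′ x) → (∀ i x → w i x ≈ w′ i x) →
             ∀ i x → (h ∷ w) i x ≈ (h′ ∷ w′) i x
    ∷-cong e e′ zero    = e
    ∷-cong e e′ (suc i) = e′ i

    ∷-η : ∀ {r} (w : Fin (suc r) → X → Carrier) → ∀ i x → w i x ≈ (w zero ∷ w ∘ suc) i x
    ∷-η w zero    x = refl
    ∷-η w (suc i) x = refl

    fixHead : ∀ {r F} → IsAlternating (suc r) F → ∀ h → IsAlternating r (λ w → F (h ∷ w))
    fixHead alt h = record
      { cong        = λ e → IsAlternating.cong alt (∷-cong (λ _ → refl) e)
      ; multilinear = proj₂ (IsAlternating.multilinear alt) h
      ; equalRows   = λ w i j i≢j → IsAlternating.equalRows alt (h ∷ w) (suc i) (suc j)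
                        λ { ≡.refl → i≢j ≡.refl }
      }

    module _ {r} {F : (Fin (suc r) → X → Carrier) → Carrier}
             (cong : Congruent F) (linear : HeadLinear F) where

      head-scale-+ : ∀ a u v w → F ((λ x → a * u x + v x) ∷ w) ≈ a * F (u ∷ w) + F (v ∷ w)
      head-scale-+ a u v w = begin
        F ((λ x → a * u x + v x) ∷ w)
          ≈⟨ cong (∷-cong (λ x → +-congˡ (trans (+-identityʳ _) (*-identityˡ _))) (λ _ _ → refl)) ⟨
        F (combination (a ∷ 1# ∷ []) (u ∷ v ∷ []) ∷ w)
          ≈⟨ linear (a ∷ 1# ∷ []) (u ∷ v ∷ []) w ⟩
        a * F (u ∷ w) + (1# * F (v ∷ w) + 0#)
          ≈⟨ +-congˡ (trans (+-identityʳ _) (*-identityˡ _)) ⟩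
        a * F (u ∷ w) + F (v ∷ w) ∎

      head-+ : ∀ u v w → F ((λ x → u x + v x) ∷ w) ≈ F (u ∷ w) + F (v ∷ w)
      head-+ u v w = begin
        F ((λ x → u x + v x) ∷ w)
          ≈⟨ cong (∷-cong (λ x → +-congʳ (*-identityˡ (u x))) (λ _ _ → refl)) ⟨
        F ((λ x → 1# * u x + v x) ∷ w) ≈⟨ head-scale-+ 1# u v w ⟩
        1# * F (u ∷ w) + F (v ∷ w)     ≈⟨ +-congʳ (*-identityˡ _) ⟩
        F (u ∷ w) + F (v ∷ w)          ∎

      head-0 : ∀ w {h} → (∀ x → h x ≈ 0#) → F (h ∷ w) ≈ 0#
      head-0 w z = trans (cong (∷-cong z (λ _ _ → refl))) (linear [] [] w)

    -- Polarization: expand `F (u+v ∷ u+v ∷ w) ≈ 0#` in both of the equal rows.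
    swap : ∀ {r F} → IsAlternating (suc (suc r)) F → ∀ u v w →
           F (u ∷ v ∷ w) ≈ - F (v ∷ u ∷ w)
    swap {F = F} alt u v w = +-inverseˡ-unique _ _ (begin
      F (u ∷ v ∷ w) + F (v ∷ u ∷ w)
        ≈⟨ +-cong (trans (sym (+-identityˡ _)) (+-congʳ (sym (same u)))) (trans (sym (+-identityʳ _)) (+-congˡ (sym (same v)))) ⟩
      (F (u ∷ u ∷ w) + F (u ∷ v ∷ w)) + (F (v ∷ u ∷ w) + F (v ∷ v ∷ w))
        ≈⟨ +-cong (second u) (second v) ⟨
      F (u ∷ u+v ∷ w) + F (v ∷ u+v ∷ w) ≈⟨ head-+ cong (proj₁ multilinear) u v (u+v ∷ w) ⟨
      F (u+v ∷ u+v ∷ w) ≈⟨ same u+v ⟩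
      0# ∎)
      where
      open IsAlternating alt
      u+v : X → Carrier
      u+v x = u x + v x
      same : ∀ t → F (t ∷ t ∷ w) ≈ 0#
      same t = equalRows (t ∷ t ∷ w) zero (suc zero) (λ ()) (λ _ → refl)
      second : ∀ t → F (t ∷ u+v ∷ w) ≈ F (t ∷ u ∷ w) + F (t ∷ v ∷ w)
      second t = head-+ (IsAlternating.cong (fixHead alt t)) (proj₁ (proj₂ multilinear t)) u v w

    moveToHead : ∀ {r F} → IsAlternating (suc r) F → ∀ w j →
                 F (w j ∷ w ∘ punchIn j) ≈ sign j * F w
    moveToHead {F = F} alt w zero = begin
      F (w zero ∷ w ∘ suc) ≈⟨ IsAlternating.cong alt (∷-η w) ⟨
      F w                  ≈⟨ *-identityˡ _ ⟨
      1# * F w             ∎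
    moveToHead {suc r} {F} alt w (suc j) = begin
      F (w (suc j) ∷ w ∘ punchIn (suc j))
        ≈⟨ cong (∷-cong (λ _ → refl) (∷-η _)) ⟩
      F (w (suc j) ∷ w zero ∷ w ∘ suc ∘ punchIn j) ≈⟨ swap alt _ _ _ ⟩
      - F (w zero ∷ w (suc j) ∷ w ∘ suc ∘ punchIn j)
        ≈⟨ -‿cong (moveToHead (fixHead alt (w zero)) (w ∘ suc) j) ⟩
      - (sign j * F (w zero ∷ w ∘ suc)) ≈⟨ -1*x≈-x _ ⟨
      - 1# * (sign j * F (w zero ∷ w ∘ suc)) ≈⟨ *-assoc _ _ _ ⟨
      (- 1# * sign j) * F (w zero ∷ w ∘ suc) ≈⟨ *-congˡ (cong (∷-η w)) ⟨
      (- 1# * sign j) * F w ∎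
      where open IsAlternating alt

    -- Meant for `v = b j` when `b j` already stands as a row in front: the `b j` components of the
    -- remaining rows then contribute nothing.
    absorb : ∀ {r} {F : (Fin r → X → Carrier) → Carrier} {v : X → Carrier} →
             Congruent F → Multilinear r F →
             (∀ w i → (∀ x → w i x ≈ v x) → F w ≈ 0#) →
             ∀ (a : Vector Carrier r) (u : Fin r → X → Carrier) → F (λ i x → a i * v x + u i x) ≈ F u
    absorb {zero}  cong multi vanish a u = cong λ ()
    absorb {suc r} {F} {v} cong (linear , multi) vanish a u = begin
      F (λ i x → a i * v x + u i x) ≈⟨ cong (∷-η _) ⟩
      F ((λ x → a zero * v x + u zero x) ∷ rest) ≈⟨ head-scale-+ cong linear (a zero) v (u zero) rest ⟩
      a zero * F (v ∷ rest) + F (u zero ∷ rest)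
        ≈⟨ +-congʳ (x*0≈0 (a zero) (vanish (v ∷ rest) zero (λ _ → refl))) ⟩
      0# + F (u zero ∷ rest) ≈⟨ +-identityˡ _ ⟩
      F (u zero ∷ rest)
        ≈⟨ absorb (λ e → cong (∷-cong (λ _ → refl) e)) (multi (u zero))
             (λ w i e → vanish (u zero ∷ w) (suc i) e) (a ∘ suc) (u ∘ suc) ⟩
      F (u zero ∷ u ∘ suc) ≈⟨ cong (∷-η u) ⟨
      F u ∎
      where rest = λ i x → a (suc i) * v x + u (suc i) x

    -- Expand the first row. In the term of `b j`, `absorb` removes the `b j` components of the
    -- other rows, so the induction hypothesis applies to `G` without column `j`, and the sum
    -- becomes the Laplace expansion of `det G`. Applied to minors, this makes the Plücker
    -- coordinates of two bases of one subspace proportional.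
    changeOfBasis : ∀ {r F} → IsAlternating r F → ∀ G b →
                    F (λ i → combination (G i) b) ≈ det G * F b
    changeOfBasis {zero} {F} alt G b =
      trans (IsAlternating.cong alt (λ ())) (sym (*-identityˡ _))
    changeOfBasis {suc r} {F} alt G b = begin
      F (λ i → combination (G i) b) ≈⟨ cong (∷-η _) ⟩
      F (combination (G zero) b ∷ rest) ≈⟨ proj₁ multilinear (G zero) b rest ⟩
      sum (λ j → G zero j * F (b j ∷ rest)) ≈⟨ sum-cong-≋ (λ j → *-congˡ {G zero j} (expand j)) ⟩
      sum (λ j → G zero j * (det (Gⱼ j) * (sign j * F b)))
        ≈⟨ sum-cong-≋ (λ j → solve 4 (λ g d s f → g :* (d :* (s :* f)) := (s :* (g :* d)) :* f) refl
                               (G zero j) (det (Gⱼ j)) (sign j) (F b)) ⟩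
      sum (λ j → (sign j * (G zero j * det (Gⱼ j))) * F b) ≈⟨ *-distribʳ-sum (F b) (λ j → sign j * (G zero j * det (Gⱼ j))) ⟨
      det G * F b ∎
      where
      open IsAlternating alt
      rest : Fin r → X → Carrier
      rest i = combination (G (suc i)) b
      Gⱼ : Fin (suc r) → Fin r → Fin r → Carrier
      Gⱼ j i l = G (suc i) (punchIn j l)
      expand : ∀ j → F (b j ∷ rest) ≈ det (Gⱼ j) * (sign j * F b)
      expand j = begin
        F (b j ∷ rest)
          ≈⟨ cong (∷-cong (λ _ → refl) (λ i x → sum-remove {i = j} (λ l → G (suc i) l * b l x))) ⟩
        F (b j ∷ (λ i x → G (suc i) j * b j x + combination (Gⱼ j i) (b ∘ punchIn j) x))
          ≈⟨ absorb (IsAlternating.cong altⱼ) (IsAlternating.multilinear altⱼ)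
               (λ w i e → equalRows (b j ∷ w) zero (suc i) (λ ()) (sym ∘ e))
               (λ i → G (suc i) j) (λ i → combination (Gⱼ j i) (b ∘ punchIn j)) ⟩
        F (b j ∷ (λ i → combination (Gⱼ j i) (b ∘ punchIn j)))
          ≈⟨ changeOfBasis altⱼ (Gⱼ j) (b ∘ punchIn j) ⟩
        det (Gⱼ j) * F (b j ∷ b ∘ punchIn j) ≈⟨ *-congˡ (moveToHead alt b j) ⟩
        det (Gⱼ j) * (sign j * F b) ∎
        where altⱼ = fixHead alt (b j)

  module _ {X : Set} where

    -- This is the shape of a Laplace expansion whose first row is held fixed.
    multilinear-weightedSum : ∀ r {n} (s h : Vector Carrier n) (F : Fin n → (Fin r → X → Carrier) → Carrier) →
                (∀ j → Multilinear r (F j)) →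
                Multilinear r (λ w → sum (λ j → s j * (h j * F j w)))
    multilinear-weightedSum zero    s h F multi = tt
    multilinear-weightedSum (suc r) s h F multi =
      (λ a b w → begin
        sum (λ j → s j * (h j * F j (combination a b ∷ w)))
          ≈⟨ sum-cong-≋ (λ j → *-congˡ {s j} (*-congˡ {h j} (proj₁ (multi j) a b w))) ⟩
        sum (λ j → s j * (h j * sum (λ t → a t * F j (b t ∷ w))))
          ≈⟨ sum-cong-≋ (λ j → *-assoc (s j) (h j) _) ⟨
        sum (λ j → s j * h j * sum (λ t → a t * F j (b t ∷ w)))
          ≈⟨ ∑-comm-*ˡ (λ j → s j * h j) (λ j t → a t * F j (b t ∷ w)) ⟩
        sum (λ t → sum (λ j → s j * h j * (a t * F j (b t ∷ w))))
          ≈⟨ sum-cong-≋ (λ t → sum-cong-≋ (λ j →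
               solve 4 (λ s h a f → s :* h :* (a :* f) := a :* (s :* (h :* f))) refl (s j) (h j) (a t) (F j (b t ∷ w)))) ⟩
        sum (λ t → sum (λ j → a t * (s j * (h j * F j (b t ∷ w)))))
          ≈⟨ sum-cong-≋ (λ t → sym (*-distribˡ-sum (a t) (λ j → s j * (h j * F j (b t ∷ w))))) ⟩
        sum (λ t → a t * sum (λ j → s j * (h j * F j (b t ∷ w)))) ∎)
      , λ h′ → multilinear-weightedSum r s h (λ j w → F j (h′ ∷ w)) (λ j → proj₂ (multi j) h′)

    minor-headLinear : ∀ {r} (J : Fin (suc r) → X) → HeadLinear (minor J)
    minor-headLinear J a b w = begin
      sum (λ j → sign j * (sum (λ t → a t * b t (J j)) * m j))
        ≈⟨ trans (sum-cong-≋ λ j → *-congˡ {sign j} (*-distribʳ-sum (m j) (λ t → a t * b t (J j))))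
                 (∑-comm-*ˡ sign (λ j t → a t * b t (J j) * m j)) ⟩
      sum (λ t → sum (λ j → sign j * (a t * b t (J j) * m j)))
        ≈⟨ sum-cong-≋ (λ t → sum-cong-≋ (λ j →
             solve 4 (λ s a b m → s :* (a :* b :* m) := a :* (s :* (b :* m))) refl (sign j) (a t) (b t (J j)) (m j))) ⟩
      sum (λ t → sum (λ j → a t * (sign j * (b t (J j) * m j))))
        ≈⟨ sum-cong-≋ (λ t → sym (*-distribˡ-sum (a t) (λ j → sign j * (b t (J j) * m j)))) ⟩
      sum (λ t → a t * minor J (b t ∷ w)) ∎
      where m = λ j → det (λ i l → w i (J (punchIn j l)))

    minor-multilinear : ∀ r (J : Fin r → X) → Multilinear r (minor J)
    minor-multilinear zero    J = tt
    minor-multilinear (suc r) J = minor-headLinear J , λ h →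
      multilinear-weightedSum r sign (h ∘ J) (λ j → minor (J ∘ punchIn j)) (λ j → minor-multilinear r (J ∘ punchIn j))

  -- Here `d j l` stands for a function of the ordered pair of distinct indices `j` and
  -- `punchIn j l`. The first clause compares the pairs that contain `zero`; the recursion treats
  -- those that do not.
  Symmetric : ∀ n → (Fin (suc n) → Fin n → Carrier) → Set ℓ
  Symmetric zero    d = ⊤
  Symmetric (suc n) d = (∀ l → d zero l ≈ d (suc l) zero) × Symmetric n (λ j l → d (suc j) (suc l))

  -- Leaving out two columns gives the same increasing map in either order. The abstract `G` lets
  -- the induction pass under `extendε`, which keeps column `zero`.
  symmetric-punchIn : ∀ n (G : (Fin n → Fin (suc (suc n))) → Carrier) →
                      (∀ ε ε′ → (∀ x → ε x ≡ ε′ x) → G ε ≈ G ε′) →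
                      Symmetric (suc n) (λ j l → G (λ x → punchIn j (punchIn l x)))
  symmetric-punchIn zero    G cong = (λ l → cong _ _ λ ()) , tt
  symmetric-punchIn (suc n) G cong =
      (λ l → cong _ _ λ _ → ≡.refl)
    , symmetric-resp n
        (λ j l → cong (extendε (λ x → punchIn j (punchIn l x))) (λ x → punchIn (suc j) (punchIn (suc l) x))
          λ { zero → ≡.refl ; (suc x) → ≡.refl })
        (symmetric-punchIn n (λ ε → G (extendε ε))
          (λ ε ε′ e → cong (extendε ε) (extendε ε′) λ { zero → ≡.refl ; (suc x) → ≡.cong suc (e x) }))
    where
    extendε : (Fin n → Fin (suc (suc n))) → Fin (suc n) → Fin (suc (suc (suc n)))
    extendε ε zero    = zero
    extendε ε (suc x) = suc (ε x)
    symmetric-resp : ∀ n {d d′ : Fin (suc (suc n)) → Fin (suc n) → Carrier} →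
                     (∀ j l → d j l ≈ d′ j l) → Symmetric (suc n) d → Symmetric (suc n) d′
    symmetric-resp zero    e (s , t) = (λ l → trans (sym (e _ _)) (trans (s l) (e _ _))) , tt
    symmetric-resp (suc n) e (s , t) =
      (λ l → trans (sym (e _ _)) (trans (s l) (e _ _))) , symmetric-resp n (λ j l → e (suc j) (suc l)) t

  -- The terms (0 , l) and (l + 1 , 0) cancel; the rest is the same sum for
  -- smaller n.
  doubleExpansion-cancels : ∀ n (h : Vector Carrier (suc n)) d → Symmetric n d →
    sum (λ j → sum (λ l → (sign j * sign l) * ((h j * h (punchIn j l)) * d j l))) ≈ 0#
  doubleExpansion-cancels zero    h d s = +-identityʳ _
  doubleExpansion-cancels (suc n) h d (s₀ , s) = begin
    sum (term zero) + sum (λ j → term (suc j) zero + sum (λ l → term (suc j) (suc l)))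
      ≈⟨ +-congˡ (∑-distrib-+ (λ j → term (suc j) zero) (λ j → sum (λ l → term (suc j) (suc l)))) ⟩
    sum (term zero) + (sum (λ j → term (suc j) zero) + sum (λ j → sum (λ l → term (suc j) (suc l))))
      ≈⟨ +-assoc _ _ _ ⟨
    (sum (term zero) + sum (λ j → term (suc j) zero)) + sum (λ j → sum (λ l → term (suc j) (suc l)))
      ≈⟨ +-cong
           (trans (sym (∑-distrib-+ (term zero) (λ j → term (suc j) zero))) (sum-zero cancel))
           (trans (sum-cong-≋ (λ j → sum-cong-≋ (λ l →
                     *-congʳ {(h (suc j) * h (suc (punchIn j l))) * d (suc j) (suc l)} (signs j l))))
                  (doubleExpansion-cancels n (h ∘ suc) (λ j l → d (suc j) (suc l)) s)) ⟩
    0# + 0# ≈⟨ +-identityˡ 0# ⟩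
    0# ∎
    where
    term : ∀ j l → Carrier
    term j l = (sign j * sign l) * ((h j * h (punchIn j l)) * d j l)
    signs : ∀ {p q} (j : Fin p) (l : Fin q) → (- 1# * sign j) * (- 1# * sign l) ≈ sign j * sign l
    signs j l = begin
      (- 1# * sign j) * (- 1# * sign l)
        ≈⟨ solve 3 (λ m s t → (m :* s) :* (m :* t) := (m :* m) :* (s :* t)) refl (- 1#) (sign j) (sign l) ⟩
      (- 1# * - 1#) * (sign j * sign l) ≈⟨ *-congʳ (trans (-1*x≈-x (- 1#)) (-‿involutive 1#)) ⟩
      1# * (sign j * sign l) ≈⟨ *-identityˡ _ ⟩
      sign j * sign l ∎
    cancel : ∀ l → term zero l + term (suc l) zero ≈ 0#
    cancel l = begin
      (1# * sign l) * ((h zero * h (suc l)) * d zero l) + ((- 1# * sign l) * 1#) * ((h (suc l) * h zero) * d (suc l) zero)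
        ≈⟨ +-congʳ (*-congˡ (*-congˡ (s₀ l))) ⟩
      (1# * sign l) * ((h zero * h (suc l)) * d (suc l) zero) + ((- 1# * sign l) * 1#) * ((h (suc l) * h zero) * d (suc l) zero)
        ≈⟨ solve 5 (λ m s a b d → (con 1 :* s) :* ((a :* b) :* d) :+ ((m :* s) :* con 1) :* ((b :* a) :* d)
                                  := (con 1 :+ m) :* (s :* (a :* b) :* d)) refl
             (- 1#) (sign l) (h zero) (h (suc l)) (d (suc l) zero) ⟩
      (1# + - 1#) * (sign l * (h zero * h (suc l)) * d (suc l) zero)
        ≈⟨ 0*x≈0 _ (-‿inverseʳ 1#) ⟩
      0# ∎

  det-equalHeads : ∀ {r} (h h′ : Vector Carrier (suc (suc r))) w → (∀ x → h x ≈ h′ x) → det (h ∷ h′ ∷ w) ≈ 0#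
  det-equalHeads {r} h h′ w e = begin
    det (h ∷ h′ ∷ w)
      ≈⟨ det-cong {M = h ∷ h′ ∷ w} {N = h ∷ h ∷ w}
           (λ { zero _ → refl ; (suc zero) x → sym (e x) ; (suc (suc i)) x → refl }) ⟩
    sum (λ j → sign j * (h j * sum (λ l → sign l * (h (punchIn j l) * m j l))))
      ≈⟨ sum-cong-≋ (λ j → trans (*-congˡ {sign j} (*-distribˡ-sum (h j) (λ l → sign l * (h (punchIn j l) * m j l))))
           (*-distribˡ-sum (sign j) (λ l → h j * (sign l * (h (punchIn j l) * m j l))))) ⟩
    sum (λ j → sum (λ l → sign j * (h j * (sign l * (h (punchIn j l) * m j l)))))
      ≈⟨ sum-cong-≋ (λ j → sum-cong-≋ (λ l →
           solve 5 (λ s a t b m → s :* (a :* (t :* (b :* m))) := (s :* t) :* ((a :* b) :* m)) refl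
             (sign j) (h j) (sign l) (h (punchIn j l)) (m j l))) ⟩
    sum (λ j → sum (λ l → (sign j * sign l) * ((h j * h (punchIn j l)) * m j l)))
      ≈⟨ doubleExpansion-cancels (suc r) h m
           (symmetric-punchIn r (λ ε → det (λ i x → w i (ε x)))
             (λ ε ε′ e → det-cong λ i l → reflexive (≡.cong (w i) (e l)))) ⟩
    0# ∎
    where
    m : Fin (suc (suc r)) → Fin (suc r) → Carrier
    m j l = det (λ i x → w i (punchIn j (punchIn l x)))

  EqualRowsVanish : ℕ → Set (c ⊔ ℓ)
  EqualRowsVanish r = ∀ (M : Fin r → Fin r → Carrier) i j → i ≢ j →
                      (∀ l → M i l ≈ M j l) → det M ≈ 0#

  equalTailRows : ∀ {r} → EqualRowsVanish r → (M : Fin (suc r) → Fin (suc r) → Carrier) →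
                  ∀ i j → i ≢ j → (∀ l → M (suc i) l ≈ M (suc j) l) → det M ≈ 0#
  equalTailRows ih M i j i≢j e = sum-zero λ l →
    x*0≈0 (sign l) (x*0≈0 (M zero l) (ih _ i j i≢j λ x → e (punchIn l x)))

  -- Alternation of the full determinant is still being proved, but with the first row fixed it is
  -- known by induction. This suffices to move row `suc j` up to the second place, where
  -- `det-equalHeads` applies.
  equalHeadRow : ∀ {r} → EqualRowsVanish (suc r) →
                 (M : Fin (suc (suc r)) → Fin (suc (suc r)) → Carrier) →
                 ∀ j → (∀ l → M zero l ≈ M (suc j) l) → det M ≈ 0#
  equalHeadRow {r} ih M j e = begin
    det M ≈⟨ *-identityˡ _ ⟨
    1# * det M ≈⟨ *-congʳ (sign-square j) ⟨
    (sign j * sign j) * det M ≈⟨ *-assoc _ _ _ ⟩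
    sign j * (sign j * det M)
      ≈⟨ *-congˡ (moveToHead {X = Fin (suc (suc r))} {F = λ w → det (M zero ∷ w)} tail-alternating (M ∘ suc) j) ⟨
    sign j * det (M zero ∷ M (suc j) ∷ M ∘ suc ∘ punchIn j)
      ≈⟨ x*0≈0 (sign j) (det-equalHeads (M zero) (M (suc j)) (M ∘ suc ∘ punchIn j) e) ⟩
    0# ∎
    where
    tail-alternating : IsAlternating (suc r) (λ w → det (M zero ∷ w))
    tail-alternating = record
      { cong        = λ e → det-cong {M = M zero ∷ _} {N = M zero ∷ _} (∷-cong (λ _ → refl) e)
      ; multilinear = proj₂ (minor-multilinear (suc (suc r)) (λ x → x)) (M zero)
      ; equalRows   = λ w i j → equalTailRows ih (M zero ∷ w) i j
      }

  det-equalRows : ∀ {r} → EqualRowsVanish r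
  det-equalRows M zero zero 0≢0 e = ⊥-elim (0≢0 ≡.refl)
  det-equalRows {suc (suc r)} M zero (suc j) _ e = equalHeadRow det-equalRows M j e
  det-equalRows {suc (suc r)} M (suc i) zero _ e = equalHeadRow det-equalRows M i (sym ∘ e)
  det-equalRows {suc r} M (suc i) (suc j) i≢j e = equalTailRows det-equalRows M i j (i≢j ∘ ≡.cong suc) e

  minor-alternating : ∀ {X : Set} r (J : Fin r → X) → IsAlternating r (minor J)
  minor-alternating r J = record
    { cong        = λ e → det-cong λ i l → e i (J l)
    ; multilinear = minor-multilinear r J
    ; equalRows   = λ w i j i≢j e → det-equalRows (λ i l → w i (J l)) i j i≢j (λ l → e (J l))
    }

-- Complementary columns, cofactor vectors and kernels over commutative rings

-- The index type `Fin (N ∸ r)` is literally that of a basis of a point of the Grassmannian of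
-- kernels, so kernel bases indexed by complementary columns need no cast.
record Complement {r N} (J : Fin r → Fin N) : Set where
  field
    index     : Fin (N ∸ r) → Fin N
    injective : Injective _≡_ _≡_ index
    disjoint  : ∀ i c → J i ≢ index c
    covers    : ∀ x → (∃[ i ] J i ≡ x) ⊎ (∃[ c ] index c ≡ x)

complement : ∀ {r N} (J : Fin r → Fin N) → Injective _≡_ _≡_ J → Complement J
complement {zero} J inj = record
  { index = id ; injective = id ; disjoint = λ () ; covers = λ x → inj₂ (x , ≡.refl) }
complement {suc r} {zero} J inj with () ← J zero
complement {suc r} {suc N} J inj = record
  { index     = punchIn (J zero) ∘ index
  ; injective = injective ∘ punchIn-injective (J zero) _ _
  ; disjoint  = λ
      { zero c e    → punchInᵢ≢i (J zero) (index c) (≡.sym e)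
      ; (suc i) c e → disjoint i c (punchIn-injective (J zero) _ _ (≡.trans (punchIn-punchOut (J₀≢ i)) e)) }
  ; covers    = covers′
  }
  where
  J₀≢ : ∀ i → J zero ≢ J (suc i)
  J₀≢ i e = 0≢1+n (inj e)
  open Complement (complement (λ i → punchOut (J₀≢ i))
    (λ {i} {j} e → suc-injective (inj (punchOut-injective (J₀≢ i) (J₀≢ j) e))))
  covers′ : ∀ x → (∃[ i ] J i ≡ x) ⊎ (∃[ c ] punchIn (J zero) (index c) ≡ x)
  covers′ x with J zero ≟ x
  ... | yes e = inj₁ (zero , e)
  ... | no J₀≢x with covers (punchOut J₀≢x)
  ... | inj₁ (i , e) = inj₁ (suc i ,
          ≡.trans (≡.sym (punchIn-punchOut (J₀≢ i))) (≡.trans (≡.cong (punchIn (J zero)) e) (punchIn-punchOut J₀≢x)))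
  ... | inj₂ (c , e) = inj₂ (c , ≡.trans (≡.cong (punchIn (J zero)) e) (punchIn-punchOut J₀≢x))

module CofactorVectors {c ℓ} (R : CommutativeRing c ℓ) where

  open Vector using (_∷_)
  open CommutativeRing R hiding (zero; rawRing)
  open LinearAlgebra (CommutativeRing.rawRing R)
  open RawCramer (CommutativeRing.rawRing R)
  open SemiringSum semiring using (sum; sum-cong-≋; sum-remove; *-distribʳ-sum)
  open SemiringSolver commutativeSemiring using (solve; _:=_; _:*_)
  open SetoidReasoning setoid
  open Determinant R

  cofactors-expand : ∀ {X : Set} {r} (w : Fin r → X → Carrier) U v →
                     sum (λ i → cofactors w U i * v (U i)) ≈ minor U (v ∷ w)
  cofactors-expand w U v = sum-cong-≋ λ i →
    solve 3 (λ s m x → (s :* m) :* x := s :* (x :* m)) refl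
      (sign i) (minor (U ∘ punchIn i) w) (v (U i))

  sum-δ : ∀ {N} (u : Fin N) a (v : Vector Carrier N) → sum (λ x → δ[ u , x ] a * v x) ≈ a * v u
  sum-δ zero    a v = trans (+-congˡ (sum-zero λ x → zeroˡ (v (suc x)))) (+-identityʳ _)
  sum-δ (suc u) a v = trans (+-cong (zeroˡ (v zero)) (sum-δ u a (v ∘ suc))) (+-identityˡ _)

  sum-scatter : ∀ {q N} (U : Fin q → Fin N) a v →
                sum (λ x → scatter U a x * v x) ≈ sum (λ i → a i * v (U i))
  sum-scatter U a v = begin
    sum (λ x → sum (λ i → δ[ U i , x ] a i) * v x)
      ≈⟨ ∑-comm-*ʳ v (λ x i → δ[ U i , x ] a i) ⟩
    sum (λ i → sum (λ x → δ[ U i , x ] a i * v x)) ≈⟨ sum-cong-≋ (λ i → sum-δ (U i) (a i) v) ⟩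
    sum (λ i → a i * v (U i)) ∎

  cramer-expand : ∀ {r N} (w : Fin r → Fin N → Carrier) J l v →
                  sum (λ x → cramer w J l x * v x) ≈ minor (l ∷ J) (v ∷ w)
  cramer-expand w J l v =
    trans (sum-scatter (l ∷ J) (cofactors w (l ∷ J)) v) (cofactors-expand w (l ∷ J) v)

  δ-refl : ∀ {N} (u : Fin N) a → δ[ u , u ] a ≈ a
  δ-refl u a with u ≟ u
  ... | yes _  = refl
  ... | no u≢u = ⊥-elim (u≢u ≡.refl)

  δ-≢ : ∀ {N} {u x : Fin N} a → u ≢ x → δ[ u , x ] a ≈ 0#
  δ-≢ {u = u} {x} a u≢x with u ≟ x
  ... | yes e = ⊥-elim (u≢x e)
  ... | no _  = refl

  sum-single : ∀ {n} (i : Fin n) {f : Vector Carrier n} → (∀ j → i ≢ j → f j ≈ 0#) → sum f ≈ f i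
  sum-single {suc n} i {f} z = trans (sum-remove {i = i} f)
    (trans (+-congˡ (sum-zero λ j → z _ (λ e → punchInᵢ≢i i j (≡.sym e)))) (+-identityʳ _))

  scatter-≡ : ∀ {q N} (U : Fin q → Fin N) a i → Injective _≡_ _≡_ U → scatter U a (U i) ≈ a i
  scatter-≡ U a i inj = trans
    (sum-single i {λ i′ → δ[ U i′ , U i ] a i′} λ j i≢j → δ-≢ (a j) (λ e → i≢j (≡.sym (inj e))))
    (δ-refl (U i) (a i))

  scatter-cong : ∀ {q N} (U : Fin q → Fin N) {a b} → (∀ i → a i ≈ b i) → ∀ x → scatter U a x ≈ scatter U b x
  scatter-cong U e x = sum-cong-≋ λ i → δ-cong (U i) (e i)
    where
    δ-cong : ∀ u {a b} → a ≈ b → δ[ u , x ] a ≈ δ[ u , x ] b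
    δ-cong u e with does (u ≟ x)
    ... | true  = e
    ... | false = refl

  scatter-∉ : ∀ {q N} (U : Fin q → Fin N) a x → (∀ i → U i ≢ x) → scatter U a x ≈ 0#
  scatter-∉ U a x x∉U = sum-zero λ i → δ-≢ (a i) (x∉U i)

  cramer-cong : ∀ {r N} {w w′ : Fin r → Fin N → Carrier} → (∀ i y → w i y ≈ w′ i y) →
                ∀ J l x → cramer w J l x ≈ cramer w′ J l x
  cramer-cong e J l = scatter-cong (l ∷ J) λ i → *-congˡ {sign i} (det-cong λ a b → e a ((l ∷ J) (punchIn i b)))

  combination-assoc : ∀ {X : Set} {q r} (c : Vector Carrier q) (a : Fin q → Fin r → Carrier)
                      (d : Fin r → X → Carrier) x →
                      combination c (λ j → combination (a j) d) x ≈ combination (combination c a) d x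
  combination-assoc c a d x = begin
    sum (λ j → c j * sum (λ t → a j t * d t x))
      ≈⟨ ∑-comm-*ˡ c (λ j t → a j t * d t x) ⟩
    sum (λ t → sum (λ j → c j * (a j t * d t x)))
      ≈⟨ sum-cong-≋ (λ t → sum-cong-≋ (λ j → sym (*-assoc (c j) (a j t) (d t x)))) ⟩
    sum (λ t → sum (λ j → (c j * a j t) * d t x))
      ≈⟨ sum-cong-≋ (λ t → sym (*-distribʳ-sum (d t x) (λ j → c j * a j t))) ⟩
    sum (λ t → sum (λ j → c j * a j t) * d t x) ∎

  combination-cong : ∀ {X : Set} {r} (a : Vector Carrier r) {b b′ : Fin r → X → Carrier} →
                     (∀ j x → b j x ≈ b′ j x) → ∀ x → combination a b x ≈ combination a b′ x
  combination-cong a e x = sum-cong-≋ λ j → *-congˡ {a j} (e j x)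

  minor-cong : ∀ {X : Set} {r} (J : Fin r → X) w w′ → (∀ i x → w i x ≈ w′ i x) →
               minor J w ≈ minor J w′
  minor-cong J w w′ e = det-cong λ i l → e i (J l)

  InSpan-resp : ∀ {X : Set} {r} {b : Fin r → X → Carrier} {y y′} → (∀ x → y x ≈ y′ x) →
                InSpan b y → InSpan b y′
  InSpan-resp e (a , e′) = a , λ x → trans (sym (e x)) (e′ x)

  InSpan-trans : ∀ {X : Set} {q r} {b : Fin q → X → Carrier} {d : Fin r → X → Carrier} {y} →
                 (∀ j → InSpan d (b j)) → InSpan b y → InSpan d y
  InSpan-trans {b = b} {d} s (a , e) = combination a (proj₁ ∘ s) , λ x →
    trans (e x) (trans (combination-cong a (λ j → proj₂ (s j)) x)
      (combination-assoc a (proj₁ ∘ s) d x))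

  InSpan-basis : ∀ {X : Set} {r} (b : Fin r → X → Carrier) j → InSpan b (b j)
  InSpan-basis b j = (λ i → δ[ j , i ] 1#) , λ x → sym
    (trans (sum-δ j 1# (λ i → b i x)) (*-identityˡ _))

  minor-span-zero : ∀ {X : Set} {r} {b : Fin r → X → Carrier} {y} → InSpan b y →
                    ∀ U → minor U (y ∷ b) ≈ 0#
  minor-span-zero {b = b} {y} (a , e) U = begin
    minor U (y ∷ b) ≈⟨ minor-cong U (y ∷ b) (combination a b ∷ b) (λ { zero → e ; (suc i) _ → refl }) ⟩
    minor U (combination a b ∷ b) ≈⟨ minor-headLinear U a b b ⟩
    sum (λ j → a j * minor U (b j ∷ b))
      ≈⟨ sum-zero (λ j → x*0≈0 (a j) (equalRows (b j ∷ b) zero (suc j) (λ ()) (λ _ → refl))) ⟩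
    0# ∎
    where open IsAlternating (minor-alternating _ U)

  -- Expansion along the first column. Since `det` is defined along the first row, the coefficients
  -- arise by recursion on the rows. They depend on `B` alone, so one choice serves all head columns
  -- `x`.
  det-headColumn : ∀ r (B : Fin (suc r) → Fin r → Carrier) →
                   Σ[ c ∈ Vector Carrier (suc r) ]
                   (∀ (x : Vector Carrier (suc r)) → det (λ i → x i ∷ B i) ≈ sum (λ i → c i * x i))
  det-headColumn zero B = (λ _ → 1#) , λ x → +-congʳ (*-congˡ (*-identityʳ (x zero)))
  det-headColumn (suc r) B = coefficient , λ x → +-cong
      (trans (*-identityˡ _) (*-comm (x zero) (det (B ∘ suc))))
      (begin
        sum (λ j → sign (suc j) * (B zero j * det (λ i l → (x (suc i) ∷ B (suc i)) (punchIn (suc j) l))))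
          ≈⟨ sum-cong-≋ (λ j → *-congˡ {sign (suc j)} (*-congˡ {B zero j}
               (trans (det-cong {M = λ i l → (x (suc i) ∷ B (suc i)) (punchIn (suc j) l)}
                                {N = λ i → x (suc i) ∷ B (suc i) ∘ punchIn j}
                       λ { i zero → refl ; i (suc l) → refl }) (proj₂ (ih j) (x ∘ suc))))) ⟩
        sum (λ j → sign (suc j) * (B zero j * sum (λ i → proj₁ (ih j) i * x (suc i))))
          ≈⟨ sum-cong-≋ (λ j → *-assoc (sign (suc j)) (B zero j) (sum (λ i → proj₁ (ih j) i * x (suc i)))) ⟨
        sum (λ j → sign (suc j) * B zero j * sum (λ i → proj₁ (ih j) i * x (suc i)))
          ≈⟨ ∑-comm-*ˡ (λ j → sign (suc j) * B zero j) (λ j i → proj₁ (ih j) i * x (suc i)) ⟩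
        sum (λ i → sum (λ j → sign (suc j) * B zero j * (proj₁ (ih j) i * x (suc i))))
          ≈⟨ sum-cong-≋ (λ i → sum-cong-≋ (λ j →
               solve 4 (λ s b c x → s :* b :* (c :* x) := (s :* (b :* c)) :* x) refl
                 (sign (suc j)) (B zero j) (proj₁ (ih j) i) (x (suc i)))) ⟩
        sum (λ i → sum (λ j → (sign (suc j) * (B zero j * proj₁ (ih j) i)) * x (suc i)))
          ≈⟨ sum-cong-≋ (λ i → sym (*-distribʳ-sum (x (suc i)) (λ j → sign (suc j) * (B zero j * proj₁ (ih j) i)))) ⟩
        sum (λ i → coefficient (suc i) * x (suc i)) ∎)
    where
    ih = λ j → det-headColumn r (λ i → B (suc i) ∘ punchIn j)
    coefficient : Fin (suc (suc r)) → Carrier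
    coefficient zero    = det (B ∘ suc)
    coefficient (suc i) = sum (λ j → sign (suc j) * (B zero j * proj₁ (ih j) i))

  -- Letting one index of a Plücker coordinate vary gives a vector of the subspace, which is how
  -- equations on the subspace are rewritten in Plücker coordinates.
  headColumn-InSpan : ∀ {X : Set} {r} (b : Fin (suc r) → X → Carrier) (J : Fin r → X) →
                      InSpan b (λ l → minor (l ∷ J) b)
  headColumn-InSpan b J = proj₁ expansion , λ l →
    trans (det-cong {M = λ i j → b i ((l ∷ J) j)} {N = λ i → b i l ∷ b i ∘ J}
      λ { i zero → refl ; i (suc j) → refl }) (proj₂ expansion (λ i → b i l))
    where expansion = det-headColumn _ (λ i → b i ∘ J)

  module Kernel (em : ∀ {a} → ExcludedMiddle a) (1≉0 : ¬ 1# ≈ 0#) where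

    kernelVector : ∀ {Row : Set} {N} (M : Matrix Row N) →
                   (∀ (A : Fin N → Row) → det (λ i → M (A i)) ≈ 0#) →
                   ∃[ y ] (∃[ j ] ¬ (y j ≈ 0#)) × y ∈Ker M
    kernelVector {N = zero}  M z = ⊥-elim (1≉0 (z λ ()))
    kernelVector {Row} {suc N} M z with em {P = ∃[ A ] ¬ (det {N} (λ i l → M (A i) (suc l)) ≈ 0#)}
    ... | yes (A , A≉0) = cofactors (M ∘ A) id
                        , (zero , A≉0 ∘ trans (sym (*-identityˡ _)))
                        , λ x → trans (cofactors-expand (M ∘ A) id (M x))
                                (trans (det-cong {M = M x ∷ M ∘ A} {N = λ i → M ((x ∷ A) i)}
                                           λ { zero l → refl ; (suc i) l → refl })
                                       (z (x ∷ A)))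
    ... | no none with kernelVector (λ x j → M x (suc j)) (λ A → vanish A)
      where
      vanish : ∀ (A : Fin N → Row) → det (λ i l → M (A i) (suc l)) ≈ 0#
      vanish A with em {P = det (λ i l → M (A i) (suc l)) ≈ 0#}
      ... | yes e = e
      ... | no ne = ⊥-elim (none (A , ne))
    ... | y , (j , yⱼ≉0) , y∈Ker = 0# ∷ y , (suc j , yⱼ≉0) , λ x →
            trans (+-congʳ (zeroˡ (M x zero))) (trans (+-identityˡ _) (y∈Ker x))

    independent⇒columnsMinor : ∀ {Row : Set} {N} (M : Matrix Row N) →
      LinearlyIndependent (λ j x → M x j) → ∃[ A ] ¬ (det (λ i → M (A i)) ≈ 0#)
    independent⇒columnsMinor M ind with em {P = ∃[ A ] ¬ (det (λ i → M (A i)) ≈ 0#)}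
    ... | yes p   = p
    ... | no none with kernelVector M (λ A → vanish A)
      where
      vanish : ∀ A → det (λ i → M (A i)) ≈ 0#
      vanish A with em {P = det (λ i → M (A i)) ≈ 0#}
      ... | yes e = e
      ... | no ne = ⊥-elim (none (A , ne))
    ... | y , (j , yⱼ≉0) , y∈Ker = ⊥-elim (yⱼ≉0 (ind y y∈Ker j))

-- Linear algebra over a field by means of minors

module _ {c ℓ} (R : CommutativeRing c ℓ) where

  open CommutativeRing R using (_≈_; _*_; 0#; 1#)

  Nontrivial : Set ℓ
  Nontrivial = ¬ 1# ≈ 0#

  HasInverses : Set (c ⊔ ℓ)
  HasInverses = ∀ x → ¬ x ≈ 0# → ∃[ y ] x * y ≈ 1#

module FieldLinearAlgebra
  {c ℓ} (R : CommutativeRing c ℓ)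
  (em : ∀ {a} → ExcludedMiddle a) (1≉0 : Nontrivial R) (inverse : HasInverses R)
  where

  open Vector using (_∷_)
  open CommutativeRing R hiding (zero; rawRing)
  open RingProperties ring using (+-inverseˡ-unique; -‿involutive; -1*x≈-x)
  open LinearAlgebra (CommutativeRing.rawRing R)
  open RawCramer (CommutativeRing.rawRing R)
  open SemiringSum semiring using (sum; sum-cong-≋; ∑-distrib-+; *-distribˡ-sum)
  open SemiringSolver commutativeSemiring using (solve; _:=_; _:*_)
  open SetoidReasoning setoid
  open Determinant R public
  open CofactorVectors R public
  open Kernel em 1≉0 public

  ≈0-stable : ∀ {x} → ¬ ¬ x ≈ 0# → x ≈ 0#
  ≈0-stable {x} nn with em {P = x ≈ 0#}
  ... | yes e = e
  ... | no ne = ⊥-elim (nn ne)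

  cancelʳ : ∀ {x y} → ¬ y ≈ 0# → x * y ≈ 0# → x ≈ 0#
  cancelʳ {x} {y} y≉0 e with y⁻¹ , ee ← inverse y y≉0 = begin
    x              ≈⟨ *-identityʳ x ⟨
    x * 1#         ≈⟨ *-congˡ ee ⟨
    x * (y * y⁻¹)  ≈⟨ *-assoc x y y⁻¹ ⟨
    (x * y) * y⁻¹  ≈⟨ 0*x≈0 y⁻¹ e ⟩
    0#             ∎

  cancelˡ : ∀ {x y} → ¬ x ≈ 0# → x * y ≈ 0# → y ≈ 0#
  cancelˡ x≉0 e = cancelʳ x≉0 (trans (*-comm _ _) e)

  *-≉0 : ∀ {x y} → ¬ x ≈ 0# → ¬ y ≈ 0# → ¬ x * y ≈ 0#
  *-≉0 x≉0 y≉0 e = x≉0 (cancelʳ y≉0 e)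

  sign-≉0 : ∀ {n} (j : Fin n) → ¬ sign j ≈ 0#
  sign-≉0 j e = 1≉0 (trans (sym (sign-square j)) (0*x≈0 (sign j) e))

  MinorsVanish : ∀ {Row : Set} {N} → Matrix Row N → ℕ → Set ℓ
  MinorsVanish {Row} {N} M r = ∀ (A : Fin r → Row) (J : Fin r → Fin N) → minor J (M ∘ A) ≈ 0#

  tooManyRows : ∀ {N r} (M : Matrix (Fin r) N) → MinorsVanish M (suc r)
  tooManyRows {r = r} M A J =
    let i , j , i<j , e = pigeonhole (ℕ.n<1+n r) A in
    det-equalRows (λ i l → M (A i) (J l)) i j (<⇒≢ i<j) (λ l → reflexive (≡.cong (λ x → M x (J l)) e))

  dependent : ∀ {r} (v : Fin (suc r) → Fin r → Carrier) →
              ∃[ c ] (∃[ j ] ¬ (c j ≈ 0#)) × (∀ x → combination c v x ≈ 0#)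
  dependent v = kernelVector (λ x j → v j x) λ A → tooManyRows (λ x j → v j x) A id

  dependentInSpan : ∀ {X : Set} {r} (v : Fin (suc r) → X → Carrier) (d : Fin r → X → Carrier) →
                    (∀ j → InSpan d (v j)) →
                    ∃[ c ] (∃[ j ] ¬ (c j ≈ 0#)) × (∀ x → combination c v x ≈ 0#)
  dependentInSpan v d s with c , c≉0 , e ← dependent (proj₁ ∘ s) = c , c≉0 , λ x → begin
    combination c v x ≈⟨ combination-cong c (λ j → proj₂ (s j)) x ⟩
    combination c (λ j → combination (proj₁ (s j)) d) x ≈⟨ combination-assoc c (proj₁ ∘ s) d x ⟩
    combination (combination c (proj₁ ∘ s)) d x ≈⟨ sum-zero (λ t → 0*x≈0 (d t x) (e t)) ⟩
    0# ∎

  relation⇒InSpan : ∀ {X : Set} {r} {b : Fin r → X → Carrier} {y} → LinearlyIndependent b →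
                    ∀ c → (∃[ j ] ¬ (c j ≈ 0#)) → (∀ x → combination c (y ∷ b) x ≈ 0#) → InSpan b y
  relation⇒InSpan {b = b} {y} ind c (j , cⱼ≉0) e with em {P = c zero ≈ 0#}
  ... | yes c₀≈0 = ⊥-elim (cⱼ≉0 (all-zero j))
    where
    all-zero : ∀ j → c j ≈ 0#
    all-zero zero    = c₀≈0
    all-zero (suc j) = ind (c ∘ suc) (λ x → begin
      combination (c ∘ suc) b x                 ≈⟨ +-identityˡ _ ⟨
      0# + combination (c ∘ suc) b x            ≈⟨ +-congʳ (0*x≈0 (y x) c₀≈0) ⟨
      c zero * y x + combination (c ∘ suc) b x  ≈⟨ e x ⟩
      0#                                        ∎) j
  ... | no c₀≉0 with c₀⁻¹ , ee ← inverse (c zero) c₀≉0 = (λ i → - c₀⁻¹ * c (suc i)) , λ x → begin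
    y x                                    ≈⟨ *-identityˡ _ ⟨
    1# * y x                               ≈⟨ *-congʳ (trans (*-comm _ _) ee) ⟨
    (c₀⁻¹ * c zero) * y x                  ≈⟨ *-assoc _ _ _ ⟩
    c₀⁻¹ * (c zero * y x)                  ≈⟨ *-congˡ (+-inverseˡ-unique _ _ (e x)) ⟩
    c₀⁻¹ * (- combination (c ∘ suc) b x)
      ≈⟨ trans (*-congˡ (sym (-1*x≈-x _))) (trans (sym (*-assoc _ _ _)) (*-congʳ (trans (*-comm _ _) (-1*x≈-x _)))) ⟩
    - c₀⁻¹ * combination (c ∘ suc) b x     ≈⟨ *-distribˡ-sum (- c₀⁻¹) (λ i → c (suc i) * b i x) ⟩
    sum (λ i → - c₀⁻¹ * (c (suc i) * b i x)) ≈⟨ sum-cong-≋ (λ i → sym (*-assoc (- c₀⁻¹) (c (suc i)) (b i x))) ⟩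
    combination (λ i → - c₀⁻¹ * c (suc i)) b x ∎

  -- Putting the vanishing combination in the place of row `j` gives `a j * det M` up to sign.
  rowsIndependent : ∀ {r} (M : Fin r → Fin r → Carrier) → ¬ det M ≈ 0# → LinearlyIndependent M
  rowsIndependent {suc r} M D≉0 a e j = cancelʳ D≉0 (cancelˡ (sign-≉0 j) (begin
    sign j * (a j * det M)
      ≈⟨ solve 3 (λ s a d → s :* (a :* d) := a :* (s :* d)) refl (sign j) (a j) (det M) ⟩
    a j * (sign j * det M) ≈⟨ *-congˡ (moveToHead alt M j) ⟨
    a j * F (M j ∷ M ∘ punchIn j)
      ≈⟨ sum-single j {λ t → a t * F (M t ∷ M ∘ punchIn j)} (λ t j≢t → x*0≈0 (a t)
           (equalRows (M t ∷ M ∘ punchIn j) zero (suc (punchOut j≢t)) (λ ())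
             (λ x → reflexive (≡.cong (λ i → M i x) (≡.sym (punchIn-punchOut j≢t)))))) ⟨
    sum (λ t → a t * F (M t ∷ M ∘ punchIn j))
      ≈⟨ proj₁ multilinear a M (M ∘ punchIn j) ⟨
    F (combination a M ∷ M ∘ punchIn j) ≈⟨ head-0 cong (proj₁ multilinear) (M ∘ punchIn j) e ⟩
    0# ∎))
    where
    F = minor {Fin (suc r)} id
    alt = minor-alternating (suc r) id
    open IsAlternating alt

  InSpan-square : ∀ {r} (M : Fin r → Fin r → Carrier) → ¬ det M ≈ 0# → ∀ y → InSpan M y
  InSpan-square M D≉0 y with c , c≉0 , e ← dependent (y ∷ M) =
    relation⇒InSpan (rowsIndependent M D≉0) c c≉0 e

  -- No transposition of determinants is involved: the rows span, so the coordinate functional at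
  -- `l` is a combination of rows, each of which kills `y`.
  columnsIndependent : ∀ {r} (M : Fin r → Fin r → Carrier) → ¬ det M ≈ 0# →
                       ∀ y → (∀ i → sum (λ l → y l * M i l) ≈ 0#) → ∀ l → y l ≈ 0#
  columnsIndependent M D≉0 y z l with a , e ← InSpan-square M D≉0 (λ x → δ[ l , x ] 1#) = begin
    y l ≈⟨ *-identityˡ _ ⟨
    1# * y l ≈⟨ sum-δ l 1# y ⟨
    sum (λ x → δ[ l , x ] 1# * y x) ≈⟨ sum-cong-≋ (λ x → *-congʳ {y x} (e x)) ⟩
    sum (λ x → combination a M x * y x)
      ≈⟨ ∑-comm-*ʳ y (λ x i → a i * M i x) ⟩
    sum (λ i → sum (λ x → a i * M i x * y x))
      ≈⟨ sum-cong-≋ (λ i → sum-cong-≋ (λ x → solve 3 (λ a m y → a :* m :* y := a :* (y :* m)) refl (a i) (M i x) (y x))) ⟩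
    sum (λ i → sum (λ x → a i * (y x * M i x)))
      ≈⟨ sum-cong-≋ (λ i → sym (*-distribˡ-sum (a i) (λ x → y x * M i x))) ⟩
    sum (λ i → a i * sum (λ x → y x * M i x)) ≈⟨ sum-zero (λ i → x*0≈0 (a i) (z i)) ⟩
    0# ∎

  minor⇒independent : ∀ {X : Set} {r} (b : Fin r → X → Carrier) J → ¬ minor J b ≈ 0# →
                      LinearlyIndependent b
  minor⇒independent b J D≉0 a e = rowsIndependent (λ i l → b i (J l)) D≉0 a (e ∘ J)

  -- On the `r` columns `J` the `suc r` vectors `y ∷ b` satisfy a relation. The corresponding
  -- combination `z` vanishes on `J`, so its bordered minor is `z l * minor J b`. By linearity that
  -- minor is also a combination of vanishing ones, whence `z` is zero everywhere.
  InSpan-byMinors : ∀ {X : Set} {r} (b : Fin r → X → Carrier) J → ¬ minor J b ≈ 0# →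
                    ∀ y → (∀ l → minor (l ∷ J) (y ∷ b) ≈ 0#) → InSpan b y
  InSpan-byMinors b J D≉0 y vanish with c , c≉0 , e ← dependent (λ j x → (y ∷ b) j (J x)) =
    relation⇒InSpan (minor⇒independent b J D≉0) c c≉0 λ l → cancelʳ D≉0 (begin
      z l * minor J b
        ≈⟨ trans (*-comm _ _) (*-congʳ (sym (*-identityˡ _))) ⟩
      cofactors b (l ∷ J) zero * z l ≈⟨ +-identityʳ _ ⟨
      cofactors b (l ∷ J) zero * z l + 0#
        ≈⟨ +-congˡ (sum-zero (λ i → x*0≈0 (cofactors b (l ∷ J) (suc i)) (e i))) ⟨
      sum (λ i → cofactors b (l ∷ J) i * z ((l ∷ J) i)) ≈⟨ cofactors-expand b (l ∷ J) z ⟩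
      minor (l ∷ J) (z ∷ b) ≈⟨ minor-headLinear (l ∷ J) c (y ∷ b) b ⟩
      sum (λ t → c t * minor (l ∷ J) ((y ∷ b) t ∷ b))
        ≈⟨ sum-zero (λ t → x*0≈0 (c t) (each t l)) ⟩
      0# ∎)
    where
    z = combination c (y ∷ b)
    each : ∀ t l → minor (l ∷ J) ((y ∷ b) t ∷ b) ≈ 0#
    each zero    l = vanish l
    each (suc t) l = minor-span-zero (InSpan-basis b t) (l ∷ J)

  -- A nonzero minor of the tail can be enlarged by some column; otherwise `InSpan-byMinors` would
  -- put the head in the span of the tail.
  independent⇒minor : ∀ {X : Set} {r} (b : Fin r → X → Carrier) → LinearlyIndependent b →
                      ∃[ J ] ¬ minor J b ≈ 0#
  independent⇒minor {r = zero}  b ind = (λ ()) , 1≉0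
  independent⇒minor {r = suc r} b ind = prepend (independent⇒minor (b ∘ suc) tail-independent)
    where
    tail-independent : LinearlyIndependent (b ∘ suc)
    tail-independent a e j = ind (0# ∷ a)
      (λ x → trans (+-congʳ (zeroˡ (b zero x))) (trans (+-identityˡ _) (e x))) (suc j)
    head∉span : ¬ InSpan (b ∘ suc) (b zero)
    head∉span (a , e) = 1≉0 (begin
      1#           ≈⟨ -‿involutive 1# ⟨
      - (- 1#)     ≈⟨ -‿cong (ind (- 1# ∷ a) (λ x → trans (+-cong (-1*x≈-x _) (sym (e x))) (-‿inverseˡ _)) zero) ⟩
      - 0#         ≈⟨ +-identityˡ _ ⟨
      0# + - 0#    ≈⟨ -‿inverseʳ 0# ⟩
      0#           ∎)
    prepend : ∃[ J ] ¬ minor J (b ∘ suc) ≈ 0# → ∃[ J ] ¬ minor J b ≈ 0#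
    prepend (J , D≉0) = choose em
      where
      choose : Dec (∃[ l ] ¬ minor (l ∷ J) (b zero ∷ b ∘ suc) ≈ 0#) → ∃[ J ] ¬ minor J b ≈ 0#
      choose (yes (l , ne)) = l ∷ J , λ e → ne
        (trans (minor-cong (l ∷ J) (b zero ∷ b ∘ suc) b (λ { zero _ → refl ; (suc _) _ → refl })) e)
      choose (no none) = ⊥-elim (head∉span (InSpan-byMinors (b ∘ suc) J D≉0 (b zero)
        (λ l → ≈0-stable λ ne → none (l , ne))))

  -- Equal dimensions turn one inclusion of spans into equality: `y ∷ b` consists of `suc r` vectors
  -- in the span of `r`.
  InSpan-exchange : ∀ {X : Set} {r} {b d : Fin r → X → Carrier} → LinearlyIndependent b →
                    (∀ i → InSpan d (b i)) → ∀ {y} → InSpan d y → InSpan b y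
  InSpan-exchange {b = b} {d} ind b⊆d {y} y∈d
    with c , c≉0 , e ← dependentInSpan (y ∷ b) d (λ { zero → y∈d ; (suc i) → b⊆d i }) =
    relation⇒InSpan ind c c≉0 e

  sameSpan⇒proportional : ∀ {X : Set} {r} (b b′ : Fin r → X → Carrier) → LinearlyIndependent b′ →
                          (∀ i → InSpan b (b′ i)) →
                          ∃[ u ] (¬ u ≈ 0#) × (∀ J → minor J b′ ≈ u * minor J b)
  sameSpan⇒proportional {r = r} b b′ ind b′⊆b
    with J , D≉0 ← independent⇒minor b′ ind = det G , (λ e → D≉0 (trans (scale J) (0*x≈0 _ e))) , scale
    where
    G = proj₁ ∘ b′⊆b
    scale : ∀ J → minor J b′ ≈ det G * minor J b
    scale J = trans (minor-cong J b′ (λ i → combination (G i) b) (λ i → proj₂ (b′⊆b i)))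
                    (changeOfBasis (minor-alternating r J) G b)

  -- Injectivity of the Plücker embedding: membership is tested by bordered minors, and these are
  -- expanded along `y` into minors of `b′` alone, so they scale by `u`.
  proportional⇒sameSpan : ∀ {X : Set} {r} (b b′ : Fin r → X → Carrier) → LinearlyIndependent b′ →
                          ∀ u → (∀ J → minor J b′ ≈ u * minor J b) →
                          ∀ {y} → InSpan b y → InSpan b′ y
  proportional⇒sameSpan b b′ ind u scale {y} y∈b with J , D≉0 ← independent⇒minor b′ ind =
    InSpan-byMinors b′ J D≉0 y λ l → begin
      minor (l ∷ J) (y ∷ b′) ≈⟨ cofactors-expand b′ (l ∷ J) y ⟨
      sum (λ i → (sign i * minor ((l ∷ J) ∘ punchIn i) b′) * y ((l ∷ J) i))
        ≈⟨ sum-cong-≋ (λ i → trans (*-congʳ {y ((l ∷ J) i)} (*-congˡ {sign i} (scale ((l ∷ J) ∘ punchIn i))))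
             (solve 4 (λ s u m y → (s :* (u :* m)) :* y := u :* ((s :* m) :* y)) refl
               (sign i) u (minor ((l ∷ J) ∘ punchIn i) b) (y ((l ∷ J) i)))) ⟩
      sum (λ i → u * (cofactors b (l ∷ J) i * y ((l ∷ J) i)))
        ≈⟨ *-distribˡ-sum u (λ i → cofactors b (l ∷ J) i * y ((l ∷ J) i)) ⟨
      u * sum (λ i → cofactors b (l ∷ J) i * y ((l ∷ J) i)) ≈⟨ *-congˡ (cofactors-expand b (l ∷ J) y) ⟩
      u * minor (l ∷ J) (y ∷ b) ≈⟨ x*0≈0 u (minor-span-zero y∈b (l ∷ J)) ⟩
      0# ∎

  minor-∷ : ∀ {Row : Set} {N r} (M : Matrix Row N) x (A : Fin r → Row) J →
            minor J (M x ∷ M ∘ A) ≈ minor J (M ∘ (x ∷ A))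
  minor-∷ M x A J = minor-cong J (M x ∷ M ∘ A) (M ∘ (x ∷ A)) λ { zero _ → refl ; (suc i) _ → refl }

  minor≉0⇒injectiveColumns : ∀ {X : Set} {r} (J : Fin r → X) w → ¬ minor J w ≈ 0# → Injective _≡_ _≡_ J
  minor≉0⇒injectiveColumns J w D≉0 {i} {j} e with i ≟ j
  ... | yes i≡j = i≡j
  ... | no i≢j  = ⊥-elim (1≉0 (trans (sym yᵢ≈1) (columnsIndependent (λ a l → w a (J l)) D≉0 y y∈Ker i)))
    where
    y : Vector Carrier _
    y l = δ[ i , l ] 1# + δ[ j , l ] (- 1#)
    yᵢ≈1 : y i ≈ 1#
    yᵢ≈1 = trans (+-cong (δ-refl i 1#) (δ-≢ (- 1#) (i≢j ∘ ≡.sym))) (+-identityʳ 1#)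
    y∈Ker : ∀ a → sum (λ l → y l * w a (J l)) ≈ 0#
    y∈Ker a = begin
      sum (λ l → y l * w a (J l)) ≈⟨ sum-cong-≋ (λ l → distribʳ (w a (J l)) (δ[ i , l ] 1#) (δ[ j , l ] (- 1#))) ⟩
      sum (λ l → δ[ i , l ] 1# * w a (J l) + δ[ j , l ] (- 1#) * w a (J l))
        ≈⟨ ∑-distrib-+ (λ l → δ[ i , l ] 1# * w a (J l)) (λ l → δ[ j , l ] (- 1#) * w a (J l)) ⟩
      sum (λ l → δ[ i , l ] 1# * w a (J l)) + sum (λ l → δ[ j , l ] (- 1#) * w a (J l))
        ≈⟨ +-cong (sum-δ i 1# (w a ∘ J)) (sum-δ j (- 1#) (w a ∘ J)) ⟩
      1# * w a (J i) + - 1# * w a (J j) ≈⟨ +-congˡ (*-congˡ (reflexive (≡.cong (w a) (≡.sym e)))) ⟩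
      1# * w a (J i) + - 1# * w a (J i) ≈⟨ distribʳ _ _ _ ⟨
      (1# + - 1#) * w a (J i) ≈⟨ 0*x≈0 _ (-‿inverseʳ 1#) ⟩
      0# ∎

  minor≉0⇒injectiveRows : ∀ {Row X : Set} {r} (M : Row → X → Carrier) (A : Fin r → Row) J →
                          ¬ minor J (M ∘ A) ≈ 0# → Injective _≡_ _≡_ A
  minor≉0⇒injectiveRows M A J D≉0 {i} {j} e with i ≟ j
  ... | yes i≡j = i≡j
  ... | no i≢j  = ⊥-elim (D≉0 (det-equalRows _ i j i≢j (λ l → reflexive (≡.cong (λ x → M x (J l)) e))))

  HasRank⇒minor≉0 : ∀ {Row : Set} {N r} (M : Matrix Row N) → HasRank M r →
                    ∃[ A ] Σ[ J ∈ (Fin r → Fin N) ] ¬ minor J (M ∘ A) ≈ 0#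
  HasRank⇒minor≉0 M (J , ind , _) with A , D≉0 ← independent⇒columnsMinor (λ x j → M x (J j)) ind =
    A , J , D≉0

  spanningColumns⇒MinorsVanish : ∀ {Row : Set} {N r} (M : Matrix Row N) (J : Fin r → Fin N) →
    (∀ l → InSpan (λ j x → M x (J j)) (λ x → M x l)) → MinorsVanish M (suc r)
  spanningColumns⇒MinorsVanish M J₀ span A J = ≈0-stable λ D≉0 →
    let c , (j , cⱼ≉0) , e = dependentInSpan (λ j x → M x (J j)) (λ j x → M x (J₀ j)) (span ∘ J)
    in cⱼ≉0 (columnsIndependent (λ i l → M (A i) (J l)) D≉0 c (e ∘ A) j)

  -- The cofactor vector of the rows `A` in the columns `l ∷ J` is a relation between column `l` and
  -- the columns `J`. On a row `x` it evaluates to a minor of size `suc r`, hence to zero, and its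
  -- coefficient at `l` is the given nonzero minor.
  minor≉0⇒HasRank : ∀ {Row : Set} {N r} (M : Matrix Row N) (A : Fin r → Row) (J : Fin r → Fin N) →
                    ¬ minor J (M ∘ A) ≈ 0# → MinorsVanish M (suc r) → HasRank M r
  minor≉0⇒HasRank M A J D≉0 vanish = J , ind , λ l →
    relation⇒InSpan ind (cofactors (M ∘ A) (l ∷ J))
      (zero , D≉0 ∘ trans (sym (*-identityˡ _)))
      λ x → begin
        combination (cofactors (M ∘ A) (l ∷ J)) ((λ x → M x l) ∷ (λ j x → M x (J j))) x
          ≈⟨ sum-cong-≋ (λ i → *-congˡ {cofactors (M ∘ A) (l ∷ J) i} (column l x i)) ⟩
        sum (λ i → cofactors (M ∘ A) (l ∷ J) i * M x ((l ∷ J) i)) ≈⟨ cofactors-expand (M ∘ A) (l ∷ J) (M x) ⟩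
        minor (l ∷ J) (M x ∷ M ∘ A) ≈⟨ minor-∷ M x A (l ∷ J) ⟩
        minor (l ∷ J) (M ∘ (x ∷ A)) ≈⟨ vanish (x ∷ A) (l ∷ J) ⟩
        0# ∎
    where
    ind : LinearlyIndependent (λ j x → M x (J j))
    ind a e = columnsIndependent (λ i l → M (A i) (J l)) D≉0 a (e ∘ A)
    column : ∀ l x i → ((λ x → M x l) ∷ (λ j x → M x (J j))) i x ≈ M x ((l ∷ J) i)
    column l x zero    = refl
    column l x (suc i) = refl

  Ker-combination : ∀ {Row : Set} {N r} (M : Matrix Row N) (a : Vector Carrier r) (b : Fin r → Vector Carrier N) →
                    (∀ j → b j ∈Ker M) → combination a b ∈Ker M
  Ker-combination M a b b∈Ker x = begin
    sum (λ l → sum (λ j → a j * b j l) * M x l) ≈⟨ ∑-comm-*ʳ (M x) (λ l j → a j * b j l) ⟩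
    sum (λ j → sum (λ l → a j * b j l * M x l)) ≈⟨ sum-cong-≋ (λ j → sum-cong-≋ (λ l → *-assoc (a j) (b j l) (M x l))) ⟩
    sum (λ j → sum (λ l → a j * (b j l * M x l))) ≈⟨ sum-cong-≋ (λ j → sym (*-distribˡ-sum (a j) (λ l → b j l * M x l))) ⟩
    sum (λ j → a j * sum (λ l → b j l * M x l)) ≈⟨ sum-zero (λ j → x*0≈0 (a j) (b∈Ker j x)) ⟩
    0# ∎

  Ker-resp : ∀ {Row : Set} {N} (M : Matrix Row N) {y y′ : Vector Carrier N} → (∀ l → y l ≈ y′ l) →
             y ∈Ker M → y′ ∈Ker M
  Ker-resp M e y∈Ker x = trans (sum-cong-≋ λ l → *-congʳ {M x l} (sym (e l))) (y∈Ker x)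

  InSpan⇒Ker : ∀ {Row : Set} {N r} (M : Matrix Row N) {b : Fin r → Vector Carrier N} {y} →
               (∀ j → b j ∈Ker M) → InSpan b y → y ∈Ker M
  InSpan⇒Ker M {b} b∈Ker (a , e) = Ker-resp M (sym ∘ e) (Ker-combination M a b b∈Ker)

  -- This is the reduced echelon basis with denominators cleared: on the columns outside `J` its
  -- vectors are unit vectors times the chosen minor, and all their entries are polynomials in the
  -- entries of `M`.
  module KernelBasis {Row : Set} {N r} (M : Matrix Row N) (A : Fin r → Row) (J : Fin r → Fin N)
    (C : Complement J) (D≉0 : ¬ minor J (M ∘ A) ≈ 0#) (vanish : MinorsVanish M (suc r))
    where

    open Complement C

    κ : Fin (N ∸ r) → Vector Carrier N
    κ = cramer (M ∘ A) J ∘ index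

    κ∈Ker : ∀ c → κ c ∈Ker M
    κ∈Ker c x = begin
      sum (λ l → κ c l * M x l) ≈⟨ cramer-expand (M ∘ A) J (index c) (M x) ⟩
      minor (index c ∷ J) (M x ∷ M ∘ A) ≈⟨ minor-∷ M x A (index c ∷ J) ⟩
      minor (index c ∷ J) (M ∘ (x ∷ A)) ≈⟨ vanish (x ∷ A) (index c ∷ J) ⟩
      0# ∎

    κ-index : ∀ c c′ → κ c (index c′) ≈ δ[ index c , index c′ ] (minor J (M ∘ A))
    κ-index c c′ = begin
      δ[ index c , index c′ ] (1# * minor J (M ∘ A)) + sum (λ i → δ[ J i , index c′ ] (cofactors (M ∘ A) (index c ∷ J) (suc i)))
        ≈⟨ +-cong (δ-cong (*-identityˡ _)) (sum-zero λ i → δ-≢ (cofactors (M ∘ A) (index c ∷ J) (suc i)) (disjoint i c′)) ⟩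
      δ[ index c , index c′ ] (minor J (M ∘ A)) + 0# ≈⟨ +-identityʳ _ ⟩
      δ[ index c , index c′ ] (minor J (M ∘ A)) ∎
      where
      δ-cong : ∀ {a b} → a ≈ b → δ[ index c , index c′ ] a ≈ δ[ index c , index c′ ] b
      δ-cong e with does (index c ≟ index c′)
      ... | true  = e
      ... | false = refl

    combination-κ-index : ∀ a c → combination a κ (index c) ≈ a c * minor J (M ∘ A)
    combination-κ-index a c = begin
      sum (λ c′ → a c′ * κ c′ (index c)) ≈⟨ sum-single c {λ c′ → a c′ * κ c′ (index c)} (λ c′ c≢c′ →
        x*0≈0 (a c′) (trans (κ-index c′ c) (δ-≢ _ (λ e → c≢c′ (≡.sym (injective e)))))) ⟩
      a c * κ c (index c) ≈⟨ *-congˡ (trans (κ-index c c) (δ-refl (index c) _)) ⟩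
      a c * minor J (M ∘ A) ∎

    κ-independent : LinearlyIndependent κ
    κ-independent a e c = cancelʳ D≉0 (trans (sym (combination-κ-index a c)) (e (index c)))

    -- Such a `z` is supported on `J`, where the rows `A` impose a nonsingular square system.
    Ker-supported : ∀ z → z ∈Ker M → (∀ c → z (index c) ≈ 0#) → ∀ x → z x ≈ 0#
    Ker-supported z z∈Ker z-index x = case (covers x)
      where
      z≈scatter : ∀ x → z x ≈ scatter J (z ∘ J) x
      z≈scatter x with covers x
      ... | inj₁ (i , ≡.refl) = sym (scatter-≡ J (z ∘ J) i (minor≉0⇒injectiveColumns J (M ∘ A) D≉0))
      ... | inj₂ (c , ≡.refl) = trans (z-index c) (sym (scatter-∉ J (z ∘ J) (index c) (λ i → disjoint i c)))
      z∘J≈0 : ∀ i → z (J i) ≈ 0#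
      z∘J≈0 = columnsIndependent (λ i l → M (A i) (J l)) D≉0 (z ∘ J) λ i →
        trans (sym (sum-scatter J (z ∘ J) (M (A i))))
          (Ker-resp M z≈scatter z∈Ker (A i))
      case : (∃[ i ] J i ≡ x) ⊎ (∃[ c ] index c ≡ x) → z x ≈ 0#
      case (inj₁ (i , ≡.refl)) = z∘J≈0 i
      case (inj₂ (c , ≡.refl)) = z-index c

    -- The vector `D * y` minus the combination of `κ` with coefficients `y (index c)` lies in the
    -- kernel and vanishes outside `J`, so it is zero.
    Ker⇒InSpan : ∀ {y} → y ∈Ker M → InSpan κ y
    Ker⇒InSpan {y} y∈Ker = relation⇒InSpan κ-independent (D ∷ λ c → - y (index c)) (zero , D≉0)
      (Ker-supported z (Ker-combination M (D ∷ λ c → - y (index c)) (y ∷ κ) λ { zero → y∈Ker ; (suc c) → κ∈Ker c })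
        λ c → begin
          D * y (index c) + combination (λ c → - y (index c)) κ (index c)
            ≈⟨ +-cong (*-comm _ _) (combination-κ-index (λ c → - y (index c)) c) ⟩
          y (index c) * D + - y (index c) * D ≈⟨ distribʳ D _ _ ⟨
          (y (index c) + - y (index c)) * D ≈⟨ 0*x≈0 D (-‿inverseʳ _) ⟩
          0# ∎)
      where
      D = minor J (M ∘ A)
      z = combination (D ∷ λ c → - y (index c)) (y ∷ κ)

    Ker⇒InSpan-independent : {b : Fin (N ∸ r) → Vector Carrier N} → LinearlyIndependent b →
                             (∀ j → b j ∈Ker M) → ∀ {y} → y ∈Ker M → InSpan b y
    Ker⇒InSpan-independent ind b∈Ker y∈Ker =
      InSpan-exchange ind (λ i → Ker⇒InSpan (b∈Ker i)) (Ker⇒InSpan y∈Ker)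

  -- The vectors l ↦ minor (l ∷ J) b span the row space of b.
  headColumns-perp : ∀ {N r} (b : Fin (suc r) → Vector Carrier N) → LinearlyIndependent b →
                     ∀ (w : Vector Carrier N) → (∀ (J : Fin r → Fin N) → sum (λ l → minor (l ∷ J) b * w l) ≈ 0#) →
                     ∀ (y : Vector Carrier N) → InSpan b y → sum (λ l → y l * w l) ≈ 0#
  headColumns-perp {N} {r} b ind w perp y y∈b = uncurry byMinor (independent⇒minor b ind)
    where
    tail-zero : ∀ (J : Fin (suc r) → Fin N) → sum (λ l → sum (λ i → cofactors b (l ∷ J) (suc i) * y (J i)) * w l) ≈ 0#
    tail-zero J = begin
      sum (λ l → sum (λ i → cofactors b (l ∷ J) (suc i) * y (J i)) * w l)
        ≈⟨ ∑-comm-*ʳ w (λ l i → cofactors b (l ∷ J) (suc i) * y (J i)) ⟩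
      sum (λ i → sum (λ l → cofactors b (l ∷ J) (suc i) * y (J i) * w l))
        ≈⟨ sum-zero (λ i → begin
          sum (λ l → sign (suc i) * minor ((l ∷ J) ∘ punchIn (suc i)) b * y (J i) * w l)
            ≈⟨ sum-cong-≋ (λ l → trans (*-congʳ {w l} (*-congʳ {y (J i)} (*-congˡ {sign (suc i)}
                 (det-cong {M = λ a x → b a ((l ∷ J) (punchIn (suc i) x))} {N = λ a x → b a ((l ∷ J ∘ punchIn i) x)}
                   λ { a zero → refl ; a (suc x) → refl }))))
                 (solve 4 (λ s m y w → s :* m :* y :* w := (s :* y) :* (m :* w)) refl
                   (sign (suc i)) (minor (l ∷ J ∘ punchIn i) b) (y (J i)) (w l))) ⟩
          sum (λ l → (sign (suc i) * y (J i)) * (minor (l ∷ J ∘ punchIn i) b * w l))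
            ≈⟨ *-distribˡ-sum (sign (suc i) * y (J i)) (λ l → minor (l ∷ J ∘ punchIn i) b * w l) ⟨
          (sign (suc i) * y (J i)) * sum (λ l → minor (l ∷ J ∘ punchIn i) b * w l)
            ≈⟨ x*0≈0 _ (perp (J ∘ punchIn i)) ⟩
          0# ∎) ⟩
      0# ∎
    -- The bordered minor of `y ∷ b` in the columns `l ∷ J` vanishes because `y` is in the span.
    -- Expanded along `y`, its term at column `l` is `D * y l`; each other term contains a minor of
    -- `b` with `l` among its columns and disappears on pairing with `w`.
    byMinor : ∀ (J : Fin (suc r) → Fin N) → ¬ minor J b ≈ 0# → sum (λ l → y l * w l) ≈ 0#
    byMinor J D≉0 = cancelˡ D≉0 (begin
      D * sum (λ l → y l * w l) ≈⟨ *-distribˡ-sum D (λ l → y l * w l) ⟩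
      sum (λ l → D * (y l * w l))
        ≈⟨ trans (sym (+-identityʳ _)) (+-congˡ (sym (tail-zero J))) ⟩
      sum (λ l → D * (y l * w l)) + sum (λ l → sum (λ i → cofactors b (l ∷ J) (suc i) * y (J i)) * w l)
        ≈⟨ ∑-distrib-+ (λ l → D * (y l * w l)) (λ l → sum (λ i → cofactors b (l ∷ J) (suc i) * y (J i)) * w l) ⟨
      sum (λ l → D * (y l * w l) + sum (λ i → cofactors b (l ∷ J) (suc i) * y (J i)) * w l)
        ≈⟨ sum-zero (λ l → begin
          D * (y l * w l) + sum (λ i → cofactors b (l ∷ J) (suc i) * y (J i)) * w l
            ≈⟨ +-congʳ (trans (sym (*-assoc D (y l) (w l))) (*-congʳ (*-congʳ (sym (*-identityˡ D))))) ⟩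
          cofactors b (l ∷ J) zero * y l * w l + sum (λ i → cofactors b (l ∷ J) (suc i) * y (J i)) * w l
            ≈⟨ distribʳ (w l) _ _ ⟨
          sum (λ i → cofactors b (l ∷ J) i * y ((l ∷ J) i)) * w l
            ≈⟨ 0*x≈0 (w l) (trans (cofactors-expand b (l ∷ J) y) (minor-span-zero {b = b} {y} y∈b (l ∷ J))) ⟩
          0# ∎) ⟩
      0# ∎)
      where D = minor J b

open import Data.List.Base using ([]; _∷_)
open import Data.List.Relation.Unary.All using ([]; _∷_)
open import Data.List.Relation.Unary.Any using (here; there)

-- Polynomial rings and their evaluation homomorphisms

module Evaluate {c ℓ c′ ℓ′} (R : CommutativeRing c ℓ) (A : RawRing c′ ℓ′)
  (φ : CommutativeRing.Carrier R → RawRing.Carrier A) {V : Set} (ρ : V → RawRing.Carrier A) where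

  open Polynomials R
  open RawRing A

  -- The local function of evaluate also depends on the polynomial evaluated at
  -- the outermost level; the abstraction over it makes that function nameable.
  private mutual
    evaluateWithin : Poly V → Poly V → Carrier
    evaluateWithin = _

    unfold : ∀ f → evaluate A φ (:- f) ρ ≡ - evaluateWithin (:- f) f
    unfold f with :- f
    ... | _ = ≡.refl

  private
    evaluateWithin≡ : ∀ h f → evaluateWithin h f ≡ evaluate A φ f ρ
    evaluateWithin≡ h (con a)  = ≡.refl
    evaluateWithin≡ h (var v)  = ≡.refl
    evaluateWithin≡ h (f :+ g) = ≡.cong₂ _+_
      (≡.trans (evaluateWithin≡ h f) (≡.sym (evaluateWithin≡ (f :+ g) f)))
      (≡.trans (evaluateWithin≡ h g) (≡.sym (evaluateWithin≡ (f :+ g) g)))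
    evaluateWithin≡ h (f :* g) = ≡.cong₂ _*_
      (≡.trans (evaluateWithin≡ h f) (≡.sym (evaluateWithin≡ (f :* g) f)))
      (≡.trans (evaluateWithin≡ h g) (≡.sym (evaluateWithin≡ (f :* g) g)))
    evaluateWithin≡ h (:- f) = ≡.cong -_
      (≡.trans (evaluateWithin≡ h f) (≡.sym (evaluateWithin≡ (:- f) f)))

  evaluate-+ : ∀ f g → evaluate A φ (f :+ g) ρ ≡ evaluate A φ f ρ + evaluate A φ g ρ
  evaluate-+ f g = ≡.cong₂ _+_ (evaluateWithin≡ (f :+ g) f) (evaluateWithin≡ (f :+ g) g)

  evaluate-* : ∀ f g → evaluate A φ (f :* g) ρ ≡ evaluate A φ f ρ * evaluate A φ g ρ
  evaluate-* f g = ≡.cong₂ _*_ (evaluateWithin≡ (f :* g) f) (evaluateWithin≡ (f :* g) g)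

  evaluate-neg : ∀ f → evaluate A φ (:- f) ρ ≡ - evaluate A φ f ρ
  evaluate-neg f = ≡.cong -_ (evaluateWithin≡ (:- f) f)

module PolynomialRing {c ℓ} (R : CommutativeRing c ℓ) (V : Set) where

  open Polynomials R
  private module R = CommutativeRing R

  polynomialRing : CommutativeRing c (c ⊔ ℓ)
  polynomialRing = record
    { Carrier = Poly V
    ; _≈_ = _≈ₚ_
    ; _+_ = _:+_
    ; _*_ = _:*_
    ; -_ = :-_
    ; 0# = con R.0#
    ; 1# = con R.1#
    ; isCommutativeRing = record
      { isRing = record
        { +-isAbelianGroup = record
          { isGroup = record
            { isMonoid = record
              { isSemigroup = record
                { isMagma = record
                  { isEquivalence = record { refl = ≈-refl ; sym = ≈-sym ; trans = ≈-trans }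
                  ; ∙-cong = +-cong }
                ; assoc = +-assoc }
              ; identity = +-identityˡ , λ f → ≈-trans (+-comm _ _) (+-identityˡ f) }
            ; inverse = +-inverseˡ , λ f → ≈-trans (+-comm _ _) (+-inverseˡ f)
            ; ⁻¹-cong = neg-cong }
          ; comm = +-comm }
        ; *-cong = *-cong
        ; *-assoc = *-assoc
        ; *-identity = *-identityˡ , λ f → ≈-trans (*-comm _ _) (*-identityˡ f)
        ; distrib = distribˡ
                  , λ f g h → ≈-trans (*-comm _ _) (≈-trans (distribˡ f g h) (+-cong (*-comm _ _) (*-comm _ _)))
        }
      ; *-comm = *-comm
      }
    }

module Evaluation {c ℓ c′ ℓ′} (R : CommutativeRing c ℓ) (B : CommutativeRing c′ ℓ′)
  (φ : CommutativeRing.Carrier R → CommutativeRing.Carrier B)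
  (φ-hom : IsRingHomomorphism (CommutativeRing.rawRing R) (CommutativeRing.rawRing B) φ)
  {V : Set} where

  open Polynomials R
  open PolynomialRing R V
  private
    module R = CommutativeRing R
    module B = CommutativeRing B
    module φ = IsRingHomomorphism φ-hom
    module E = Evaluate R B.rawRing φ {V}
  open SetoidReasoning B.setoid

  eval : (V → B.Carrier) → Poly V → B.Carrier
  eval ρ f = evaluate B.rawRing φ f ρ

  module _ (ρ : V → B.Carrier) where

    eval-+ : ∀ f g → eval ρ (f :+ g) B.≈ eval ρ f B.+ eval ρ g
    eval-+ f g = B.reflexive (E.evaluate-+ ρ f g)

    eval-* : ∀ f g → eval ρ (f :* g) B.≈ eval ρ f B.* eval ρ g
    eval-* f g = B.reflexive (E.evaluate-* ρ f g)

    eval-neg : ∀ f → eval ρ (:- f) B.≈ B.- eval ρ f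
    eval-neg f = B.reflexive (E.evaluate-neg ρ f)

  module _ {ρ ρ′ : V → B.Carrier} where

    eval-+-cong : ∀ f f′ g g′ → eval ρ f B.≈ eval ρ′ f′ → eval ρ g B.≈ eval ρ′ g′ →
                  eval ρ (f :+ g) B.≈ eval ρ′ (f′ :+ g′)
    eval-+-cong f f′ g g′ e e′ = B.trans (eval-+ ρ f g) (B.trans (B.+-cong e e′) (B.sym (eval-+ ρ′ f′ g′)))

    eval-*-cong : ∀ f f′ g g′ → eval ρ f B.≈ eval ρ′ f′ → eval ρ g B.≈ eval ρ′ g′ →
                  eval ρ (f :* g) B.≈ eval ρ′ (f′ :* g′)
    eval-*-cong f f′ g g′ e e′ = B.trans (eval-* ρ f g) (B.trans (B.*-cong e e′) (B.sym (eval-* ρ′ f′ g′)))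

    eval-neg-cong : ∀ f f′ → eval ρ f B.≈ eval ρ′ f′ → eval ρ (:- f) B.≈ eval ρ′ (:- f′)
    eval-neg-cong f f′ e = B.trans (eval-neg ρ f) (B.trans (B.-‿cong e) (B.sym (eval-neg ρ′ f′)))

  module _ (ρ : V → B.Carrier) where

    eval-sound : ∀ {f g} → f ≈ₚ g → eval ρ f B.≈ eval ρ g
    eval-sound ≈-refl = B.refl
    eval-sound (≈-sym e) = B.sym (eval-sound e)
    eval-sound (≈-trans e e′) = B.trans (eval-sound e) (eval-sound e′)
    eval-sound (+-cong {f} {f′} {g} {g′} e e′) = eval-+-cong f f′ g g′ (eval-sound e) (eval-sound e′)
    eval-sound (*-cong {f} {f′} {g} {g′} e e′) = eval-*-cong f f′ g g′ (eval-sound e) (eval-sound e′)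
    eval-sound (neg-cong {f} {f′} e) = eval-neg-cong f f′ (eval-sound e)
    eval-sound (+-assoc f g h) = begin
      eval ρ ((f :+ g) :+ h) ≈⟨ B.trans (eval-+ ρ (f :+ g) h) (B.+-congʳ (eval-+ ρ f g)) ⟩
      eval ρ f B.+ eval ρ g B.+ eval ρ h ≈⟨ B.+-assoc _ _ _ ⟩
      eval ρ f B.+ (eval ρ g B.+ eval ρ h) ≈⟨ B.trans (eval-+ ρ f (g :+ h)) (B.+-congˡ (eval-+ ρ g h)) ⟨
      eval ρ (f :+ (g :+ h)) ∎
    eval-sound (+-comm f g) = B.trans (eval-+ ρ f g) (B.trans (B.+-comm _ _) (B.sym (eval-+ ρ g f)))
    eval-sound (+-identityˡ f) =
      B.trans (eval-+ ρ (con R.0#) f) (B.trans (B.+-congʳ φ.0#-homo) (B.+-identityˡ _))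
    eval-sound (+-inverseˡ f) = begin
      eval ρ (:- f :+ f) ≈⟨ B.trans (eval-+ ρ (:- f) f) (B.+-congʳ (eval-neg ρ f)) ⟩
      B.- eval ρ f B.+ eval ρ f ≈⟨ B.-‿inverseˡ _ ⟩
      B.0# ≈⟨ φ.0#-homo ⟨
      φ R.0# ∎
    eval-sound (*-assoc f g h) = begin
      eval ρ ((f :* g) :* h) ≈⟨ B.trans (eval-* ρ (f :* g) h) (B.*-congʳ (eval-* ρ f g)) ⟩
      eval ρ f B.* eval ρ g B.* eval ρ h ≈⟨ B.*-assoc _ _ _ ⟩
      eval ρ f B.* (eval ρ g B.* eval ρ h) ≈⟨ B.trans (eval-* ρ f (g :* h)) (B.*-congˡ (eval-* ρ g h)) ⟨
      eval ρ (f :* (g :* h)) ∎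
    eval-sound (*-comm f g) = B.trans (eval-* ρ f g) (B.trans (B.*-comm _ _) (B.sym (eval-* ρ g f)))
    eval-sound (*-identityˡ f) =
      B.trans (eval-* ρ (con R.1#) f) (B.trans (B.*-congʳ φ.1#-homo) (B.*-identityˡ _))
    eval-sound (distribˡ f g h) = begin
      eval ρ (f :* (g :+ h)) ≈⟨ B.trans (eval-* ρ f (g :+ h)) (B.*-congˡ (eval-+ ρ g h)) ⟩
      eval ρ f B.* (eval ρ g B.+ eval ρ h) ≈⟨ B.distribˡ _ _ _ ⟩
      eval ρ f B.* eval ρ g B.+ eval ρ f B.* eval ρ h ≈⟨ B.+-cong (eval-* ρ f g) (eval-* ρ f h) ⟨
      eval ρ (f :* g) B.+ eval ρ (f :* h) ≈⟨ eval-+ ρ (f :* g) (f :* h) ⟨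
      eval ρ (f :* g :+ f :* h) ∎
    eval-sound (con-cong e) = φ.⟦⟧-cong e
    eval-sound (con-+ a b) = B.trans (φ.+-homo a b) (B.sym (eval-+ ρ (con a) (con b)))
    eval-sound (con-* a b) = B.trans (φ.*-homo a b) (B.sym (eval-* ρ (con a) (con b)))

    eval-homomorphism : IsRingHomomorphism (CommutativeRing.rawRing polynomialRing) B.rawRing (eval ρ)
    eval-homomorphism = record
      { isSemiringHomomorphism = record
        { isNearSemiringHomomorphism = record
          { +-isMonoidHomomorphism = record
            { isMagmaHomomorphism = record
              { isRelHomomorphism = record { cong = eval-sound }
              ; homo = eval-+ ρ }
            ; ε-homo = φ.0#-homo }
          ; *-homo = eval-* ρ }
        ; 1#-homo = φ.1#-homo }
      ; -‿homo = eval-neg ρ }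

  eval-cong : ∀ {ρ ρ′} → (∀ v → ρ v B.≈ ρ′ v) → ∀ f → eval ρ f B.≈ eval ρ′ f
  eval-cong e (con a) = B.refl
  eval-cong e (var v) = e v
  eval-cong e (f :+ g) = eval-+-cong f f g g (eval-cong e f) (eval-cong e g)
  eval-cong e (f :* g) = eval-*-cong f f g g (eval-cong e f) (eval-cong e g)
  eval-cong e (:- f) = eval-neg-cong f f (eval-cong e f)

module RingHomomorphism {a ℓ c′ ℓ′} {A : RawRing a ℓ} (B : CommutativeRing c′ ℓ′)
  {h : RawRing.Carrier A → CommutativeRing.Carrier B}
  (h-hom : IsRingHomomorphism A (CommutativeRing.rawRing B) h) where

  private
    module A = RawRing A
    module B where
      open CommutativeRing B public
      open LinearAlgebra (CommutativeRing.rawRing B) public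
      open RawCramer (CommutativeRing.rawRing B) public
      open RawSemiringDefs (RawRing.rawSemiring (CommutativeRing.rawRing B)) public using (sum)
    module C where
      open LinearAlgebra A public
      open RawCramer A public
      open RawSemiringDefs A.rawSemiring public using (sum)
  open IsRingHomomorphism h-hom
  open SemiringSum B.semiring using (sum-cong-≋)

  sum-homo : ∀ {n} (f : Vector A.Carrier n) → h (C.sum f) B.≈ B.sum (h ∘ f)
  sum-homo {zero}  f = 0#-homo
  sum-homo {suc n} f = B.trans (+-homo _ _) (B.+-congˡ (sum-homo (f ∘ suc)))

  sign-homo : ∀ {n} (j : Fin n) → h (C.sign j) B.≈ B.sign j
  sign-homo zero    = 1#-homo
  sign-homo (suc j) = B.trans (*-homo _ _)
    (B.*-cong (B.trans (-‿homo _) (B.-‿cong 1#-homo)) (sign-homo j))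

  det-homo : ∀ {n} (M : Fin n → Fin n → A.Carrier) → h (C.det M) B.≈ B.det (λ i j → h (M i j))
  det-homo {zero}  M = 1#-homo
  det-homo {suc n} M = B.trans (sum-homo (λ j → C.sign j A.* (M zero j A.* C.det (λ i l → M (suc i) (punchIn j l)))))
    (sum-cong-≋ λ j → B.trans (*-homo _ _) (B.*-cong (sign-homo j)
      (B.trans (*-homo _ _) (B.*-congˡ {h (M zero j)} (det-homo (λ i l → M (suc i) (punchIn j l)))))))

  scatter-homo : ∀ {q N} (U : Fin q → Fin N) a x → h (C.scatter U a x) B.≈ B.scatter U (h ∘ a) x
  scatter-homo U a x = B.trans (sum-homo (λ i → C.δ[ U i , x ] a i)) (sum-cong-≋ λ i → δ-homo (U i) (a i))
    where
    δ-homo : ∀ u a → h (C.δ[ u , x ] a) B.≈ B.δ[ u , x ] h a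
    δ-homo u a with does (u ≟ x)
    ... | true  = B.refl
    ... | false = 0#-homo

  cramer-homo : ∀ {r N} (w : Fin r → Fin N → A.Carrier) J l x →
                h (C.cramer w J l x) B.≈ B.cramer (λ i y → h (w i y)) J l x
  cramer-homo w J l x = B.trans (scatter-homo U (C.cofactors w U) x) (scatter-cong U (λ i →
    B.trans (*-homo _ _) (B.*-cong (sign-homo i) (det-homo (λ i′ l′ → w i′ (U (punchIn i l′)))))) x)
    where
    U = l Vector.∷ J
    open CofactorVectors B using (scatter-cong)

-- Polynomials on lines, their zeros, and polynomial identities over infinite fields

-- Univariate polynomials as lists of coefficients, constant term first.
module CoefficientLists {c ℓ} (R : CommutativeRing c ℓ) where

  open CommutativeRing R hiding (zero; rawRing)
  open RingProperties ring using (-1*x≈-x)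
  open SemiringSolver commutativeSemiring using (solve; _:=_; _:+_; _:*_)
  open SetoidReasoning setoid

  value : List Carrier → Carrier → Carrier
  value []      x = 0#
  value (a ∷ p) x = a + x * value p x

  add : List Carrier → List Carrier → List Carrier
  add []      q       = q
  add (a ∷ p) []      = a ∷ p
  add (a ∷ p) (b ∷ q) = a + b ∷ add p q

  multiply : List Carrier → List Carrier → List Carrier
  multiply []      q = []
  multiply (a ∷ p) q = add (List.map (a *_) q) (0# ∷ multiply p q)

  value-add : ∀ p q x → value (add p q) x ≈ value p x + value q x
  value-add []      q       x = sym (+-identityˡ _)
  value-add (a ∷ p) []      x = sym (+-identityʳ _)
  value-add (a ∷ p) (b ∷ q) x = begin
    a + b + x * value (add p q) x         ≈⟨ +-congˡ (*-congˡ (value-add p q x)) ⟩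
    a + b + x * (value p x + value q x)
      ≈⟨ solve 5 (λ a b x p q → a :+ b :+ x :* (p :+ q) := (a :+ x :* p) :+ (b :+ x :* q)) refl a b x _ _ ⟩
    (a + x * value p x) + (b + x * value q x) ∎

  value-scale : ∀ a q x → value (List.map (a *_) q) x ≈ a * value q x
  value-scale a []      x = sym (zeroʳ a)
  value-scale a (b ∷ q) x = begin
    a * b + x * value (List.map (a *_) q) x ≈⟨ +-congˡ (*-congˡ (value-scale a q x)) ⟩
    a * b + x * (a * value q x)
      ≈⟨ solve 4 (λ a b x q → a :* b :+ x :* (a :* q) := a :* (b :+ x :* q)) refl a b x _ ⟩
    a * (b + x * value q x) ∎

  value-multiply : ∀ p q x → value (multiply p q) x ≈ value p x * value q x
  value-multiply []      q x = sym (zeroˡ _)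
  value-multiply (a ∷ p) q x = begin
    value (add (List.map (a *_) q) (0# ∷ multiply p q)) x ≈⟨ value-add (List.map (a *_) q) (0# ∷ multiply p q) x ⟩
    value (List.map (a *_) q) x + (0# + x * value (multiply p q) x)
      ≈⟨ +-cong (value-scale a q x) (trans (+-identityˡ _) (*-congˡ (value-multiply p q x))) ⟩
    a * value q x + x * (value p x * value q x)
      ≈⟨ solve 4 (λ a x p q → a :* q :+ x :* (p :* q) := (a :+ x :* p) :* q) refl a x _ _ ⟩
    (a + x * value p x) * value q x ∎

  -- Horner's scheme: the coefficients of the quotient by `x - r` are the intermediate values at
  -- `r`.
  quotient : List Carrier → Carrier → List Carrier
  quotient []          r = []
  quotient (a ∷ [])    r = []
  quotient (a ∷ b ∷ p) r = value (b ∷ p) r ∷ quotient (b ∷ p) r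

  length-quotient : ∀ a p r → List.length (quotient (a ∷ p) r) ≡ List.length p
  length-quotient a []      r = ≡.refl
  length-quotient a (b ∷ p) r = ≡.cong suc (length-quotient b p r)

  value-quotient : ∀ p r x → value p x ≈ value p r + (x - r) * value (quotient p r) x
  value-quotient []       r x = sym (trans (+-identityˡ _) (zeroʳ _))
  value-quotient (a ∷ []) r x =
    trans (trans (+-congˡ (zeroʳ x)) (sym (+-congˡ (zeroʳ r)))) (sym (trans (+-congˡ (zeroʳ _)) (+-identityʳ _)))
  value-quotient (a ∷ b ∷ p) r x = begin
    a + x * P x                          ≈⟨ +-congˡ (*-congˡ (value-quotient (b ∷ p) r x)) ⟩
    a + x * (P r + (x - r) * Q)
      ≈⟨ solve 5 (λ a x r d q → a :+ x :* (r :+ d :* q) := a :+ x :* r :+ d :* (x :* q)) refl a x (P r) (x - r) Q ⟩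
    a + x * P r + (x - r) * (x * Q)
      ≈⟨ +-congʳ (+-congˡ (*-congʳ (trans (sym (+-identityʳ x)) (trans (+-congˡ (sym (-‿inverseˡ r))) (sym (+-assoc _ _ _)))))) ⟩
    a + ((x - r) + r) * P r + (x - r) * (x * Q)
      ≈⟨ solve 6 (λ a d r p x q → a :+ (d :+ r) :* p :+ d :* (x :* q) := a :+ r :* p :+ d :* (p :+ x :* q)) refl
           a (x - r) r (P r) x Q ⟩
    a + r * P r + (x - r) * (P r + x * Q) ∎
    where
    P = value (b ∷ p)
    Q = value (quotient (b ∷ p) r) x

  -- A predicate on functions rather than a syntax, so that minors and Cramer vectors over `Ω` can
  -- be treated as they are, and with coefficients anywhere in `Ω`, for example in a kernel basis
  -- that depends on a point.
  data IsPolynomial {V : Set} : ((V → Carrier) → Carrier) → Set (c ⊔ ℓ) where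
    const : ∀ a → IsPolynomial (λ _ → a)
    coordinate : ∀ v → IsPolynomial (λ t → t v)
    _⊕_ : ∀ {f g} → IsPolynomial f → IsPolynomial g → IsPolynomial (λ t → f t + g t)
    _⊗_ : ∀ {f g} → IsPolynomial f → IsPolynomial g → IsPolynomial (λ t → f t * g t)
    resp : ∀ {f g} → (∀ t → f t ≈ g t) → IsPolynomial f → IsPolynomial g

  module _ {V : Set} where

    IsPolynomial-cong : {f : (V → Carrier) → Carrier} → IsPolynomial f →
                        ∀ {t t′} → (∀ v → t v ≈ t′ v) → f t ≈ f t′
    IsPolynomial-cong (const a)  e = refl
    IsPolynomial-cong (coordinate v)  e = e v
    IsPolynomial-cong (f ⊕ g) e = +-cong (IsPolynomial-cong f e) (IsPolynomial-cong g e)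
    IsPolynomial-cong (f ⊗ g) e = *-cong (IsPolynomial-cong f e) (IsPolynomial-cong g e)

    IsPolynomial-cong (resp e f) e′ = trans (sym (e _)) (trans (IsPolynomial-cong f e′) (e _))

    restrictToLine : {f : (V → Carrier) → Carrier} → IsPolynomial f → ∀ (a b : V → Carrier) →
                     ∃[ p ] (∀ x → value p x ≈ f (λ v → a v + x * b v))
    restrictToLine (const c) a b = c ∷ [] , λ x → trans (+-congˡ (zeroʳ x)) (+-identityʳ c)
    restrictToLine (coordinate v) a b = a v ∷ b v ∷ [] , λ x →
      +-congˡ (*-congˡ (trans (+-congˡ (zeroʳ x)) (+-identityʳ (b v))))
    restrictToLine (f ⊕ g) a b with restrictToLine f a b | restrictToLine g a b
    ... | p , e | q , e′ = add p q , λ x → trans (value-add p q x) (+-cong (e x) (e′ x))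
    restrictToLine (f ⊗ g) a b with restrictToLine f a b | restrictToLine g a b
    ... | p , e | q , e′ = multiply p q , λ x → trans (value-multiply p q x) (*-cong (e x) (e′ x))

    restrictToLine (resp e f) a b with restrictToLine f a b
    ... | p , e′ = p , λ x → trans (e′ x) (e _)

    open RawCramer (CommutativeRing.rawRing R)
    open LinearAlgebra (CommutativeRing.rawRing R) using (det)
    open SemiringSum semiring using (sum)

    IsPolynomial-neg : {f : (V → Carrier) → Carrier} → IsPolynomial f → IsPolynomial (λ t → - f t)
    IsPolynomial-neg {f} p = resp (λ t → -1*x≈-x (f t)) (const (- 1#) ⊗ p)

    IsPolynomial-sum : ∀ {n} {f : Fin n → (V → Carrier) → Carrier} → (∀ i → IsPolynomial (f i)) →
                       IsPolynomial (λ t → sum (λ i → f i t))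
    IsPolynomial-sum {zero}  p = const 0#
    IsPolynomial-sum {suc n} p = p zero ⊕ IsPolynomial-sum (p ∘ suc)

    IsPolynomial-det : ∀ {n} {M : Fin n → Fin n → (V → Carrier) → Carrier} →
                       (∀ i j → IsPolynomial (M i j)) → IsPolynomial (λ t → det (λ i j → M i j t))
    IsPolynomial-det {zero}  p = const 1#
    IsPolynomial-det {suc n} p = IsPolynomial-sum λ j →
      const (sign j) ⊗ (p zero j ⊗ IsPolynomial-det (λ i l → p (suc i) (punchIn j l)))

    IsPolynomial-scatter : ∀ {q N} (U : Fin q → Fin N) {a : Fin q → (V → Carrier) → Carrier} →
                           (∀ i → IsPolynomial (a i)) → ∀ x → IsPolynomial (λ t → scatter U (λ i → a i t) x)
    IsPolynomial-scatter U {a} p x = IsPolynomial-sum {f = λ i t → δ[ U i , x ] a i t} δ-polynomial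
      where
      δ-polynomial : ∀ i → IsPolynomial (λ t → δ[ U i , x ] a i t)
      δ-polynomial i with does (U i ≟ x)
      ... | true  = p i
      ... | false = const 0#

    IsPolynomial-cramer : ∀ {r N} {w : Fin r → Fin N → (V → Carrier) → Carrier} →
                          (∀ i y → IsPolynomial (w i y)) →
                          ∀ J l x → IsPolynomial (λ t → cramer (λ i y → w i y t) J l x)
    IsPolynomial-cramer p J l = IsPolynomial-scatter (l Vector.∷ J) λ i →
      const (sign i) ⊗ IsPolynomial-det (λ i′ l′ → p i′ ((l Vector.∷ J) (punchIn i l′)))

-- The test points form a type `P` of their own. With `P` the carrier of `K` inside `Ω`,
-- nonvanishing over `Ω` yields nonvanishing at parameters from `K`; with `P` the carrier of `R`,
-- polynomial functions determine their coefficients.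
module FinitelyManyZeros
  {c ℓ} (R : CommutativeRing c ℓ)
  (em : ∀ {a} → ExcludedMiddle a) (1≉0 : Nontrivial R) (inverse : HasInverses R)
  {p q} {P : Set p} (_∼_ : P → P → Set q) (point : P → CommutativeRing.Carrier R)
  (point-injective : ∀ {x y} → CommutativeRing._≈_ R (point x) (point y) → x ∼ y)
  (infinite : ∀ (xs : List P) → ∃[ x ] ListAll.All (λ y → ¬ x ∼ y) xs)
  where

  open CommutativeRing R hiding (zero; rawRing)
  open RingProperties ring using (x∙y⁻¹≈ε⇒x≈y)
  open FieldLinearAlgebra R em 1≉0 inverse using (cancelˡ; *-≉0; x*0≈0; ≈0-stable)
  open CoefficientLists R
  open SetoidReasoning setoid

  -- Each zero found is divided out. The bound `m` makes the recursion structural, since the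
  -- quotient is not a sublist of `p`.
  finitelyManyZeros : ∀ m p → List.length p ℕ.≤ m → ∃[ x ] ¬ value p x ≈ 0# →
                      ∃[ zs ] (∀ k → value p (point k) ≈ 0# → Any (k ∼_) zs)
  finitelyManyZeros m []      _ (x , ne) = ⊥-elim (ne refl)
  finitelyManyZeros (suc m) (a ∷ p) (s≤s p≤m) (x , ne) = decide em
    where
    decide : Dec (∃[ k ] value (a ∷ p) (point k) ≈ 0#) →
             ∃[ zs ] (∀ k → value (a ∷ p) (point k) ≈ 0# → Any (k ∼_) zs)
    decide (no none)      = [] , λ k e → ⊥-elim (none (k , e))
    decide (yes (k₀ , e₀)) = k₀ ∷ proj₁ zeros , λ k e → split k e em
      where
      factor : ∀ x → value (a ∷ p) x ≈ (x - point k₀) * value (quotient (a ∷ p) (point k₀)) x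
      factor x = trans (value-quotient (a ∷ p) (point k₀) x) (trans (+-congʳ e₀) (+-identityˡ _))
      zeros = finitelyManyZeros m (quotient (a ∷ p) (point k₀))
        (≡.subst (ℕ._≤ m) (≡.sym (length-quotient a p (point k₀))) p≤m)
        (x , λ e → ne (trans (factor x) (x*0≈0 _ e)))
      split : ∀ k → value (a ∷ p) (point k) ≈ 0# → Dec (k ∼ k₀) → Any (k ∼_) (k₀ ∷ proj₁ zeros)
      split k e (yes k∼k₀) = here k∼k₀
      split k e (no k≁k₀)  = there (proj₂ zeros k
        (cancelˡ (λ z → k≁k₀ (point-injective (x∙y⁻¹≈ε⇒x≈y _ _ z))) (trans (sym (factor (point k))) e)))

  avoidZeros : ∀ p → ∃[ x ] ¬ value p x ≈ 0# → ∀ ys →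
               ∃[ k ] (¬ value p (point k) ≈ 0#) × ListAll.All (λ y → ¬ k ∼ y) ys
  avoidZeros p ne ys =
    let zs , isZero = finitelyManyZeros (List.length p) p ℕ.≤-refl ne
        k , k∉ = infinite (zs ++ ys)
    in k , (λ e → ListAll.All¬⇒¬Any (ListAll.++⁻ˡ zs k∉) (isZero k e)) , ListAll.++⁻ʳ zs k∉

  -- The constant term is the value at `0#`. The rest then vanishes away from `0#`, and if it were
  -- nonzero anywhere, it would be nonzero at some test point other than `0#`.
  vanishing⇒coefficients≈0 : ∀ p → (∀ x → value p x ≈ 0#) → ListAll.All (_≈ 0#) p
  vanishing⇒coefficients≈0 []      _ = []
  vanishing⇒coefficients≈0 (a ∷ p) z = a≈0 ∷ vanishing⇒coefficients≈0 p (λ x → ≈0-stable λ ne → absurd (x , ne) em)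
    where
    a≈0 : a ≈ 0#
    a≈0 = trans (sym (trans (+-congˡ (zeroˡ _)) (+-identityʳ a))) (z 0#)
    p-vanishes : ∀ x → ¬ x ≈ 0# → value p x ≈ 0#
    p-vanishes x x≉0 = cancelˡ x≉0 (begin
      x * value p x     ≈⟨ trans (+-congʳ a≈0) (+-identityˡ _) ⟨
      a + x * value p x ≈⟨ z x ⟩
      0#                ∎)
    absurd : ∃[ x ] ¬ value p x ≈ 0# → ¬ Dec (∃[ k ] point k ≈ 0#)
    absurd ne (yes (k₀ , e₀)) with avoidZeros p ne (k₀ ∷ [])
    ... | k , p≉0 , k≁k₀ ∷ [] = p≉0 (p-vanishes (point k) λ e → k≁k₀ (point-injective (trans e (sym e₀))))
    absurd ne (no none) with avoidZeros p ne []
    ... | k , p≉0 , _ = p≉0 (p-vanishes (point k) λ e → none (k , e))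

  module _ {V : Set} where

    -- Irreducibility of affine space. On the line from `t₁` to `t₂` the first factor is nonzero at
    -- parameter `0#` and the second at `1#`; a test point avoids the finitely many zeros of both.
    nonvanishing-* : ∀ {f g : (V → Carrier) → Carrier} → IsPolynomial f → IsPolynomial g →
                     ∃[ t ] ¬ f t ≈ 0# → ∃[ t ] ¬ g t ≈ 0# → ∃[ t ] ¬ f t * g t ≈ 0#
    nonvanishing-* {f} {g} f-poly g-poly (t₁ , f≉0) (t₂ , g≉0)
      with restrictToLine f-poly t₁ (λ v → t₂ v - t₁ v) | restrictToLine g-poly t₁ (λ v → t₂ v - t₁ v)
    ... | p , p-value | q , q-value
      with zs , isZero ← finitelyManyZeros (List.length p) p ℕ.≤-refl (0# , λ e → f≉0 (begin
             f t₁ ≈⟨ IsPolynomial-cong f-poly (λ v → trans (+-congˡ (zeroˡ _)) (+-identityʳ _)) ⟨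
             f (λ v → t₁ v + 0# * (t₂ v - t₁ v)) ≈⟨ p-value 0# ⟨
             value p 0# ≈⟨ e ⟩
             0# ∎))
      with k , q≉0 , k∉ ← avoidZeros q (1# , λ e → g≉0 (begin
             g t₂ ≈⟨ IsPolynomial-cong g-poly (λ v → trans (+-congˡ (*-identityˡ _)) (trans (+-comm _ _)
                       (trans (+-assoc _ _ _) (trans (+-congˡ (-‿inverseˡ _)) (+-identityʳ _))))) ⟨
             g (λ v → t₁ v + 1# * (t₂ v - t₁ v)) ≈⟨ q-value 1# ⟨
             value q 1# ≈⟨ e ⟩
             0# ∎)) zs
      = (λ v → t₁ v + point k * (t₂ v - t₁ v))
      , *-≉0 (λ e → ListAll.All¬⇒¬Any k∉ (isZero k (trans (p-value (point k)) e)))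
             (λ e → q≉0 (trans (q-value (point k)) e))

    -- One coordinate is replaced at a time. With the others frozen, `f` is a univariate polynomial
    -- that is nonzero at the old value of `v`, hence nonzero at some test point.
    replaceByPoints : ∀ {f : (V → Carrier) → Carrier} → IsPolynomial f → ∃[ t ] ¬ f t ≈ 0# → ∀ (vs : List V) →
                      ∃[ t ] (¬ f t ≈ 0#) × (∀ v → v ∈ vs → ∃[ k ] t v ≈ point k)
    replaceByPoints f-poly (t , f≉0) [] = t , f≉0 , λ _ ()
    replaceByPoints {f} f-poly f≉0 (v ∷ vs) with replaceByPoints f-poly f≉0 vs
    ... | t , ne , onPoints = result (restrictToLine f-poly a b)
      where
      isv : ∀ w → Dec (w ≡ v)
      isv w = em
      a b : V → Carrier
      a w = if does (isv w) then 0# else t w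
      b w = if does (isv w) then 1# else 0#
      result : ∃[ p ] (∀ x → value p x ≈ f (λ v → a v + x * b v)) →
               ∃[ t ] (¬ f t ≈ 0#) × (∀ w → w ∈ v ∷ vs → ∃[ k ] t w ≈ point k)
      result (p , p-value) =
        (λ w → a w + point k * b w) , (λ e → p≉0 (trans (p-value (point k)) e)) , onPoints′
        where
        atOld : ∀ w → a w + t v * b w ≈ t w
        atOld w with isv w
        ... | yes ≡.refl = trans (+-identityˡ _) (*-identityʳ _)
        ... | no _       = trans (+-congˡ (zeroʳ _)) (+-identityʳ _)
        nonzero : ∃[ k ] (¬ value p (point k) ≈ 0#) × ListAll.All (λ y → ¬ k ∼ y) []
        nonzero = avoidZeros p (t v , λ e → ne (trans (sym (IsPolynomial-cong f-poly atOld)) (trans (sym (p-value (t v))) e))) []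
        k   = proj₁ nonzero
        p≉0 = proj₁ (proj₂ nonzero)
        onPoints′ : ∀ w → w ∈ v ∷ vs → ∃[ k′ ] a w + point k * b w ≈ point k′
        onPoints′ w w∈ with isv w
        ... | yes _   = k , trans (+-identityˡ _) (*-identityʳ _)
        ... | no w≢v with w∈
        ...   | here w≡v = ⊥-elim (w≢v w≡v)
        ...   | there w∈vs with k′ , e ← onPoints w w∈vs = k′ , trans (+-congˡ (zeroʳ _)) (trans (+-identityʳ _) e)

    nonvanishingAtPoint : ∀ {f : (V → Carrier) → Carrier} → IsPolynomial f →
                          ∀ (vs : List V) → (∀ v → v ∈ vs) →
                          ∃[ t ] ¬ f t ≈ 0# → ∃[ k ] ¬ f (λ v → point (k v)) ≈ 0#
    nonvanishingAtPoint {f} f-poly vs v∈vs f≉0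
      with t , ne , onPoints ← replaceByPoints f-poly f≉0 vs
      = (λ v → proj₁ (onPoints v (v∈vs v)))
      , λ e → ne (trans (IsPolynomial-cong f-poly (λ v → proj₂ (onPoints v (v∈vs v)))) e)

-- Over an infinite field a polynomial that vanishes identically as a function
-- is zero: read it as a univariate polynomial in one variable after another.
module Completeness
  {c ℓ} (R : CommutativeRing c ℓ)
  (em : ∀ {a} → ExcludedMiddle a) (1≉0 : Nontrivial R) (inverse : HasInverses R)
  (infinite : ∀ (xs : List (CommutativeRing.Carrier R)) → ∃[ x ] ListAll.All (λ y → ¬ CommutativeRing._≈_ R x y) xs)
  {V : Set}
  where

  open CommutativeRing R hiding (zero; rawRing)
  open FinitelyManyZeros R em 1≉0 inverse _≈_ id id infinite using (vanishing⇒coefficients≈0)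
  open Polynomials R using (Poly; con; var; _:+_; _:*_; :-_; _≈ₚ_; con-cong)
  open PolynomialRing R V
  private module S = CommutativeRing polynomialRing
  open RingProperties S.ring using () renaming (-1*x≈-x to -1*f≈-f)
  open CoefficientLists polynomialRing using (value; add; multiply; value-add; value-scale; value-multiply)
  private module L = CoefficientLists R

  id-homomorphism : IsRingHomomorphism (CommutativeRing.rawRing R) (CommutativeRing.rawRing R) id
  id-homomorphism = Identity.isRingHomomorphism (CommutativeRing.rawRing R) refl

  open Evaluation R R id id-homomorphism {V}

  -- Occurrence of variables is tracked on terms, not on classes modulo `≈ₚ`. The induction
  -- eliminates one variable at a time, and the coefficient terms must visibly lack the eliminated
  -- one.
  data Within (Q : V → Set) : Poly V → Set c where
    con  : ∀ a → Within Q (con a)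
    var  : ∀ {v} → Q v → Within Q (var v)
    _:+_ : ∀ {f g} → Within Q f → Within Q g → Within Q (f :+ g)
    _:*_ : ∀ {f g} → Within Q f → Within Q g → Within Q (f :* g)
    :-_  : ∀ {f} → Within Q f → Within Q (:- f)

  within-all : ∀ {Q : V → Set} → (∀ v → Q v) → ∀ f → Within Q f
  within-all q (con a)  = con a
  within-all q (var v)  = var (q v)
  within-all q (f :+ g) = within-all q f :+ within-all q g
  within-all q (f :* g) = within-all q f :* within-all q g
  within-all q (:- f)   = :- within-all q f

  within-eval : ∀ {Q : V → Set} {ρ ρ′} → (∀ v → Q v → ρ v ≈ ρ′ v) → ∀ {f} → Within Q f → eval ρ f ≈ eval ρ′ f
  within-eval e (con a) = refl
  within-eval e (var q) = e _ q
  within-eval e (_:+_ {f} {g} p q) = eval-+-cong f f g g (within-eval e p) (within-eval e q)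
  within-eval e (_:*_ {f} {g} p q) = eval-*-cong f f g g (within-eval e p) (within-eval e q)
  within-eval e (:-_ {f} p) = eval-neg-cong f f (within-eval e p)

  within-∅ : ∀ {Q : V → Set} → (∀ v → ¬ Q v) → ∀ {f} → Within Q f → ∃[ a ] f ≈ₚ con a
  within-∅ q (con a) = a , S.refl
  within-∅ q (var v∈) = ⊥-elim (q _ v∈)
  within-∅ q (p :+ p′) with within-∅ q p | within-∅ q p′
  ... | a , e | b , e′ = a + b , S.trans (S.+-cong e e′) (S.sym (Polynomials.con-+ a b))
  within-∅ q (p :* p′) with within-∅ q p | within-∅ q p′
  ... | a , e | b , e′ = a * b , S.trans (S.*-cong e e′) (S.sym (Polynomials.con-* a b))
  within-∅ q (:- p) with within-∅ q p
  ... | a , e = - a , S.trans (S.-‿cong e) (S.sym (RingProperties.+-inverseˡ-unique S.ring _ _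
        (S.trans (S.sym (Polynomials.con-+ (- a) a)) (con-cong (-‿inverseˡ a)))))

  module _ (v : V) where

    isv : ∀ w → Dec (w ≡ v)
    isv w = em

    coefficients : Poly V → List (Poly V)
    coefficients (con a) = con a ∷ []
    coefficients (var w) = if does (isv w) then con 0# ∷ con 1# ∷ [] else var w ∷ []
    coefficients (f :+ g) = add (coefficients f) (coefficients g)
    coefficients (f :* g) = multiply (coefficients f) (coefficients g)
    coefficients (:- f) = List.map (con (- 1#) :*_) (coefficients f)

    value-singleton : ∀ f x → value (f ∷ []) x S.≈ f
    value-singleton f x = S.trans (S.+-congˡ (S.zeroʳ x)) (S.+-identityʳ f)

    value-coefficients : ∀ f → value (coefficients f) (var v) ≈ₚ f
    value-coefficients (con a) = value-singleton (con a) (var v)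
    value-coefficients (var w) with isv w
    ... | yes ≡.refl = S.trans (S.+-identityˡ _) (S.trans (S.*-congˡ (value-singleton (con 1#) (var v))) (S.*-identityʳ _))
    ... | no _       = value-singleton (var w) (var v)
    value-coefficients (f :+ g) = S.trans (value-add (coefficients f) (coefficients g) (var v))
      (S.+-cong (value-coefficients f) (value-coefficients g))
    value-coefficients (f :* g) = S.trans (value-multiply (coefficients f) (coefficients g) (var v))
      (S.*-cong (value-coefficients f) (value-coefficients g))
    value-coefficients (:- f) = S.trans (value-scale (con (- 1#)) (coefficients f) (var v))
      (S.trans (S.*-cong con-neg (value-coefficients f)) (-1*f≈-f f))
      where
      con-neg : con (- 1#) ≈ₚ (:- con 1#)
      con-neg = RingProperties.+-inverseˡ-unique S.ring _ _
        (S.trans (S.sym (Polynomials.con-+ (- 1#) 1#)) (con-cong (-‿inverseˡ 1#)))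

    within-add : ∀ {Q : V → Set} {p q} → ListAll.All (Within Q) p → ListAll.All (Within Q) q → ListAll.All (Within Q) (add p q)
    within-add []      ws′       = ws′
    within-add (w ∷ ws) []        = w ∷ ws
    within-add (w ∷ ws) (w′ ∷ ws′) = (w :+ w′) ∷ within-add ws ws′

    within-scale : ∀ {Q : V → Set} {f p} → Within Q f → ListAll.All (Within Q) p → ListAll.All (Within Q) (List.map (f :*_) p)
    within-scale w []       = []
    within-scale w (w′ ∷ ws) = (w :* w′) ∷ within-scale w ws

    within-multiply : ∀ {Q : V → Set} {p q} → ListAll.All (Within Q) p → ListAll.All (Within Q) q → ListAll.All (Within Q) (multiply p q)
    within-multiply []       ws′ = []
    within-multiply (w ∷ ws) ws′ = within-add (within-scale w ws′) (con 0# ∷ within-multiply ws ws′)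

    Without : (V → Set) → V → Set
    Without Q w = Q w × w ≢ v

    within-coefficients : ∀ {Q f} → Within Q f → ListAll.All (Within (Without Q)) (coefficients f)
    within-coefficients (con a) = con a ∷ []
    within-coefficients (var {w} q) with isv w
    ... | yes _  = con 0# ∷ con 1# ∷ []
    ... | no w≢v = var (q , w≢v) ∷ []
    within-coefficients (p :+ q) = within-add (within-coefficients p) (within-coefficients q)
    within-coefficients (p :* q) = within-multiply (within-coefficients p) (within-coefficients q)
    within-coefficients (:- p) = within-scale (con (- 1#)) (within-coefficients p)

    _[v:=_] : (V → Carrier) → Carrier → V → Carrier
    (t [v:= x ]) w = if does (isv w) then x else t w

    updated : ∀ t x → (t [v:= x ]) v ≈ x
    updated t x with isv v
    ... | yes _  = refl
    ... | no v≢v = ⊥-elim (v≢v ≡.refl)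

    unchanged : ∀ t x w → w ≢ v → t w ≈ (t [v:= x ]) w
    unchanged t x w w≢v with isv w
    ... | yes w≡v = ⊥-elim (w≢v w≡v)
    ... | no _    = refl

    value-eval : ∀ {Q : V → Set} t x p → ListAll.All (Within (Without Q)) p →
                 eval (t [v:= x ]) (value p (var v)) ≈ L.value (List.map (eval t) p) x
    value-eval t x []      []       = refl
    value-eval t x (f ∷ p) (w ∷ ws) = trans (eval-+ _ f (var v :* value p (var v))) (+-cong
      (within-eval (λ u (_ , u≢v) → sym (unchanged t x u u≢v)) w)
      (trans (eval-* _ (var v) (value p (var v))) (*-cong (updated t x) (value-eval t x p ws))))

    value-zero : ∀ p → ListAll.All (_≈ₚ con 0#) p → ∀ x → value p x ≈ₚ con 0#
    value-zero []      []       x = S.refl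
    value-zero (f ∷ p) (e ∷ es) x = S.trans (S.+-cong e (S.*-congˡ (value-zero p es x)))
      (S.trans (S.+-identityˡ _) (S.zeroʳ x))

  vanishing⇒≈0-within : ∀ (vs : List V) {Q : V → Set} → (∀ v → Q v → v ∈ vs) → ∀ {f} → Within Q f →
                        (∀ t → eval t f ≈ 0#) → f ≈ₚ con 0#
  vanishing⇒≈0-within [] Q⊆vs w z with within-∅ (λ v q → ListAny.¬Any[] (Q⊆vs v q)) w
  ... | a , e = S.trans e (con-cong (trans (sym (eval-sound (λ _ → 0#) e)) (z _)))
  vanishing⇒≈0-within (v ∷ vs) {Q} Q⊆vs {f} w z = S.trans (S.sym (value-coefficients v f))
    (value-zero v (coefficients v f) (zeros (coefficients v f) cs-within λ t →
      ListAll.map⁻ (vanishing⇒coefficients≈0 (List.map (eval t) (coefficients v f)) λ x →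
        trans (sym (value-eval v t x (coefficients v f) cs-within))
          (trans (eval-sound _ (value-coefficients v f)) (z _)))) (var v))
    where
    cs-within : ListAll.All (Within (Without v Q)) (coefficients v f)
    cs-within = within-coefficients v w
    Without⊆vs : ∀ u → Without v Q u → u ∈ vs
    Without⊆vs u (q , u≢v) with Q⊆vs u q
    ... | here u≡v   = ⊥-elim (u≢v u≡v)
    ... | there u∈vs = u∈vs
    zeros : ∀ p → ListAll.All (Within (Without v Q)) p → (∀ t → ListAll.All (λ g → eval t g ≈ 0#) p) → ListAll.All (_≈ₚ con 0#) p
    zeros []      []       es = []
    zeros (g ∷ p) (w ∷ ws) es = vanishing⇒≈0-within vs Without⊆vs w (λ t → ListAll.head (es t))
                              ∷ zeros p ws (λ t → ListAll.tail (es t))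

  vanishing⇒≈0 : ∀ (vs : List V) → (∀ v → v ∈ vs) → ∀ f → (∀ t → eval t f ≈ 0#) → f ≈ₚ con 0#
  vanishing⇒≈0 vs v∈vs f = vanishing⇒≈0-within vs (λ _ → id) (within-all v∈vs f)

-- Extensions of fields and polynomials over the smaller field

module HeytingFieldFacts (em : ∀ {a} → ExcludedMiddle a) {c ℓ₁ ℓ₂} (F : HeytingField c ℓ₁ ℓ₂) where

  open HeytingField F
  open RingProperties (CommutativeRing.ring (commutativeRing F)) using (-0#≈0#)

  -- In the zero ring every element is invertible, so `1# # 0#` would hold, against tightness.
  1≉0 : ¬ 1# ≈ 0#
  1≉0 e = proj₂ (tight 1# 0#) e
    (invertible⇒# (1# , inverseOf1 , inverseOf1))
    where
    inverseOf1 : ∀ {x} → x ≈ 1#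
    inverseOf1 {x} = trans (sym (*-identityʳ x)) (trans (*-congˡ e) (trans (zeroʳ x) (sym e)))

  inverse : ∀ x → ¬ x ≈ 0# → ∃[ y ] x * y ≈ 1#
  inverse x x≉0 with em {P = x # 0#}
  ... | no ¬x#0 = ⊥-elim (x≉0 (proj₁ (tight x 0#) ¬x#0))
  ... | yes x#0 with y , _ , e ← #⇒invertible x#0 =
    y , trans (*-congʳ (sym (trans (+-congˡ -0#≈0#) (+-identityʳ x)))) e

module FieldExtension (em : ∀ {a} → ExcludedMiddle a)
  {c ℓ₁ ℓ₂ c′ ℓ₁′ ℓ₂′} (K : HeytingField c ℓ₁ ℓ₂) (K-infinite : IsInfinite K)
  (Ω : HeytingField c′ ℓ₁′ ℓ₂′)
  (φ : HeytingField.Carrier K → HeytingField.Carrier Ω)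
  (φ-hom : IsRingHomomorphism (rawRing K) (rawRing Ω) φ)
  where

  module K where
    open HeytingField K public
    open HeytingFieldFacts em K public
  module Ω where
    open HeytingField Ω public
    open HeytingFieldFacts em Ω public

  Ωᶜ = commutativeRing Ω

  open SetoidReasoning (CommutativeRing.setoid Ωᶜ) public
  open SemiringSum (CommutativeRing.semiring Ωᶜ) using (sum; sum-cong-≋) public
  open FieldLinearAlgebra Ωᶜ em Ω.1≉0 Ω.inverse public
  open Polynomials (commutativeRing K) public
  open LinearAlgebra (rawRing Ω) public
  open RawCramer (rawRing Ω) public
  open CoefficientLists Ωᶜ using (IsPolynomial; const; coordinate; _⊕_; _⊗_; resp;
    IsPolynomial-neg; IsPolynomial-sum; IsPolynomial-det; IsPolynomial-cong;
    IsPolynomial-scatter; IsPolynomial-cramer) public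
  private
    module φ = IsRingHomomorphism φ-hom
  module Ev {V : Set} = Evaluation (commutativeRing K) Ωᶜ φ φ-hom {V}
  open Ev public

  φ-injective : ∀ {x y} → φ x Ω.≈ φ y → x K.≈ y
  φ-injective {x} {y} e with em {P = x K.- y K.≈ K.0#}
  ... | yes x-y≈0 = RingProperties.x∙y⁻¹≈ε⇒x≈y (CommutativeRing.ring (commutativeRing K)) x y x-y≈0
  ... | no x-y≉0 with z , ee ← K.inverse _ x-y≉0 = ⊥-elim (Ω.1≉0 (begin
      Ω.1# ≈⟨ φ.1#-homo ⟨
      φ K.1# ≈⟨ φ.⟦⟧-cong ee ⟨
      φ ((x K.- y) K.* z) ≈⟨ φ.*-homo _ _ ⟩
      φ (x K.- y) Ω.* φ z ≈⟨ 0*x≈0 (φ z) (Ω.trans (φ.+-homo _ _)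
        (Ω.trans (Ω.+-cong e (φ.-‿homo y)) (Ω.-‿inverseʳ _))) ⟩
      Ω.0# ∎))

  open FinitelyManyZeros Ωᶜ em Ω.1≉0 Ω.inverse K._≈_ φ φ-injective K-infinite public
    using (nonvanishing-*; nonvanishingAtPoint)

  IsPolynomial-eval : ∀ {V W : Set} (f : Poly V) {ρ : V → (W → Ω.Carrier) → Ω.Carrier} →
                      (∀ v → IsPolynomial (ρ v)) → IsPolynomial (λ t → eval (λ v → ρ v t) f)
  IsPolynomial-eval (con a)  p = const (φ a)
  IsPolynomial-eval (var v)  p = p v
  IsPolynomial-eval (f :+ g) p = resp (λ t → Ω.sym (eval-+ _ f g)) (IsPolynomial-eval f p ⊕ IsPolynomial-eval g p)
  IsPolynomial-eval (f :* g) p = resp (λ t → Ω.sym (eval-* _ f g)) (IsPolynomial-eval f p ⊗ IsPolynomial-eval g p)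
  IsPolynomial-eval (:- f)   p = resp (λ t → Ω.sym (eval-neg _ f)) (IsPolynomial-neg (IsPolynomial-eval f p))

  module _ {V : Set} (vs : List V) (v∈vs : ∀ v → v ∈ vs) where

    open Completeness (commutativeRing K) em K.1≉0 K.inverse K-infinite {V} using (id-homomorphism; vanishing⇒≈0)
    module EvK = Evaluation (commutativeRing K) (commutativeRing K) id id-homomorphism {V}

    eval-φ : ∀ (t : V → K.Carrier) f → eval (φ ∘ t) f Ω.≈ φ (EvK.eval t f)
    eval-φ t (con a)  = Ω.refl
    eval-φ t (var v)  = Ω.refl
    eval-φ t (f :+ g) = Ω.trans (eval-+ _ f g) (Ω.trans (Ω.+-cong (eval-φ t f) (eval-φ t g))
      (Ω.trans (Ω.sym (φ.+-homo _ _)) (φ.⟦⟧-cong (K.sym (EvK.eval-+ t f g)))))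
    eval-φ t (f :* g) = Ω.trans (eval-* _ f g) (Ω.trans (Ω.*-cong (eval-φ t f) (eval-φ t g))
      (Ω.trans (Ω.sym (φ.*-homo _ _)) (φ.⟦⟧-cong (K.sym (EvK.eval-* t f g)))))
    eval-φ t (:- f) = Ω.trans (eval-neg _ f) (Ω.trans (Ω.-‿cong (eval-φ t f))
      (Ω.trans (Ω.sym (φ.-‿homo _)) (φ.⟦⟧-cong (K.sym (EvK.eval-neg t f)))))

    -- The witness is sought among points over `K`: a polynomial vanishing at all of them is zero by
    -- `vanishing⇒≈0`, and `φ` is injective.
    ≉0⇒nonvanishing : ∀ f → ¬ f ≈ₚ con K.0# → ∃[ t ] ¬ eval t f Ω.≈ Ω.0#
    ≉0⇒nonvanishing f f≉0 with em {P = ∃[ t ] ¬ eval t f Ω.≈ Ω.0#}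
    ... | yes p   = p
    ... | no none = ⊥-elim (f≉0 (vanishing⇒≈0 vs v∈vs f λ t → φ-injective
            (Ω.trans (Ω.sym (eval-φ t f)) (Ω.trans (≈0-stable λ ne → none (φ ∘ t , ne)) (Ω.sym φ.0#-homo)))))

  nonvanishing-all : ∀ {V : Set} {n} (f : Fin n → (V → Ω.Carrier) → Ω.Carrier) → (∀ i → IsPolynomial (f i)) →
                     (∀ i → ∃[ t ] ¬ f i t Ω.≈ Ω.0#) →
                     ∀ {g} → IsPolynomial g → ∃[ t ] ¬ g t Ω.≈ Ω.0# →
                     ∃[ t ] (¬ g t Ω.≈ Ω.0#) × (∀ i → ¬ f i t Ω.≈ Ω.0#)
  nonvanishing-all {n = zero}  f f-poly f≉0 g-poly (t , g≉0) = t , g≉0 , λ ()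
  nonvanishing-all {n = suc n} f f-poly f≉0 {g} g-poly g≉0 =
    let t , gf≉0 , fs≉0 = nonvanishing-all (f ∘ suc) (f-poly ∘ suc) (f≉0 ∘ suc) (g-poly ⊗ f-poly zero)
                            (nonvanishing-* g-poly (f-poly zero) g≉0 (f≉0 zero))
    in t , (λ e → gf≉0 (0*x≈0 _ e)) , λ { zero e → gf≉0 (x*0≈0 _ e) ; (suc i) → fs≉0 i }

  -- Products of Grassmannians: change of representatives, and irreducibility of unirational sets

  module MultiprojectiveVariety {I : Set} (r m : I → ℕ) (is : List I) (i∈is : ∀ i → i ∈ is) where

    open GrassmannianProduct K Ω φ r m public
    open SemiringExp (CommutativeRing.semiring Ωᶜ) using (_^_; ^-homo-*)
    open SemiringSolver (CommutativeRing.commutativeSemiring Ωᶜ) using (solve; _:=_) renaming (_:+_ to _:+:_; _:*_ to _:*:_)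

    scaleFactor : ∀ {d f} → IsMultihomogeneous d f → ∀ i₀ u {g h : Coordinate → Ω.Carrier} →
                  (∀ J → h (i₀ , J) Ω.≈ u Ω.* g (i₀ , J)) → (∀ i J → i ≢ i₀ → h (i , J) Ω.≈ g (i , J)) →
                  eval h f Ω.≈ u ^ d i₀ Ω.* eval g f
    scaleFactor (con a) i₀ u e e′ = Ω.sym (Ω.*-identityˡ _)
    scaleFactor (var {d} {i} J one none) i₀ u {g} {h} e e′ with em {P = i ≡ i₀}
    ... | yes ≡.refl rewrite one = Ω.trans (e J) (Ω.*-congʳ (Ω.sym (Ω.*-identityʳ u)))
    ... | no i≢i₀ rewrite none i₀ (i≢i₀ ∘ ≡.sym) = Ω.trans (e′ i J i≢i₀) (Ω.sym (Ω.*-identityˡ _))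
    scaleFactor (_:+_ {d} {f} {f′} p q) i₀ u {g} {h} e e′ = begin
      eval h (f :+ f′) ≈⟨ Ω.trans (eval-+ h f f′) (Ω.+-cong (scaleFactor p i₀ u e e′) (scaleFactor q i₀ u e e′)) ⟩
      u ^ d i₀ Ω.* eval g f Ω.+ u ^ d i₀ Ω.* eval g f′ ≈⟨ Ω.distribˡ _ _ _ ⟨
      u ^ d i₀ Ω.* (eval g f Ω.+ eval g f′) ≈⟨ Ω.*-congˡ (eval-+ g f f′) ⟨
      u ^ d i₀ Ω.* eval g (f :+ f′) ∎
    scaleFactor (_:*_ {d} {d′} {f} {f′} p q) i₀ u {g} {h} e e′ = begin
      eval h (f :* f′) ≈⟨ Ω.trans (eval-* h f f′) (Ω.*-cong (scaleFactor p i₀ u e e′) (scaleFactor q i₀ u e e′)) ⟩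
      (u ^ d i₀ Ω.* eval g f) Ω.* (u ^ d′ i₀ Ω.* eval g f′)
        ≈⟨ solve 4 (λ a f b f′ → (a :*: f) :*: (b :*: f′) := (a :*: b) :*: (f :*: f′)) Ω.refl
             (u ^ d i₀) (eval g f) (u ^ d′ i₀) (eval g f′) ⟩
      (u ^ d i₀ Ω.* u ^ d′ i₀) Ω.* (eval g f Ω.* eval g f′)
        ≈⟨ Ω.*-cong (Ω.sym (^-homo-* u (d i₀) (d′ i₀))) (Ω.sym (eval-* g f f′)) ⟩
      u ^ (d i₀ ℕ.+ d′ i₀) Ω.* eval g (f :* f′) ∎
    scaleFactor (:-_ {d} {f} p) i₀ u {g} {h} e e′ = begin
      eval h (:- f) ≈⟨ Ω.trans (eval-neg h f) (Ω.-‿cong (scaleFactor p i₀ u e e′)) ⟩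
      Ω.- (u ^ d i₀ Ω.* eval g f) ≈⟨ RingProperties.-‿distribʳ-* (CommutativeRing.ring Ωᶜ) _ _ ⟩
      u ^ d i₀ Ω.* (Ω.- eval g f) ≈⟨ Ω.*-congˡ (eval-neg g f) ⟨
      u ^ d i₀ Ω.* eval g (:- f) ∎
    scaleFactor (resp {d} {d′} {f} {f′} d≡d′ f≈f′ p) i₀ u {g} {h} e e′ rewrite ≡.sym (d≡d′ i₀) =
      Ω.trans (eval-sound h (≈-sym f≈f′)) (Ω.trans (scaleFactor p i₀ u e e′) (Ω.*-congˡ (eval-sound g f≈f′)))

    -- The factors of `g` are exchanged for those of `h` one at a time along `is`, each exchange
    -- multiplying the value by a power of one scalar. The family `hybrid l` has been exchanged
    -- exactly at the indices in `l`.
    homogeneous-zero : ∀ {d f} → IsMultihomogeneous d f → ∀ {g h : Coordinate → Ω.Carrier} →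
                       (∀ i → ∃[ u ] (∀ J → h (i , J) Ω.≈ u Ω.* g (i , J))) →
                       eval g f Ω.≈ Ω.0# → eval h f Ω.≈ Ω.0#
    homogeneous-zero {f = f} hom {g} {h} scale z =
      Ω.trans (eval-cong (λ { (i , J) → Ω.sym (hybrid-∈ is i J (i∈is i)) }) f) (hybrid-zero is)
      where
      inList : ∀ (l : List I) i → Dec (i ∈ l)
      inList l i = em
      hybrid : List I → Coordinate → Ω.Carrier
      hybrid l (i , J) = if does (inList l i) then h (i , J) else g (i , J)
      hybrid-∈ : ∀ l i J → i ∈ l → hybrid l (i , J) Ω.≈ h (i , J)
      hybrid-∈ l i J i∈l with inList l i
      ... | yes _  = Ω.refl
      ... | no i∉l = ⊥-elim (i∉l i∈l)
      hybrid-∉ : ∀ l i J → ¬ i ∈ l → hybrid l (i , J) Ω.≈ g (i , J)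
      hybrid-∉ l i J i∉l with inList l i
      ... | yes i∈l = ⊥-elim (i∉l i∈l)
      ... | no _    = Ω.refl
      hybrid-zero : ∀ l → eval (hybrid l) f Ω.≈ Ω.0#
      hybrid-zero [] = Ω.trans (eval-cong (λ { (i , J) → hybrid-∉ [] i J λ () }) f) z
      hybrid-zero (i₀ ∷ l) = step em
        where
        other : ∀ i J → i ≢ i₀ → hybrid (i₀ ∷ l) (i , J) Ω.≈ hybrid l (i , J)
        other i J i≢i₀ = byCases em
          where
          byCases : Dec (i ∈ l) → hybrid (i₀ ∷ l) (i , J) Ω.≈ hybrid l (i , J)
          byCases (yes i∈l) = Ω.trans (hybrid-∈ (i₀ ∷ l) i J (there i∈l)) (Ω.sym (hybrid-∈ l i J i∈l))
          byCases (no i∉l)  = Ω.trans (hybrid-∉ (i₀ ∷ l) i J λ { (here e) → i≢i₀ e ; (there i∈l) → i∉l i∈l })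
                                      (Ω.sym (hybrid-∉ l i J i∉l))
        step : Dec (i₀ ∈ l) → eval (hybrid (i₀ ∷ l)) f Ω.≈ Ω.0#
        step (yes i₀∈l) = Ω.trans (eval-cong same f) (hybrid-zero l)
          where
          same : ∀ v → hybrid (i₀ ∷ l) v Ω.≈ hybrid l v
          same (i , J) = byCases em
            where
            byCases : Dec (i ≡ i₀) → hybrid (i₀ ∷ l) (i , J) Ω.≈ hybrid l (i , J)
            byCases (yes ≡.refl) = Ω.trans (hybrid-∈ (i₀ ∷ l) i J (here ≡.refl)) (Ω.sym (hybrid-∈ l i J i₀∈l))
            byCases (no i≢i₀)    = other i J i≢i₀
        step (no i₀∉l) = Ω.trans
          (scaleFactor hom i₀ (proj₁ (scale i₀)) {hybrid l} {hybrid (i₀ ∷ l)}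
            (λ J → Ω.trans (hybrid-∈ (i₀ ∷ l) i₀ J (here ≡.refl)) (Ω.trans (proj₂ (scale i₀) J)
                     (Ω.*-congˡ (Ω.sym (hybrid-∉ l i₀ J i₀∉l)))))
            other)
          (x*0≈0 _ (hybrid-zero l))

    -- Both subspaces have `r i` basis vectors, so one inclusion already makes their Plücker
    -- coordinates proportional.
    _≋_ : Point → Point → Set _
    L ≋ L′ = ∀ i j → Gr.basis (L′ i) j ∈Gr L i

    ≋⇒proportional : ∀ {L L′} → L ≋ L′ → HasCoordinates L (coordinates L′)
    ≋⇒proportional {L} {L′} L≋L′ i
      with u , u≉0 , e ← sameSpan⇒proportional (Gr.basis (L i)) (Gr.basis (L′ i)) (Gr.independent (L′ i)) (L≋L′ i)
      = u , u≉0 , λ J → e (lookup J)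

    zeros-resp : ∀ {L L′} → L ≋ L′ → ∀ Z → L ∈ᵖ zeros Z → L′ ∈ᵖ zeros Z
    zeros-resp {L} {L′} L≋L′ Z L∈Z f eqn = homogeneous-zero (proj₂ (ClosedSet.homogeneous Z eqn))
      (λ i → let u , _ , e = ≋⇒proportional {L} {L′} L≋L′ i in u , e) (L∈Z f eqn)

    HasCoordinates⇒zero : ∀ {d f} → IsMultihomogeneous d f → ∀ {L h} → HasCoordinates L h →
                          eval (coordinates L) f Ω.≈ Ω.0# → eval h f Ω.≈ Ω.0#
    HasCoordinates⇒zero hom c = homogeneous-zero hom λ i → let u , _ , e = c i in u , e

    HasCoordinates⇒zero⁻¹ : ∀ {d f} → IsMultihomogeneous d f → ∀ {L h} → HasCoordinates L h →
                            eval h f Ω.≈ Ω.0# → eval (coordinates L) f Ω.≈ Ω.0#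
    HasCoordinates⇒zero⁻¹ hom {L} {h} c = homogeneous-zero hom λ i →
      let u , u≉0 , e = c i
          v , ee = Ω.inverse u u≉0
      in v , λ J → Ω.sym (Ω.trans (Ω.*-congˡ (e J)) (Ω.trans (Ω.sym (Ω.*-assoc _ _ _))
           (Ω.trans (Ω.*-congʳ (Ω.trans (Ω.*-comm _ _) ee)) (Ω.*-identityˡ _))))

    HasCoordinates⇒≋ : ∀ {L L′} → HasCoordinates L (coordinates L′) → L ≋ L′ × L′ ≋ L
    HasCoordinates⇒≋ {L} {L′} c =
        (λ i j → proportional⇒sameSpan (b′ i) (b i) (Gr.independent (L i)) (v i) (back i) (InSpan-basis _ j))
      , (λ i j → proportional⇒sameSpan (b i) (b′ i) (Gr.independent (L′ i)) (u i) (forth i) (InSpan-basis _ j))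
      where
      b b′ : ∀ i → Fin (r i) → Fin (m i) → Ω.Carrier
      b i = Gr.basis (L i)
      b′ i = Gr.basis (L′ i)
      u v : ∀ i → Ω.Carrier
      u i = proj₁ (c i)
      v i = proj₁ (Ω.inverse (u i) (proj₁ (proj₂ (c i))))
      toVec : ∀ i (a : Fin (r i) → Fin (m i) → Ω.Carrier) J → minor (lookup (tabulate J)) a Ω.≈ minor J a
      toVec i a J = det-cong λ j l → Ω.reflexive (≡.cong (a j) (lookup∘tabulate J l))
      forth : ∀ i J → minor J (b′ i) Ω.≈ u i Ω.* minor J (b i)
      forth i J = Ω.trans (Ω.sym (toVec i (b′ i) J))
        (Ω.trans (proj₂ (proj₂ (c i)) (tabulate J)) (Ω.*-congˡ (toVec i (b i) J)))
      back : ∀ i J → minor J (b i) Ω.≈ v i Ω.* minor J (b′ i)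
      back i J = begin
        minor J (b i)                     ≈⟨ Ω.*-identityˡ _ ⟨
        Ω.1# Ω.* minor J (b i)            ≈⟨ Ω.*-congʳ (proj₂ (Ω.inverse (u i) (proj₁ (proj₂ (c i))))) ⟨
        (u i Ω.* v i) Ω.* minor J (b i)   ≈⟨ Ω.trans (Ω.*-congʳ (Ω.*-comm _ _)) (Ω.*-assoc _ _ _) ⟩
        v i Ω.* (u i Ω.* minor J (b i))   ≈⟨ Ω.*-congˡ (forth i J) ⟨
        v i Ω.* minor J (b′ i)            ∎

    ∉zeros : ∀ Z {L} → ¬ L ∈ᵖ zeros Z → ∃[ f ] ClosedSet.Equation Z f × (¬ eval (coordinates L) f Ω.≈ Ω.0#)
    ∉zeros Z {L} L∉Z with em {P = ∃[ f ] ClosedSet.Equation Z f × (¬ eval (coordinates L) f Ω.≈ Ω.0#)}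
    ... | yes p   = p
    ... | no none = ⊥-elim (L∉Z λ f eqn → ≈0-stable λ ne → none (f , eqn , ne))

    -- By density, a closed set that does not contain `X` has an equation whose pullback to the
    -- parameter space is not identically zero. For two such sets, the product of the two pullbacks
    -- and the domain polynomial is nonzero at some parameter, whose image lies in `X` but in
    -- neither set.
    unirational⇒irreducible : ∀ {x} (X : Pred Point x) → IsUnirational X → IsIrreducible X
    unirational⇒irreducible X (N , F , image⊆X , dense) = nonempty , irreducible
      where
      open RationalMap F hiding (nonempty)
      Φ : (Fin N → Ω.Carrier) → Coordinate → Ω.Carrier
      Φ t J = eval t (components J)
      Φ-polynomial : ∀ f → IsPolynomial (λ t → eval (Φ t) f)
      Φ-polynomial f = IsPolynomial-eval f (λ J → IsPolynomial-eval (components J) coordinate)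
      domain≉0 : ∃[ t ] ¬ eval t domain Ω.≈ Ω.0#
      domain≉0 = ≉0⇒nonvanishing (allFin N) ∈-allFin domain (RationalMap.nonempty F)
      nonempty : ∃[ L ] L ∈ᵖ X
      nonempty = let t , t∈ = domain≉0 ; L , c = defined t t∈ in L , image⊆X {L} (t , t∈ , c)
      Nonvanishing : ClosedSet → Set _
      Nonvanishing Z = ∃[ f ] ClosedSet.Equation Z f × (∃[ t ] ¬ eval (Φ t) f Ω.≈ Ω.0#)
      nonvanishing : ∀ Z {L} → L ∈ᵖ X → ¬ L ∈ᵖ zeros Z → Nonvanishing Z
      nonvanishing Z {L} L∈X L∉Z with em {P = Nonvanishing Z}
      ... | yes p   = p
      ... | no none = ⊥-elim (L∉Z (dense Z (λ { {L′} (t , t∈ , c) f eqn →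
              HasCoordinates⇒zero⁻¹ (proj₂ (ClosedSet.homogeneous Z eqn)) {L′} {Φ t} c
                (≈0-stable λ ne → none (f , eqn , t , ne)) }) L∈X))
      irreducible : ∀ Z W → (∀ {L} → L ∈ᵖ X → L ∈ᵖ zeros Z ⊎ L ∈ᵖ zeros W) → (X ⊆ zeros Z) ⊎ (X ⊆ zeros W)
      irreducible Z W cover with em {P = X ⊆ zeros Z} | em {P = X ⊆ zeros W}
      ... | yes p | _     = inj₁ p
      ... | no _  | yes q = inj₂ q
      ... | no X⊈Z | no X⊈W = ⊥-elim (contradict (witness Z X⊈Z) (witness W X⊈W))
        where
        witness : ∀ Z → ¬ (X ⊆ zeros Z) → Nonvanishing Z
        witness Z X⊈Z with em {P = ∃[ L ] (L ∈ᵖ X) × (¬ L ∈ᵖ zeros Z)}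
        ... | yes (L , L∈X , L∉Z) = nonvanishing Z L∈X L∉Z
        ... | no none = ⊥-elim (X⊈Z λ {L} L∈X f eqn → ≈0-stable λ ne → none (L , L∈X , λ L∈Z → ne (L∈Z f eqn)))
        contradict : Nonvanishing Z → ¬ Nonvanishing W
        contradict (f , f∈Z , f≉0) (g , g∈W , g≉0) =
          let t₁ , fg≉0 = nonvanishing-* (Φ-polynomial f) (Φ-polynomial g) f≉0 g≉0
              t , fgd≉0 = nonvanishing-* (Φ-polynomial f ⊗ Φ-polynomial g) (IsPolynomial-eval domain coordinate)
                            (t₁ , fg≉0) domain≉0
              L , c = defined t (λ e → fgd≉0 (x*0≈0 _ e))
              f′≉0 = λ e → fgd≉0 (0*x≈0 _ (0*x≈0 _ e))
              g′≉0 = λ e → fgd≉0 (0*x≈0 _ (x*0≈0 _ e))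
          in [ (λ L∈Z → f′≉0 (HasCoordinates⇒zero (proj₂ (ClosedSet.homogeneous Z f∈Z)) {L} {Φ t} c (L∈Z f f∈Z)))
             , (λ L∈W → g′≉0 (HasCoordinates⇒zero (proj₂ (ClosedSet.homogeneous W g∈W)) {L} {Φ t} c (L∈W g g∈W)))
             ]′ (cover {L} (image⊆X {L} (t , (λ e → fgd≉0 (x*0≈0 _ e)) , c)))

open import Data.Vec.Base using ([]; _∷_)
open import Data.Vec.Relation.Unary.All using ([]; _∷_)
open import Data.Vec.Relation.Unary.Any using (here; there)

-- Combinatorics of the simplicial index sets and of the realization matrices

lookup-injective : ∀ {A : Set} {xs : List A} → Unique xs → Injective _≡_ _≡_ (List.lookup xs)
lookup-injective (x∉ AllPairs.∷ u) {zero}  {zero}  e = ≡.refl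
lookup-injective (x∉ AllPairs.∷ u) {zero}  {suc j} e = ⊥-elim (ListAll.lookup x∉ (∈-lookup j) e)
lookup-injective (x∉ AllPairs.∷ u) {suc i} {zero}  e = ⊥-elim (ListAll.lookup x∉ (∈-lookup i) (≡.sym e))
lookup-injective (x∉ AllPairs.∷ u) {suc i} {suc j} e = ≡.cong suc (lookup-injective u e)

allVecs-complete : ∀ {q p} (α : Vec (Fin q) p) → α ∈ allVecs q p
allVecs-complete []      = ListAny.here ≡.refl
allVecs-complete (x ∷ α) = ∈-cartesianProductWith⁺ Vec._∷_ (∈-allFin x) (allVecs-complete α)

allVecs-unique : ∀ q p → Unique (allVecs q p)
allVecs-unique q zero    = ListAll.[] AllPairs.∷ AllPairs.[]
allVecs-unique q (suc p) = Unique.cartesianProductWith⁺ Vec._∷_ ∷-injective (Unique.allFin⁺ q) (allVecs-unique q p)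

extend-cong : ∀ {p q} g {α β : Fin p → Fin q} → (∀ i → α i ≡ β i) → ∀ i → extend g α i ≡ extend g β i
extend-cong {p} {q} g e i with splitAt p i
... | inj₁ j = ≡.cong (_↑ˡ g) (e j)
... | inj₂ j = ≡.refl

↑ˡ≢↑ʳ : ∀ {q} g (i : Fin q) (j : Fin g) → i ↑ˡ g ≢ q ↑ʳ j
↑ˡ≢↑ʳ {q} g i j e with () ← ≡.trans (≡.sym (splitAt-↑ˡ q i g)) (≡.trans (≡.cong (splitAt q) e) (splitAt-↑ʳ q g j))

-- The two blocks of the join separate the vertex from the last `g` elements: a value in the left
-- block comes from the vertex, and one in the right block shows its own position, whatever `α` and
-- `β` are.
extend-vertex-injective : ∀ {q} g (α β : Fin 1 → Fin q) i j → extend g α i ≡ extend g β j → i ≡ j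
extend-vertex-injective g α β zero    zero    e = ≡.refl
extend-vertex-injective g α β zero    (suc j) e = ⊥-elim (↑ˡ≢↑ʳ g (α zero) j e)
extend-vertex-injective g α β (suc i) zero    e = ⊥-elim (↑ˡ≢↑ʳ g (β zero) i (≡.sym e))
extend-vertex-injective {q} g α β (suc i) (suc j) e = ≡.cong suc (↑ʳ-injective q i j e)

foldr₁-⊓-attained : ∀ {k} (s : Vec ℕ (suc k)) → VecAny.Any (_≡ foldr₁ _⊓_ s) s
foldr₁-⊓-attained (x ∷ [])     = here ≡.refl
foldr₁-⊓-attained (x ∷ y ∷ s) with ℕ.⊓-sel x (foldr₁ _⊓_ (y ∷ s))
... | inj₁ e = here (≡.sym e)
... | inj₂ e = there (VecAny.map (λ e′ → ≡.trans e′ (≡.sym e)) (foldr₁-⊓-attained (y ∷ s)))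

All-list : ∀ {n} {P : ℕ → Set} → (∀ x → List (P x)) → (xs : Vec ℕ n) → List (All P xs)
All-list ps []       = [] List.∷ List.[]
All-list ps (x ∷ xs) = cartesianProductWith All._∷_ (ps x) (All-list ps xs)

All-list-complete : ∀ {n} {P : ℕ → Set} (ps : ∀ x → List (P x)) → (∀ x (a : P x) → a ∈ ps x) →
                    (xs : Vec ℕ n) (as : All P xs) → as ∈ All-list ps xs
All-list-complete ps c []       []       = ListAny.here ≡.refl
All-list-complete ps c (x ∷ xs) (a ∷ as) =
  ∈-cartesianProductWith⁺ All._∷_ (c x a) (All-list-complete ps c xs as)

All-map-injective : ∀ {n} {P Q : ℕ → Set} {f f′ : ∀ {x} → P x → Q x} →
                    (∀ x (a b : P x) → f a ≡ f′ b → a ≡ b) → {xs : Vec ℕ n} (as bs : All P xs) →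
                    All.map f as ≡ All.map f′ bs → as ≡ bs
All-map-injective inj []       []       e = ≡.refl
All-map-injective inj (a ∷ as) (b ∷ bs) e =
  ≡.cong₂ _∷_ (inj _ a b (≡.cong All.head e)) (All-map-injective inj as bs (≡.cong All.tail e))

All-map-cong : ∀ {n} {P Q : ℕ → Set} {f g : ∀ {x} → P x → Q x} → (∀ x (a : P x) → f a ≡ g a) →
               {xs : Vec ℕ n} (as : All P xs) → All.map f as ≡ All.map g as
All-map-cong e []       = ≡.refl
All-map-cong e (a ∷ as) = ≡.cong₂ _∷_ (e _ a) (All-map-cong e as)

All-map-∘ : ∀ {n} {P Q R : ℕ → Set} {g : ∀ {x} → Q x → R x} {f : ∀ {x} → P x → Q x}
            {xs : Vec ℕ n} (as : All P xs) → All.map g (All.map f as) ≡ All.map (λ {x} a → g (f a)) as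
All-map-∘ []       = ≡.refl
All-map-∘ (a ∷ as) = ≡.cong₂ _∷_ ≡.refl (All-map-∘ as)

module DiagonalFacts {k} (s : Vec ℕ (suc k)) where

  open Diagonal s

  indices : ∀ p → List (I p)
  indices p = All-list (λ x → allFin (suc (M x p))) s

  ∈-indices : ∀ {p} (u : I p) → u ∈ indices p
  ∈-indices = All-list-complete (λ x → allFin _) (λ x → ∈-allFin) s

  I∙-cong : ∀ {p q} {α β : Fin (suc p) → Fin (suc q)} → (∀ i → α i ≡ β i) → ∀ m → I∙ α m ≡ I∙ β m
  I∙-cong e = All-map-cong (λ x → extend-cong (gap x) e)

  I∙-∘ : ∀ {p q r} (β : Fin (suc q) → Fin (suc r)) (α : Fin (suc p) → Fin (suc q)) m →
         I∙ (β ∘ α) m ≡ I∙ β (I∙ α m)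
  I∙-∘ β α m = ≡.trans (All-map-cong (λ x → extend-∘ (gap x) β α) m) (≡.sym (All-map-∘ m))

  column-nondecreasing : ∀ p l → Nondecreasing (column p l)
  column-nondecreasing p l =
    proj₂ (∈-filter⁻ nondecreasing? {xs = allVecs (suc n) (suc p)} (∈-lookup {xs = basis p} l))

  column-injective : ∀ p → Injective _≡_ _≡_ (column p)
  column-injective p = lookup-injective (Unique.filter⁺ nondecreasing? (allVecs-unique (suc n) (suc p)))

  face-of : ∀ p → Fin (suc (suc p)) → Fin (S (suc p)) → Fin (suc p) → Fin (suc n)
  face-of p i l = lookup (column (suc p) l) ∘ punchIn i

  abstract
    columnIndex : ∀ p {α} → Nondecreasing α → ∃[ j ] column p j ≡ α
    columnIndex p {α} α-mono = ListAny.index α∈ , ≡.sym (ListAny.lookup-index α∈)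
      where
      α∈ : α ∈ basis p
      α∈ = ∈-filter⁺ nondecreasing? (allVecs-complete α) α-mono

    faceIndex : ∀ p i l → ∃[ j ] column p j ≡ tabulate (face-of p i l)
    faceIndex p i l = columnIndex p λ a b a≤b →
      ≡.subst₂ Fin._≤_ (≡.sym (lookup∘tabulate (face-of p i l) a)) (≡.sym (lookup∘tabulate (face-of p i l) b))
        (column-nondecreasing (suc p) l (punchIn i a) (punchIn i b) (punchIn-mono-≤ i a b a≤b))

  I∙-faceIndex : ∀ p i l m → I∙ (lookup (column p (proj₁ (faceIndex p i l)))) m ≡
                             I∙ (lookup (column (suc p) l)) (I∙ (punchIn i) m)
  I∙-faceIndex p i l m = ≡.trans
    (I∙-cong (λ a → ≡.trans (≡.cong (λ α → lookup α a) (proj₂ (faceIndex p i l))) (lookup∘tabulate (face-of p i l) a)) m)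
    (I∙-∘ (lookup (column (suc p) l)) (punchIn i) m)

  gap-vanishes : VecAny.Any (λ x → gap x ≡ 0) s
  gap-vanishes = VecAny.map (λ { ≡.refl → ℕ.n∸n≡0 n }) (foldr₁-⊓-attained s)

  -- Every factor recovers its component of `m`. The vertex `l` is recovered from a factor with gap
  -- zero: there the source has a single element and its image is the vertex itself.
  vertex-injective : ∀ l l′ (m m′ : I 0) → I∙ (lookup (column 0 l)) m ≡ I∙ (lookup (column 0 l′)) m′ →
                     m ≡ m′ × l ≡ l′
  vertex-injective l l′ m m′ e =
    All-map-injective (λ x → extend-vertex-injective (gap x) _ _) m m′ e ,
    column-injective 0 (equal (column 0 l) (column 0 l′) (head-equal gap-vanishes m m′ e))
    where
    equal : (α β : Vec (Fin (suc n)) 1) → lookup α zero ≡ lookup β zero → α ≡ β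
    equal (a ∷ []) (b ∷ []) ≡.refl = ≡.refl
    head-equal : ∀ {N} {xs : Vec ℕ N} → VecAny.Any (λ x → gap x ≡ 0) xs →
                 {α β : Fin 1 → Fin (suc n)} (m m′ : All (λ x → Fin (suc (gap x))) xs) →
                 All.map (λ {x} → extend (gap x) α) m ≡ All.map (λ {x} → extend (gap x) β) m′ → α zero ≡ β zero
    head-equal (here {x = x} e₀) {α} {β} (i ∷ _) (j ∷ _) e = zero-gap (gap x) e₀ i j (≡.cong All.head e)
      where
      zero-gap : ∀ g → g ≡ 0 → (i j : Fin (suc g)) → extend g α i ≡ extend g β j → α zero ≡ β zero
      zero-gap zero ≡.refl zero zero e = ↑ˡ-injective 0 (α zero) (β zero) e
    head-equal (there a) (_ ∷ m) (_ ∷ m′) e = head-equal a m m′ (≡.cong All.tail e)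

  module _ {c ℓ} (R : CommutativeRing c ℓ) where

    open CommutativeRing R hiding (zero; rawRing)
    open LinearAlgebra (CommutativeRing.rawRing R)
    open SemiringSum semiring using (sum; sum-cong-≋)
    open Determinant R using (0*x≈0; ∑-comm-*ʳ)
    open CofactorVectors R using (sum-single)
    open SetoidReasoning setoid

    -- Naturality of the realization map: pairing `face p i y` with row `m` is pairing `y` with row
    -- `I∙ (punchIn i) m`. The inner sum has one surviving term, the column of the face.
    face-Ker : ∀ (T : I n → Carrier) p i {y} → y ∈Ker realization T (suc p) →
               face (CommutativeRing.rawRing R) p i y ∈Ker realization T p
    face-Ker T p i {y} y∈Ker m = begin
      sum (λ j → sum (λ l → entry l j) * v j) ≈⟨ ∑-comm-*ʳ v (λ j l → entry l j) ⟩
      sum (λ l → sum (λ j → entry l j * v j)) ≈⟨ sum-cong-≋ each ⟩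
      sum (λ l → y l * T (I∙ (lookup (column (suc p) l)) (I∙ (punchIn i) m))) ≈⟨ y∈Ker (I∙ (punchIn i) m) ⟩
      0# ∎
      where
      v : Vector Carrier (S p)
      v j = realization T p m j
      α≟ : ∀ l j → Dec (tabulate (lookup (column (suc p) l) ∘ punchIn i) ≡ column p j)
      α≟ l j = ≡-dec _≟_ _ _
      entry : Fin (S (suc p)) → Fin (S p) → Carrier
      entry l j = if does (α≟ l j) then y l else 0#
      each : ∀ l → sum (λ j → entry l j * v j) ≈ y l * T (I∙ (lookup (column (suc p) l)) (I∙ (punchIn i) m))
      each l = begin
        sum (λ j → entry l j * v j) ≈⟨ sum-single j₀ {λ j → entry l j * v j} (λ j j₀≢j → 0*x≈0 (v j) (off j j₀≢j)) ⟩
        entry l j₀ * v j₀ ≈⟨ *-cong on (reflexive (≡.cong T (I∙-faceIndex p i l m))) ⟩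
        y l * T (I∙ (lookup (column (suc p) l)) (I∙ (punchIn i) m)) ∎
        where
        j₀ = proj₁ (faceIndex p i l)
        on : entry l j₀ ≈ y l
        on with α≟ l j₀
        ... | yes _ = refl
        ... | no ne = ⊥-elim (ne (≡.sym (proj₂ (faceIndex p i l))))
        off : ∀ j → j₀ ≢ j → entry l j ≈ 0#
        off j j₀≢j with α≟ l j
        ... | yes e = ⊥-elim (j₀≢j (column-injective p (≡.trans (proj₂ (faceIndex p i l)) e)))
        ... | no _  = refl

-- From the generic rank over the function field to specializations

module FractionValue {c ℓ c′ ℓ′} (R : CommutativeRing c ℓ) (B : CommutativeRing c′ ℓ′) {V : Set}
  {h : Polynomials.Poly R V → CommutativeRing.Carrier B}
  (h-hom : IsRingHomomorphism (CommutativeRing.rawRing (PolynomialRing.polynomialRing R V)) (CommutativeRing.rawRing B) h)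
  where

  open Polynomials R using (con; _:+_; _:*_; Fraction; frac; fromPoly; functionField)

  open CommutativeRing B hiding (zero; rawRing)
  private
    module F = RawRing (functionField V)
    module LF = LinearAlgebra (functionField V)
  open LinearAlgebra (CommutativeRing.rawRing B) using (combination)
  open IsRingHomomorphism h-hom
  open SemiringSolver commutativeSemiring using (solve; _:=_) renaming (_:+_ to _⊞_; _:*_ to _⊠_)
  open SetoidReasoning setoid

  -- Cleared of denominators, so that the target can also be the polynomial ring itself. It
  -- determines the value only together with `Defined`, over a target without zero divisors.
  HasValue : Fraction V → Carrier → Set ℓ′
  HasValue q x = h (Fraction.num q) ≈ x * h (Fraction.den q)

  Defined : Fraction V → Set ℓ′
  Defined q = ¬ h (Fraction.den q) ≈ 0#

  value-fromPoly : ∀ f → HasValue (fromPoly f) (h f)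
  value-fromPoly f = sym (trans (*-congˡ 1#-homo) (*-identityʳ _))

  value-+ : ∀ {p q x y} → HasValue p x → HasValue q y → HasValue (p F.+ q) (x + y)
  value-+ {frac a b _} {frac a′ b′ _} {x} {y} e e′ = begin
    h (a :* b′ :+ a′ :* b) ≈⟨ trans (+-homo _ _) (+-cong (*-homo a b′) (*-homo a′ b)) ⟩
    h a * h b′ + h a′ * h b ≈⟨ +-cong (*-congʳ e) (*-congʳ e′) ⟩
    x * h b * h b′ + y * h b′ * h b
      ≈⟨ solve 4 (λ x y b b′ → x ⊠ b ⊠ b′ ⊞ y ⊠ b′ ⊠ b := (x ⊞ y) ⊠ (b ⊠ b′)) refl x y (h b) (h b′) ⟩
    (x + y) * (h b * h b′) ≈⟨ *-congˡ (*-homo b b′) ⟨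
    (x + y) * h (b :* b′) ∎

  value-* : ∀ {p q x y} → HasValue p x → HasValue q y → HasValue (p F.* q) (x * y)
  value-* {frac a b _} {frac a′ b′ _} {x} {y} e e′ = begin
    h (a :* a′) ≈⟨ trans (*-homo _ _) (*-cong e e′) ⟩
    (x * h b) * (y * h b′)
      ≈⟨ solve 4 (λ x y b b′ → (x ⊠ b) ⊠ (y ⊠ b′) := (x ⊠ y) ⊠ (b ⊠ b′)) refl x y (h b) (h b′) ⟩
    (x * y) * (h b * h b′) ≈⟨ *-congˡ (*-homo b b′) ⟨
    (x * y) * h (b :* b′) ∎

  value-combination : ∀ {X : Set} {r} (a : Vector (Fraction V) r) (b : Fin r → X → Fraction V) x
                      {a′ : Vector Carrier r} (b′ : Fin r → X → Carrier) →
                      (∀ j → HasValue (a j) (a′ j)) → (∀ j → HasValue (b j x) (b′ j x)) →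
                      HasValue (LF.combination a b x) (combination a′ b′ x)
  value-combination {r = zero}  a b x b′ e e′ = trans 0#-homo (sym (zeroˡ _))
  value-combination {r = suc r} a b x {a′} b′ e e′ =
    value-+ {a zero F.* b zero x} {LF.combination (a ∘ suc) (b ∘ suc) x}
      (value-* {a zero} {b zero x} (e zero) (e′ zero))
      (value-combination (a ∘ suc) (b ∘ suc) x {a′ ∘ suc} (b′ ∘ suc) (e ∘ suc) (e′ ∘ suc))

  module _ (no-zero-divisors : ∀ {x y} → ¬ x ≈ 0# → ¬ y ≈ 0# → ¬ x * y ≈ 0#) (1≉0 : ¬ 1# ≈ 0#) where

    defined-1 : ¬ h (con (CommutativeRing.1# R)) ≈ 0#
    defined-1 e = 1≉0 (trans (sym 1#-homo) e)

    defined-den-* : ∀ f g → ¬ h f ≈ 0# → ¬ h g ≈ 0# → ¬ h (f :* g) ≈ 0#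
    defined-den-* f g f≉0 g≉0 e = no-zero-divisors f≉0 g≉0 (trans (sym (*-homo f g)) e)

    defined-combination : ∀ {X : Set} {r} (a : Vector (Fraction V) r) (b : Fin r → X → Fraction V) x →
                          (∀ j → Defined (a j)) → (∀ j → Defined (b j x)) → Defined (LF.combination a b x)
    defined-combination {r = zero}  a b x d d′ = defined-1
    defined-combination {r = suc r} a b x d d′ = defined-den-* _ _
      (defined-den-* _ _ (d zero) (d′ zero)) (defined-combination (a ∘ suc) (b ∘ suc) x (d ∘ suc) (d′ ∘ suc))

HasSymbolicRank : ∀ {c ℓ} (R : CommutativeRing c ℓ) {V Row : Set} {N : ℕ} → (Row → Fin N → V) → ℕ → Set _
HasSymbolicRank R {V} entry = LinearAlgebra.HasRank (functionField V) (λ x j → fromPoly (var (entry x j)))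
  where open Polynomials R

module SymbolicMatrix (em : ∀ {a} → ExcludedMiddle a)
  {c ℓ₁ ℓ₂ c′ ℓ₁′ ℓ₂′} (K : HeytingField c ℓ₁ ℓ₂) (K-infinite : IsInfinite K)
  (Ω : HeytingField c′ ℓ₁′ ℓ₂′)
  (φ : HeytingField.Carrier K → HeytingField.Carrier Ω)
  (φ-hom : IsRingHomomorphism (rawRing K) (rawRing Ω) φ)
  where

  open FieldExtension em K K-infinite Ω φ φ-hom
  private
    module φ = IsRingHomomorphism φ-hom

  module _ {V Row : Set} {N : ℕ} (entry : Row → Fin N → V) where

    specialize : ∀ {a} {A : Set a} → (V → A) → Row → Fin N → A
    specialize T x j = T (entry x j)

    specialize-polynomial : ∀ {W : Set} {τ : V → (W → Ω.Carrier) → Ω.Carrier} → (∀ u → IsPolynomial (τ u)) →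
                            ∀ {r} (A : Fin r → Row) J →
                            IsPolynomial (λ t → minor J (specialize (λ u → τ u t) ∘ A))
    specialize-polynomial {τ = τ} τ-poly A J =
      IsPolynomial-det {M = λ i l t → τ (entry (A i) (J l)) t} λ i l → τ-poly (entry (A i) (J l))

    module _ {W : Set} (τ : V → Poly W) {r} (A : Fin r → Row) (J : Fin r → Fin N) where

      open PolynomialRing (commutativeRing K) W
      private module RC = RawCramer (CommutativeRing.rawRing polynomialRing)

      symbolicMinor : Poly W
      symbolicMinor = RC.minor J (specialize τ ∘ A)

      symbolicCramer : Fin N → Fin N → Poly W
      symbolicCramer = RC.cramer (specialize τ ∘ A) J

      symbolicPlücker : ∀ {q} → (Fin q → Fin N) → (Fin q → Fin N) → Poly W
      symbolicPlücker C = λ U → RC.minor U (symbolicCramer ∘ C)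

      module _ (t : W → Ω.Carrier) where

        open RingHomomorphism Ωᶜ (eval-homomorphism t)

        eval-minor : eval t symbolicMinor Ω.≈ minor J (specialize (eval t ∘ τ) ∘ A)
        eval-minor = det-homo (λ i l → specialize τ (A i) (J l))

        eval-plücker : ∀ {q} (C : Fin q → Fin N) U → eval t (symbolicPlücker C U) Ω.≈
                       minor U (cramer (specialize (eval t ∘ τ) ∘ A) J ∘ C)
        eval-plücker C U = Ω.trans (det-homo (λ i l → symbolicCramer (C i) (U l)))
          (det-cong λ i l → cramer-homo (specialize τ ∘ A) J (C i) (U l))

    module _ (vs : List V) (v∈vs : ∀ v → v ∈ vs) where

      open PolynomialRing (commutativeRing K) V
      private
        module S = CommutativeRing polynomialRing
        module LF = LinearAlgebra (functionField V)

      1ₚ≉0 : ¬ con {V} K.1# ≈ₚ con K.0#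
      1ₚ≉0 e = Ω.1≉0 (Ω.trans (Ω.sym φ.1#-homo) (Ω.trans (eval-sound (λ _ → Ω.0#) e) φ.0#-homo))

      -- Independence over the function field restricts to independence over the polynomial ring.
      -- There a nonzero symbolic minor is found without division, and it is nonzero at some tensor
      -- because `K` is infinite.
      rank⇒minor≉0-somewhere : ∀ {r} → HasSymbolicRank (commutativeRing K) entry r →
        Σ[ A ∈ (Fin r → Row) ] Σ[ J ∈ (Fin r → Fin N) ] ∃[ T ] ¬ minor J (specialize T ∘ A) Ω.≈ Ω.0#
      rank⇒minor≉0-somewhere {r} (J , ind , _) =
        let A , ne = independent⇒columnsMinorₚ (λ x j → var (entry x (J j))) polynomially-independent
            t , D≉0 = ≉0⇒nonvanishing vs v∈vs _ ne
        in A , J , t , λ e → D≉0 (Ω.trans (eval-minor var A J t) e)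
        where
        open CofactorVectors.Kernel polynomialRing em 1ₚ≉0 using ()
          renaming (independent⇒columnsMinor to independent⇒columnsMinorₚ)
        polynomially-independent : LinearAlgebra.LinearlyIndependent (CommutativeRing.rawRing polynomialRing)
                                     (λ j x → var (entry x (J j)))
        polynomially-independent a e j = S.trans (S.sym (S.*-identityʳ (a j)))
          (S.trans (ind (fromPoly ∘ a) (λ x →
            S.trans (S.*-identityʳ _)
              (S.trans (V.value-combination (fromPoly ∘ a) (λ j x → fromPoly (var (entry x (J j)))) x
                         (λ j x → var (entry x (J j)))
                         (λ j → V.value-fromPoly (a j)) (λ j → V.value-fromPoly (var (entry x (J j)))))
                (S.*-congʳ (e x)))) j) (S.zeroˡ _))
          where module V = FractionValue (commutativeRing K) polynomialRing
                           (Identity.isRingHomomorphism (CommutativeRing.rawRing polynomialRing) S.refl)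

      -- Where no denominator of the spanning coefficients vanishes, the generic relations
      -- specialize and the minor is zero. A minor that is nonzero at some `T` would also be nonzero
      -- at a tensor where all these denominators are nonzero.
      rank⇒MinorsVanish : ∀ {r} → HasSymbolicRank (commutativeRing K) entry r →
                          ∀ T → MinorsVanish (specialize T) (suc r)
      rank⇒MinorsVanish {r} (J₀ , _ , span) T A J = ≈0-stable λ μ≉0 → atGeneric
        (nonvanishing-all (λ i t → eval t (den i)) (λ i → IsPolynomial-eval (den i) coordinate) den≉0
          (specialize-polynomial coordinate A J) (T , μ≉0))
        where
        coefficient : Fin (N ℕ.* r) → Fraction V
        coefficient i = proj₁ (span (proj₁ (remQuot r i))) (proj₂ (remQuot {N} r i))
        den : Fin (N ℕ.* r) → Poly V
        den = Fraction.den ∘ coefficient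
        den≉0 : ∀ i → ∃[ t ] ¬ eval t (den i) Ω.≈ Ω.0#
        -- A regular element is not zero: otherwise its product with `con K.1#` would vanish,
        -- forcing `1# ≈ 0#`.
        den≉0 i = ≉0⇒nonvanishing vs v∈vs (den i) λ e → Ω.1≉0
          (Ω.trans (Ω.sym φ.1#-homo) (Ω.trans (eval-sound (λ _ → Ω.0#)
            (Fraction.den-regular (coefficient i) (con K.1#) (S.trans (S.*-congʳ e) (S.zeroˡ _)))) φ.0#-homo))
        atGeneric : ¬ (∃[ t ] (¬ minor J (specialize t ∘ A) Ω.≈ Ω.0#) × (∀ i → ¬ eval t (den i) Ω.≈ Ω.0#))
        atGeneric (t , μ≉0 , dens≉0) = μ≉0 (spanningColumns⇒MinorsVanish (specialize t) J₀ span-at A J)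
          where
          module Val = FractionValue (commutativeRing K) Ωᶜ (eval-homomorphism t)
          a : ∀ l → Vector (Fraction V) r
          a l = proj₁ (span l)
          a-defined : ∀ l j → Val.Defined (a l j)
          a-defined l j e = dens≉0 (combine l j)
            (Ω.trans (Ω.reflexive (≡.cong (λ (l , j) → eval t (Fraction.den (a l j))) (remQuot-combine l j))) e)
          value : ∀ q → Val.Defined q → ∃[ x ] Val.HasValue q x
          value q d with y , e ← Ω.inverse _ d = eval t (Fraction.num q) Ω.* y ,
            Ω.sym (Ω.trans (Ω.*-assoc _ _ _) (Ω.trans (Ω.*-congˡ (Ω.trans (Ω.*-comm _ _) e)) (Ω.*-identityʳ _)))
          span-at : ∀ l → InSpan (λ j x → t (entry x (J₀ j))) (λ x → t (entry x l))
          span-at l = (λ j → proj₁ (value (a l j) (a-defined l j))) , λ x →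
            let q = LinearAlgebra.combination (functionField V) (a l) (λ j x → fromPoly (var (entry x (J₀ j)))) x
                q-defined = Val.defined-combination *-≉0 Ω.1≉0 (a l) (λ j x → fromPoly (var (entry x (J₀ j)))) x (a-defined l)
                              (λ j → Val.defined-1 *-≉0 Ω.1≉0)
                q-value = Val.value-combination (a l) (λ j x → fromPoly (var (entry x (J₀ j)))) x (λ j x → t (entry x (J₀ j)))
                            (λ j → proj₂ (value (a l j) (a-defined l j))) (λ j → Val.value-fromPoly (var (entry x (J₀ j))))
            in equal q-defined (begin
              t (entry x l) Ω.* eval t (Fraction.den q) ≈⟨ eval-* t (var (entry x l)) (Fraction.den q) ⟨
              eval t (var (entry x l) :* Fraction.den q) ≈⟨ eval-sound t (proj₂ (span l) x) ⟩
              eval t (Fraction.num q :* con K.1#) ≈⟨ eval-sound t (S.*-identityʳ (Fraction.num q)) ⟩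
              eval t (Fraction.num q) ≈⟨ q-value ⟩
              combination (λ j → proj₁ (value (a l j) (a-defined l j))) (λ j x → t (entry x (J₀ j))) x Ω.*
            eval t (Fraction.den q) ∎)
            where
            equal : ∀ {x y d} → ¬ d Ω.≈ Ω.0# → x Ω.* d Ω.≈ y Ω.* d → x Ω.≈ y
            equal {x} {y} {d} d≉0 e = RingProperties.x∙y⁻¹≈ε⇒x≈y (CommutativeRing.ring Ωᶜ) x y (cancelʳ d≉0 (begin
              (x Ω.- y) Ω.* d ≈⟨ Ω.distribʳ d x (Ω.- y) ⟩
              x Ω.* d Ω.+ (Ω.- y) Ω.* d ≈⟨ Ω.+-cong e (Ω.sym (RingProperties.-‿distribˡ-* (CommutativeRing.ring Ωᶜ) y d)) ⟩
              y Ω.* d Ω.+ Ω.- (y Ω.* d) ≈⟨ Ω.-‿inverseʳ _ ⟩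
              Ω.0# ∎))

-- Kernel charts and the parametrization of `𝓜`

-- The realization matrices matter only through the positions of their
-- indeterminate entries: entry p x j is the one in row x and column j.
module KernelModuli (em : ∀ {a} → ExcludedMiddle a)
  {c ℓ₁ ℓ₂ c′ ℓ₁′ ℓ₂′} (K : HeytingField c ℓ₁ ℓ₂) (K-infinite : IsInfinite K)
  (Ω : HeytingField c′ ℓ₁′ ℓ₂′)
  (φ : HeytingField.Carrier K → HeytingField.Carrier Ω)
  (φ-hom : IsRingHomomorphism (rawRing K) (rawRing Ω) φ)
  {V : Set} (vs : List V) (v∈vs : ∀ v → v ∈ vs)
  (n : ℕ) (Row : ℕ → Set) (N : ℕ → ℕ) (entry : ∀ p → Row p → Fin (N p) → V)
  (R′ : ℕ → ℕ)
  (rank : ∀ p → HasSymbolicRank (commutativeRing K) (entry p) (R′ p))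
  {D : Set} (deg : D → ℕ) (deg≤n : ∀ d → deg d ℕ.≤ n) (ds : List D) (d∈ds : ∀ d → d ∈ ds)
  where

  open FieldExtension em K K-infinite Ω φ φ-hom public
  open SymbolicMatrix em K K-infinite Ω φ φ-hom public
  open MultiprojectiveVariety (λ d → N (deg d) ∸ R′ (deg d)) (N ∘ deg) ds d∈ds public

  Tensor : Set c′
  Tensor = V → Ω.Carrier

  M : ∀ p → Tensor → Matrix (Row p) (N p)
  M p = specialize (entry p)

  𝓤 : Pred Tensor _
  𝓤 T = ∀ p → p ℕ.≤ n → HasRank (M p T) (R′ p)

  _Ψ↦_ : Tensor → Point → Set _
  T Ψ↦ L = ∀ d y → (y ∈Gr L d) ⇔ (y ∈Ker M (deg d) T)

  𝓜 : Pred Point _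
  𝓜 L = ∃[ T ] (T ∈ᵖ 𝓤 × T Ψ↦ L)

  vanish : ∀ p T → MinorsVanish (M p T) (suc (R′ p))
  vanish p = rank⇒MinorsVanish (entry p) vs v∈vs (rank p)

  -- Injectivity is part of the data so that the complementary columns, and with them the formula
  -- for the kernel basis, are the same for all tensors.
  record Selection (p : ℕ) : Set where
    field
      rows              : Fin (R′ p) → Row p
      columns           : Fin (R′ p) → Fin (N p)
      columns-injective : Injective _≡_ _≡_ columns
    selected : Tensor → Ω.Carrier
    selected T = minor columns (M p T ∘ rows)

    open Complement (complement columns columns-injective) using (index) public

    module _ {W : Set} (τ : V → Poly W) where

      kernelPlückerₚ : (Fin (N p ∸ R′ p) → Fin (N p)) → Poly W
      kernelPlückerₚ = symbolicPlücker (entry p) τ rows columns index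

      eval-kernelPlückerₚ : ∀ t U → eval t (kernelPlückerₚ U) Ω.≈
                            minor U (cramer (M p (eval t ∘ τ) ∘ rows) columns ∘ index)
      eval-kernelPlückerₚ t = eval-plücker (entry p) τ rows columns t index

    selected-polynomial : ∀ {W : Set} {τ : V → (W → Ω.Carrier) → Ω.Carrier} → (∀ u → IsPolynomial (τ u)) →
                          IsPolynomial (λ t → selected (λ u → τ u t))
    selected-polynomial τ-poly = specialize-polynomial (entry p) τ-poly rows columns

    module _ (T : Tensor) (ne : ¬ selected T Ω.≈ Ω.0#) where

      open KernelBasis (M p T) rows columns (complement columns columns-injective) ne (vanish p T) public

      kernel : Gr (N p ∸ R′ p) (N p)
      kernel = record { basis = κ ; independent = κ-independent }

  open Selection

  select : ∀ {p} A J T → ¬ minor J (M p T ∘ A) Ω.≈ Ω.0# → Selection p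
  select {p} A J T ne = record
    { rows = A ; columns = J ; columns-injective = minor≉0⇒injectiveColumns J (M p T ∘ A) ne }

  genericSelection : ∀ p → Σ[ σ ∈ Selection p ] ∃[ T ] ¬ selected σ T Ω.≈ Ω.0#
  genericSelection p =
    let A , J , T , ne = rank⇒minor≉0-somewhere (entry p) vs v∈vs (rank p)
    in select A J T ne , T , ne

  R′≤N : ∀ p → R′ p ℕ.≤ N p
  R′≤N p = injective⇒≤ (columns-injective (proj₁ (genericSelection p)))

  Selections : Set
  Selections = ∀ p → Selection p

  generic : Selections
  generic p = proj₁ (genericSelection p)

  AllSelected : Selections → Tensor → Set _
  AllSelected σ T = ∀ p → p ℕ.≤ n → ¬ selected (σ p) T Ω.≈ Ω.0#

  fromBounded : ∀ {ℓ} (P : ℕ → Set ℓ) → (∀ (i : Fin (suc n)) → P (toℕ i)) → ∀ p → p ℕ.≤ n → P p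
  fromBounded P f p p≤n = ≡.subst P (toℕ-fromℕ< (s≤s p≤n)) (f (fromℕ< (s≤s p≤n)))

  kernelPoint : ∀ σ T → AllSelected σ T → Point
  kernelPoint σ T ne d = kernel (σ (deg d)) T (ne (deg d) (deg≤n d))

  AllSelected⇒𝓤 : ∀ σ T → AllSelected σ T → T ∈ᵖ 𝓤
  AllSelected⇒𝓤 σ T ne p p≤n = minor≉0⇒HasRank (M p T) (rows (σ p)) (columns (σ p)) (ne p p≤n) (vanish p T)

  kernelPoint-Ψ : ∀ σ T ne → T Ψ↦ kernelPoint σ T ne
  kernelPoint-Ψ σ T ne d y = mk⇔
    (InSpan⇒Ker (M (deg d) T) (κ∈Ker (σ (deg d)) T (ne (deg d) (deg≤n d))))
    (Ker⇒InSpan (σ (deg d)) T (ne (deg d) (deg≤n d)))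

  Ψ↦-unique : ∀ T {L L′} → T Ψ↦ L → T Ψ↦ L′ → L ≋ L′
  Ψ↦-unique T {L} {L′} ψ ψ′ d j =
    Equivalence.from (ψ d (Gr.basis (L′ d) j)) (Equivalence.to (ψ′ d _) (InSpan-basis (Gr.basis (L′ d)) j))

  Ψ↦-resp : ∀ T {L L′} → L ≋ L′ → L′ ≋ L → T Ψ↦ L → T Ψ↦ L′
  Ψ↦-resp T {L} {L′} L≋L′ L′≋L ψ d y = mk⇔
    (λ y∈L′ → Equivalence.to (ψ d y) (InSpan-trans (L≋L′ d) y∈L′))
    (λ y∈Ker → InSpan-trans (L′≋L d) (Equivalence.from (ψ d y) y∈Ker))

  selections : ∀ T → T ∈ᵖ 𝓤 → Σ[ σ ∈ Selections ] AllSelected σ T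
  selections T T∈𝓤 = (λ p → proj₁ (choose p)) , λ p → proj₂ (choose p)
    where
    choose : ∀ p → Σ[ σ ∈ Selection p ] (p ℕ.≤ n → ¬ selected σ T Ω.≈ Ω.0#)
    choose p with p ℕ.≤? n
    -- Above degree `n` nothing is asked of a selection; the generic one serves as a default.
    ... | no p≰n  = generic p , λ p≤n → ⊥-elim (p≰n p≤n)
    ... | yes p≤n = let A , J , ne = HasRank⇒minor≉0 (M p T) (T∈𝓤 p p≤n) in select A J T ne , λ _ → ne

  trivialKernel : ∀ T → T ∈ᵖ 𝓤 → ∀ p → p ℕ.≤ n → N p ∸ R′ p ≡ 0 →
                  ∀ {y} → y ∈Ker M p T → ∀ j → y j Ω.≈ Ω.0#
  trivialKernel T T∈𝓤 p p≤n K′≡0 y∈Ker j =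
    let σ , ne = selections T T∈𝓤
        a , e = Ker⇒InSpan (σ p) T (ne p p≤n) y∈Ker
    in Ω.trans (e j) (empty-sum K′≡0 _)
    where
    empty-sum : ∀ {m} → m ≡ 0 → (f : Vector Ω.Carrier m) → sum f Ω.≈ Ω.0#
    empty-sum ≡.refl f = Ω.refl

  size : ℕ
  size = List.length vs

  position : V → Fin size
  position v = ListAny.index (v∈vs v)

  -- Repetitions in `vs` give several parameters for one entry, of which `tensor` reads one. That
  -- `tensor` inverts `toCoordinates` on one side is enough to reach every tensor.
  tensor : (Fin size → Ω.Carrier) → Tensor
  tensor t = t ∘ position

  toCoordinates : Tensor → Fin size → Ω.Carrier
  toCoordinates T = T ∘ List.lookup vs

  tensor-toCoordinates : ∀ T v → tensor (toCoordinates T) v ≡ T v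
  tensor-toCoordinates T v = ≡.cong T (≡.sym (ListAny.lookup-index (v∈vs v)))

  tensor-polynomial : ∀ u → IsPolynomial (λ t → tensor t u)
  tensor-polynomial u = coordinate (position u)

  selected-cong : ∀ {p} (σ : Selection p) {T T′} → (∀ v → T v ≡ T′ v) → selected σ T Ω.≈ selected σ T′
  selected-cong {p} σ e = det-cong λ i l → Ω.reflexive (e (entry p (rows σ i) (columns σ l)))

  Ker-cong : ∀ p {T T′} → (∀ v → T v ≡ T′ v) → ∀ {y} → y ∈Ker M p T → y ∈Ker M p T′
  Ker-cong p e {y} y∈Ker x =
    Ω.trans (sum-cong-≋ λ l → Ω.*-congˡ {y l} (Ω.reflexive (≡.sym (e (entry p x l))))) (y∈Ker x)

  Ψ↦-cong : ∀ {T T′} → (∀ v → T v ≡ T′ v) → ∀ {L} → T Ψ↦ L → T′ Ψ↦ L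
  Ψ↦-cong {T} {T′} e ψ d y = mk⇔
    (λ y∈L → Ker-cong (deg d) e {y} (Equivalence.to (ψ d y) y∈L))
    (λ y∈Ker → Equivalence.from (ψ d y) (Ker-cong (deg d) (λ v → ≡.sym (e v)) {y} y∈Ker))

  productUpTo : ∀ {W : Set} → ℕ → (ℕ → Poly W) → Poly W
  productUpTo zero    f = con K.1#
  productUpTo (suc m) f = f m :* productUpTo m f

  productUpTo-≉0 : ∀ {W : Set} m (f : ℕ → Poly W) {t} → (∀ p → p ℕ.< m → ¬ eval t (f p) Ω.≈ Ω.0#) →
                   ¬ eval t (productUpTo m f) Ω.≈ Ω.0#
  productUpTo-≉0 zero    f ne e = Ω.1≉0 (Ω.trans (Ω.sym (IsRingHomomorphism.1#-homo φ-hom)) e)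
  productUpTo-≉0 (suc m) f {t} ne e = *-≉0 (ne m ℕ.≤-refl) (productUpTo-≉0 m f λ p p<m → ne p (ℕ.m≤n⇒m≤1+n p<m))
    (Ω.trans (Ω.sym (eval-* t (f m) (productUpTo m f))) e)

  productUpTo-factor : ∀ {W : Set} m (f : ℕ → Poly W) {t} → ¬ eval t (productUpTo m f) Ω.≈ Ω.0# →
                       ∀ p → p ℕ.< m → ¬ eval t (f p) Ω.≈ Ω.0#
  productUpTo-factor (suc m) f {t} ne p p<1+m e with ℕ.m<1+n⇒m<n∨m≡n p<1+m
  ... | inj₁ p<m    = productUpTo-factor m f (λ e′ → ne (Ω.trans (eval-* t (f m) (productUpTo m f)) (x*0≈0 _ e′))) p p<m e
  ... | inj₂ ≡.refl = ne (Ω.trans (eval-* t (f m) (productUpTo m f)) (0*x≈0 _ e))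

  -- Polynomials `τ` are substituted for the tensor entries: affine coordinates for the
  -- parametrization of `𝓜`, and later `solutionₚ`, whose variables are Plücker coordinates.
  module _ {W : Set} (τ : V → Poly W) (σ : Selections) where

    selectedₚ : ℕ → Poly W
    selectedₚ p = symbolicMinor (entry p) τ (rows (σ p)) (columns (σ p))

    plückerₚ : Coordinate → Poly W
    plückerₚ (d , J) = kernelPlückerₚ (σ (deg d)) τ (lookup J)

    eval-selectedₚ : ∀ t p → eval t (selectedₚ p) Ω.≈ selected (σ p) (eval t ∘ τ)
    eval-selectedₚ t p = eval-minor (entry p) τ (rows (σ p)) (columns (σ p)) t

    eval-plückerₚ : ∀ t ne J → eval t (plückerₚ J) Ω.≈ coordinates (kernelPoint σ (eval t ∘ τ) ne) J
    eval-plückerₚ t ne (d , J) = eval-kernelPlückerₚ (σ (deg d)) τ t (lookup J)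

  module _ (σ : Selections) where

    private
      τ : V → Poly (Fin size)
      τ = var ∘ position

    domainₚ : Poly (Fin size)
    domainₚ = productUpTo (suc n) (selectedₚ τ σ)

    domain⇒selected : ∀ t → ¬ eval t domainₚ Ω.≈ Ω.0# → AllSelected σ (tensor t)
    domain⇒selected t t∈ p p≤n e = productUpTo-factor (suc n) (selectedₚ τ σ) t∈ p (s≤s p≤n)
      (Ω.trans (eval-selectedₚ τ σ t p) e)

    selected⇒domain : ∀ t → AllSelected σ (tensor t) → ¬ eval t domainₚ Ω.≈ Ω.0#
    selected⇒domain t ne = productUpTo-≉0 (suc n) (selectedₚ τ σ)
      (λ p p<1+n e → ne p (ℕ.≤-pred p<1+n) (Ω.trans (Ω.sym (eval-selectedₚ τ σ t p)) e))

    domain-nonvanishing : (∀ p → p ℕ.≤ n → ∃[ T ] ¬ selected (σ p) T Ω.≈ Ω.0#) → ∃[ t ] ¬ eval t domainₚ Ω.≈ Ω.0#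
    domain-nonvanishing σ≉0 =
      let t , _ , ne = nonvanishing-all {n = suc n} (λ i t → selected (σ (toℕ i)) (tensor t))
            (λ i → selected-polynomial (σ (toℕ i)) tensor-polynomial)
            (λ i → let T , ne = σ≉0 (toℕ i) (toℕ≤pred[n] i) in
              toCoordinates T , λ e → ne (Ω.trans (Ω.sym (selected-cong (σ (toℕ i)) (tensor-toCoordinates T))) e))
            (const Ω.1#) ((λ _ → Ω.0#) , Ω.1≉0)
      in t , selected⇒domain t (fromBounded (λ p → ¬ selected (σ p) (tensor t) Ω.≈ Ω.0#) ne)

    Φ : (Fin size → Ω.Carrier) → Coordinate → Ω.Carrier
    Φ t J = eval t (plückerₚ τ σ J)

    Φ-coordinates : ∀ t ne → HasCoordinates (kernelPoint σ (tensor t) ne) (Φ t)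
    Φ-coordinates t ne d = Ω.1# , Ω.1≉0 , λ J →
      Ω.trans (eval-plückerₚ τ σ t ne (d , J)) (Ω.sym (Ω.*-identityˡ _))

    Φ-polynomial : ∀ f → IsPolynomial (λ t → eval (Φ t) f)
    Φ-polynomial f = IsPolynomial-eval f (λ J → IsPolynomial-eval (plückerₚ τ σ J) coordinate)

    parametrization : (∀ p → p ℕ.≤ n → ∃[ T ] ¬ selected (σ p) T Ω.≈ Ω.0#) → RationalMap size
    parametrization σ≉0 = record
      { domain     = domainₚ
      ; nonempty   = λ e → let t , ne = domain-nonvanishing σ≉0 in
          ne (Ω.trans (eval-sound t e) (IsRingHomomorphism.0#-homo φ-hom))
      ; components = plückerₚ τ σ
      ; defined    = λ t t∈ → kernelPoint σ (tensor t) (domain⇒selected t t∈) , Φ-coordinates t (domain⇒selected t t∈)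
      }

    image⊆𝓜 : ∀ σ≉0 → RationalMap.Image (parametrization σ≉0) ⊆ 𝓜
    image⊆𝓜 _ {L} (t , t∈ , t↦L) = tensor t , AllSelected⇒𝓤 σ (tensor t) ne ,
      Ψ↦-resp (tensor t) {L₀} {L} (proj₂ same) (proj₁ same) (kernelPoint-Ψ σ (tensor t) ne)
      where
      ne : AllSelected σ (tensor t)
      ne = domain⇒selected t t∈
      L₀ : Point
      L₀ = kernelPoint σ (tensor t) ne
      same : L ≋ L₀ × L₀ ≋ L
      same = HasCoordinates⇒≋ {L} {L₀} λ d → let u , u≉0 , e = t↦L d in u , u≉0 , λ J →
        Ω.trans (Ω.sym (eval-plückerₚ τ σ t ne (d , J))) (e J)

  generic≉0 : ∀ p → p ℕ.≤ n → ∃[ T ] ¬ selected (generic p) T Ω.≈ Ω.0#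
  generic≉0 p _ = proj₂ (genericSelection p)

  -- The generic minors may vanish at the tensor of `L`, so `f` is pulled back along a chart `σ`
  -- through that tensor. Where both charts are defined they give the same kernels, and the pullback
  -- vanishes there. If `f` were nonzero at `L`, its pullback times both domain polynomials would be
  -- nonzero at some tensor.
  image-dense : IsDenseIn (RationalMap.Image (parametrization generic generic≉0)) 𝓜
  image-dense Z image⊆Z {L} (T , T∈𝓤 , ψ) f eqn = ≈0-stable contradict
    where
    hom = proj₂ (ClosedSet.homogeneous Z eqn)
    σ : Selections
    σ = proj₁ (selections T T∈𝓤)
    t₀ : Fin size → Ω.Carrier
    t₀ = toCoordinates T
    ne₀ : AllSelected σ (tensor t₀)
    ne₀ p p≤n e = proj₂ (selections T T∈𝓤) p p≤n (Ω.trans (Ω.sym (selected-cong (σ p) (tensor-toCoordinates T))) e)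
    L₀ : Point
    L₀ = kernelPoint σ (tensor t₀) ne₀
    L₀≋L : L₀ ≋ L
    L₀≋L = Ψ↦-unique (tensor t₀) {L₀} {L} (kernelPoint-Ψ σ (tensor t₀) ne₀)
             (Ψ↦-cong (λ v → ≡.sym (tensor-toCoordinates T v)) {L} ψ)
    f₀≉0 : ¬ eval (coordinates L) f Ω.≈ Ω.0# → ¬ eval (Φ σ t₀) f Ω.≈ Ω.0#
    f₀≉0 f≉0 e = f≉0 (homogeneous-zero hom (λ d → let u , _ , e = ≋⇒proportional {L₀} {L} L₀≋L d in u , e)
      (HasCoordinates⇒zero⁻¹ hom {L₀} {Φ σ t₀} (Φ-coordinates σ t₀ ne₀) e))
    onImage : ∀ t → AllSelected σ (tensor t) → ¬ eval t (domainₚ generic) Ω.≈ Ω.0# → eval (Φ σ t) f Ω.≈ Ω.0#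
    onImage t neσ t∈ = HasCoordinates⇒zero hom {L₂} {Φ σ t} (Φ-coordinates σ t neσ)
      (zeros-resp {L₁} {L₂} L₁≋L₂ Z (image⊆Z {L₁} (t , t∈ , Φ-coordinates generic t neγ)) f eqn)
      where
      neγ = domain⇒selected generic t t∈
      L₁ L₂ : Point
      L₁ = kernelPoint generic (tensor t) neγ
      L₂ = kernelPoint σ (tensor t) neσ
      L₁≋L₂ : L₁ ≋ L₂
      L₁≋L₂ = Ψ↦-unique (tensor t) {L₁} {L₂} (kernelPoint-Ψ generic (tensor t) neγ) (kernelPoint-Ψ σ (tensor t) neσ)
    nonvanishing : ¬ eval (coordinates L) f Ω.≈ Ω.0# →
      ∃[ t ] ¬ (eval (Φ σ t) f Ω.* eval t (domainₚ σ)) Ω.* eval t (domainₚ generic) Ω.≈ Ω.0#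
    nonvanishing f≉0 = nonvanishing-* (Φ-polynomial σ f ⊗ IsPolynomial-eval (domainₚ σ) coordinate)
      (IsPolynomial-eval (domainₚ generic) coordinate)
      (t₀ , *-≉0 (f₀≉0 f≉0) (selected⇒domain σ t₀ ne₀)) (domain-nonvanishing generic generic≉0)
    contradict : ¬ ¬ eval (coordinates L) f Ω.≈ Ω.0#
    contradict f≉0 = let t , ne = nonvanishing f≉0 in ne (0*x≈0 _ (0*x≈0 _
      (onImage t (domain⇒selected σ t (λ e → ne (0*x≈0 _ (x*0≈0 _ e)))) (λ e → ne (x*0≈0 _ e)))))

  𝓜-unirational : IsUnirational 𝓜
  𝓜-unirational = size , parametrization generic generic≉0 , (λ {L} → image⊆𝓜 generic generic≉0 {L}) , image-dense

  𝓜-irreducible : IsIrreducible 𝓜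
  𝓜-irreducible = unirational⇒irreducible 𝓜 𝓜-unirational

  -- When the entries of the d₀-th matrix are distinct indeterminates, every
  -- subspace of the right dimension is the kernel of a specialization.
  module Projection (d₀ : D)
    (entry-injective : ∀ {x x′ j j′} → entry (deg d₀) x j ≡ entry (deg d₀) x′ j′ → x ≡ x′ × j ≡ j′)
    where

    private
      p₀ = deg d₀
      r = N p₀ ∸ R′ p₀

    module G₀ = MultiprojectiveVariety {Unit.⊤} (λ _ → r) (λ _ → N p₀) (Unit.tt ∷ []) (λ _ → here ≡.refl)

    project₀ : Point → G₀.Point
    project₀ L _ = L d₀

    record Realization (b : Fin r → Vector Ω.Carrier (N p₀)) : Set (c′ ⊔ ℓ₁′) where
      field
        selection : Selection p₀
        T         : Tensor
        selected≉0 : ¬ selected selection T Ω.≈ Ω.0#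
        b∈Ker     : ∀ i → b i ∈Ker M p₀ T

    -- A basis `θ` of the vectors orthogonal to `b` has `R′ p₀` members. They are written into as
    -- many rows of the matrix, and all other entries are set to zero; distinct indeterminates make
    -- this free of conflicts. On the columns `free` the rows `θ` are a nonzero multiple of the
    -- identity, so the rank is not too small.
    realize : ∀ b → LinearlyIndependent b → Realization b
    realize b ind = uncurry fromMinor (independent⇒minor b ind)
      where
      fromMinor : ∀ J → ¬ minor J b Ω.≈ Ω.0# → Realization b
      fromMinor J D≉0 = record
        { selection  = select A′ J′ T ne′
        ; T          = T
        ; selected≉0 = ne′
        ; b∈Ker      = b∈Ker′
        }
        where
        J-complement : Complement J
        J-complement = complement J (minor≉0⇒injectiveColumns J b D≉0)
        open Complement J-complement using () renaming (index to free; injective to free-injective)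
        open KernelBasis {Row = Fin r} b id J J-complement D≉0 (tooManyRows b)
          using () renaming (κ to θ; κ∈Ker to θ⊥b; κ-index to θ-free)
        corank : N p₀ ∸ r ≡ R′ p₀
        corank = ℕ.m∸[m∸n]≡n (R′≤N p₀)
        -- The rows of a nonzero generic minor are pairwise distinct, which provides room for all of
        -- `θ`.
        row : Fin (N p₀ ∸ r) → Row p₀
        row i = rows (generic p₀) (Fin.cast corank i)
        row-injective : Injective _≡_ _≡_ row
        row-injective e = cast-injective (minor≉0⇒injectiveRows (M p₀ (proj₁ (proj₂ (genericSelection p₀))))
          (rows (generic p₀)) (columns (generic p₀)) (proj₂ (proj₂ (genericSelection p₀))) e)
          where
          cast-injective : ∀ {i j} → Fin.cast corank i ≡ Fin.cast corank j → i ≡ j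
          cast-injective {i} {j} e = toℕ-injective
            (≡.trans (≡.sym (toℕ-cast corank i)) (≡.trans (≡.cong toℕ e) (toℕ-cast corank j)))
        Placed : V → Set
        Placed v = ∃[ i ] ∃[ l ] entry p₀ (row i) l ≡ v
        place : ∀ {v} → Dec (Placed v) → Ω.Carrier
        place (yes (i , l , _)) = θ i l
        place (no _)            = Ω.0#
        T : Tensor
        T v = place (em {P = Placed v})
        T-row : ∀ i l → T (entry p₀ (row i) l) Ω.≈ θ i l
        T-row i l = atRow em
          where
          atRow : (placed? : Dec (Placed (entry p₀ (row i) l))) → place placed? Ω.≈ θ i l
          atRow (no none) = ⊥-elim (none (i , l , ≡.refl))
          atRow (yes (i′ , l′ , e)) =
            Ω.reflexive (≡.cong₂ θ (row-injective (proj₁ (entry-injective e))) (proj₂ (entry-injective e)))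
        T-other : ∀ x → ¬ (∃[ i ] row i ≡ x) → ∀ l → T (entry p₀ x l) Ω.≈ Ω.0#
        T-other x none l = atRow em
          where
          atRow : (placed? : Dec (Placed (entry p₀ x l))) → place placed? Ω.≈ Ω.0#
          atRow (no _)              = Ω.refl
          atRow (yes (i , l′ , e)) = ⊥-elim (none (i , proj₁ (entry-injective e)))
        b∈Ker′ : ∀ i → b i ∈Ker M p₀ T
        b∈Ker′ i x = atRow em
          where
          atRow : Dec (∃[ i ] row i ≡ x) → sum (λ l → b i l Ω.* T (entry p₀ x l)) Ω.≈ Ω.0#
          atRow (yes (c , ≡.refl)) = Ω.trans (sum-cong-≋ λ l →
            Ω.trans (Ω.*-congˡ {b i l} (T-row c l)) (Ω.*-comm (b i l) (θ c l))) (θ⊥b c i)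
          atRow (no none) = sum-zero λ l → x*0≈0 (b i l) (T-other x none l)
        free-independent : LinearlyIndependent (λ j x → M p₀ T x (free j))
        free-independent a e c = cancelʳ D≉0 (begin
          a c Ω.* minor J b ≈⟨ Ω.*-congˡ (Ω.trans (θ-free c c) (δ-refl (free c) (minor J b))) ⟨
          a c Ω.* θ c (free c)
            ≈⟨ sum-single c {λ j → a j Ω.* θ c (free j)} (λ j c≢j → x*0≈0 (a j)
                 (Ω.trans (θ-free c j) (δ-≢ (minor J b) (λ e → c≢j (free-injective e))))) ⟨
          sum (λ j → a j Ω.* θ c (free j)) ≈⟨ sum-cong-≋ (λ j → Ω.*-congˡ {a j} (Ω.sym (T-row c (free j)))) ⟩
          sum (λ j → a j Ω.* T (entry p₀ (row c) (free j))) ≈⟨ e (row c) ⟩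
          Ω.0# ∎)
        HasMinor : ℕ → Set _
        HasMinor q = Σ[ A ∈ (Fin q → Row p₀) ] Σ[ J ∈ (Fin q → Fin (N p₀)) ] ¬ minor J (M p₀ T ∘ A) Ω.≈ Ω.0#
        hasMinor : HasMinor (R′ p₀)
        hasMinor = ≡.subst HasMinor corank
          (let A , ne = independent⇒columnsMinor (λ x j → M p₀ T x (free j)) free-independent in A , free , ne)
        A′ = proj₁ hasMinor
        J′ = proj₁ (proj₂ hasMinor)
        ne′ = proj₂ (proj₂ hasMinor)

    -- The tensor that realizes `W` is controlled in the degree of `d₀` only and may lie outside
    -- `𝓤`. The kernel chart of this degree is polynomial around it, and wherever the generic minors
    -- of all degrees are nonzero too, its value is the projection of a point of `𝓜`.
    project₀-dominant : G₀.IsDenseIn (λ W → ∃[ L ] (L ∈ᵖ 𝓜 × W ≡ project₀ L)) (λ _ → Unit.⊤)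
    project₀-dominant Z images⊆Z {W} _ f eqn = ≈0-stable contradict
      where
      open Realization (realize (Gr.basis (W Unit.tt)) (Gr.independent (W Unit.tt)))
      hom = proj₂ (G₀.ClosedSet.homogeneous Z eqn)
      plückerₚ₀ : G₀.Coordinate → Poly (Fin size)
      plückerₚ₀ (_ , J) = kernelPlückerₚ selection (var ∘ position) (lookup J)
      Φ₀ : (Fin size → Ω.Carrier) → G₀.Coordinate → Ω.Carrier
      Φ₀ t J = eval t (plückerₚ₀ J)
      point : ∀ t → ¬ selected selection (tensor t) Ω.≈ Ω.0# → G₀.Point
      point t ne _ = kernel selection (tensor t) ne
      Φ₀-coordinates : ∀ t ne → G₀.HasCoordinates (point t ne) (Φ₀ t)
      Φ₀-coordinates t ne _ = Ω.1# , Ω.1≉0 , λ J →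
        Ω.trans (eval-kernelPlückerₚ selection (var ∘ position) t (lookup J)) (Ω.sym (Ω.*-identityˡ _))
      Φ₀-polynomial : IsPolynomial (λ t → eval (Φ₀ t) f)
      Φ₀-polynomial = IsPolynomial-eval f λ J → IsPolynomial-eval (plückerₚ₀ J) coordinate
      t₀ : Fin size → Ω.Carrier
      t₀ = toCoordinates T
      ne₀ : ¬ selected selection (tensor t₀) Ω.≈ Ω.0#
      ne₀ e = selected≉0 (Ω.trans (Ω.sym (selected-cong selection (tensor-toCoordinates T))) e)
      L₀≋W : point t₀ ne₀ G₀.≋ W
      L₀≋W _ j = Ker⇒InSpan selection (tensor t₀) ne₀
        (Ker-cong p₀ (λ v → ≡.sym (tensor-toCoordinates T v)) {Gr.basis (W Unit.tt) j} (b∈Ker j))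
      f₀≉0 : ¬ eval (G₀.coordinates W) f Ω.≈ Ω.0# → ¬ eval (Φ₀ t₀) f Ω.≈ Ω.0#
      f₀≉0 f≉0 e = f≉0 (G₀.homogeneous-zero hom
        (λ d → let u , _ , e = G₀.≋⇒proportional {point t₀ ne₀} {W} L₀≋W d in u , e)
        (G₀.HasCoordinates⇒zero⁻¹ hom {point t₀ ne₀} {Φ₀ t₀} (Φ₀-coordinates t₀ ne₀) e))
      atGeneric : ∀ t → ¬ selected selection (tensor t) Ω.≈ Ω.0# → AllSelected generic (tensor t) →
                  eval (Φ₀ t) f Ω.≈ Ω.0#
      atGeneric t neσ neγ = G₀.HasCoordinates⇒zero hom {point t neσ} {Φ₀ t} (Φ₀-coordinates t neσ)
        (G₀.zeros-resp {project₀ L} {point t neσ} L≋ Z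
          (images⊆Z {project₀ L}
            (L , (tensor t , AllSelected⇒𝓤 generic (tensor t) neγ , kernelPoint-Ψ generic (tensor t) neγ) , ≡.refl)) f eqn)
        where
        L : Point
        L = kernelPoint generic (tensor t) neγ
        L≋ : project₀ L G₀.≋ point t neσ
        L≋ _ j = Ker⇒InSpan (generic p₀) (tensor t) (neγ p₀ (deg≤n d₀)) (κ∈Ker selection (tensor t) neσ j)
      nonvanishing : ¬ eval (G₀.coordinates W) f Ω.≈ Ω.0# →
        ∃[ t ] ¬ (eval (Φ₀ t) f Ω.* selected selection (tensor t)) Ω.* eval t (domainₚ generic) Ω.≈ Ω.0#
      nonvanishing f≉0 = nonvanishing-* (Φ₀-polynomial ⊗ selected-polynomial selection tensor-polynomial)
        (IsPolynomial-eval (domainₚ generic) coordinate) (t₀ , *-≉0 (f₀≉0 f≉0) ne₀) (domain-nonvanishing generic generic≉0)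
      contradict : ¬ ¬ eval (G₀.coordinates W) f Ω.≈ Ω.0#
      contradict f≉0 = let t , ne = nonvanishing f≉0 in ne (0*x≈0 _ (0*x≈0 _
        (atGeneric t (λ e → ne (0*x≈0 _ (x*0≈0 _ e))) (domain⇒selected generic t (λ e → ne (x*0≈0 _ e))))))

  -- Constructibility of `𝓜`

  -- Overwriting the head keeps the length `r`, so that the positive number `N p ∸ R′ p` is never
  -- rewritten as a successor.
  swapHead : ∀ {r m} → Fin m → Vec (Fin m) r → Vec (Fin m) r
  swapHead l Vec.[]      = Vec.[]
  swapHead l (_ Vec.∷ J) = l Vec.∷ J

  swapHead-InSpan : ∀ {r m} → 0 ℕ.< r → (b : Fin r → Vector Ω.Carrier m) (J : Vec (Fin m) r) →
                    InSpan b (λ l → minor (lookup (swapHead l J)) b)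
  swapHead-InSpan (s≤s _) b (a Vec.∷ J) = InSpan-resp {b = b}
    (λ l → det-cong {M = λ i j → b i ((l Vector.∷ lookup J) j)} {N = λ i j → b i (lookup (l Vec.∷ J) j)}
      λ { i zero → Ω.refl ; i (suc j) → Ω.refl })
    (headColumn-InSpan b (lookup J))

  swapHead-perp : ∀ {r m} → 0 ℕ.< r → (b : Fin r → Vector Ω.Carrier m) → LinearlyIndependent b →
                  ∀ (w : Vector Ω.Carrier m) →
                  (∀ (J : Vec (Fin m) r) → sum (λ l → minor (lookup (swapHead l J)) b Ω.* w l) Ω.≈ Ω.0#) →
                  ∀ (y : Vector Ω.Carrier m) → InSpan b y → sum (λ l → y l Ω.* w l) Ω.≈ Ω.0#
  -- The placeholder head `zero` below presupposes a column; without columns the sum is empty.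
  swapHead-perp {m = zero}  (s≤s _) b ind w perp y y∈b = Ω.refl
  swapHead-perp {m = suc m} (s≤s _) b ind w perp = headColumns-perp b ind w λ J →
    Ω.trans (sum-cong-≋ λ l → Ω.*-congʳ {w l} (det-cong {M = λ i j → b i ((l Vector.∷ J) j)}
              {N = λ i j → b i (lookup (l Vec.∷ tabulate J) j)}
              λ { i zero → Ω.refl ; i (suc j) → Ω.reflexive (≡.cong (b i) (≡.sym (lookup∘tabulate J j))) }))
            (perp (zero Vec.∷ tabulate J))

  module Symbolicₚ where
    open PolynomialRing (commutativeRing K) Coordinate public
    module S = CommutativeRing polynomialRing
    module A = RawCramer (CommutativeRing.rawRing polynomialRing)
    module L = LinearAlgebra (CommutativeRing.rawRing polynomialRing)
    open RawSemiringDefs (RawRing.rawSemiring (CommutativeRing.rawRing polynomialRing)) public using () renaming (sum to sumₚ)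
  open Symbolicₚ

  addDegrees : ∀ {r} → (Fin r → D → ℕ) → D → ℕ
  addDegrees {zero}  e d = 0
  addDegrees {suc r} e d = e zero d ℕ.+ addDegrees (e ∘ suc) d

  unitDegree : D → D → ℕ
  unitDegree d d′ = if does (em {P = d′ ≡ d}) then 1 else 0

  homogeneous-var : ∀ d J → IsMultihomogeneous (unitDegree d) (var (d , J))
  homogeneous-var d J = var J one none
    where
    one : unitDegree d d ≡ 1
    one with em {P = d ≡ d}
    ... | yes _  = ≡.refl
    ... | no d≢d = ⊥-elim (d≢d ≡.refl)
    none : ∀ d′ → d′ ≢ d → unitDegree d d′ ≡ 0
    none d′ d′≢d with em {P = d′ ≡ d}
    ... | yes e = ⊥-elim (d′≢d e)
    ... | no _  = ≡.refl

  -- The constructor `con` yields degree zero only. In degree `e`, zero is obtained as zero times a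
  -- polynomial of that degree; empty sums and omitted entries rely on this.
  homogeneous-0 : ∀ {e f} → IsMultihomogeneous e f → IsMultihomogeneous e (con K.0#)
  homogeneous-0 {f = f} h = resp (λ _ → ≡.refl) (S.zeroˡ f) (con K.0# :* h)

  homogeneous-sum : ∀ {e} → IsMultihomogeneous e (con K.0#) → ∀ {m} {f : Fin m → Poly Coordinate} →
                    (∀ i → IsMultihomogeneous e (f i)) → IsMultihomogeneous e (sumₚ f)
  homogeneous-sum h0 {zero}  h = h0
  homogeneous-sum h0 {suc m} h = h zero :+ homogeneous-sum h0 (h ∘ suc)

  homogeneous-sign : ∀ {m} (j : Fin m) → IsMultihomogeneous (λ _ → 0) (A.sign j)
  homogeneous-sign zero    = con K.1#
  homogeneous-sign (suc j) = (:- con K.1#) :* homogeneous-sign j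

  homogeneous-det : ∀ {r} (e : Fin r → D → ℕ) {B : Fin r → Fin r → Poly Coordinate} →
                    (∀ i j → IsMultihomogeneous (e i) (B i j)) → IsMultihomogeneous (addDegrees e) (L.det B)
  homogeneous-det {zero}  e h = con K.1#
  homogeneous-det {suc r} e {B} h = homogeneous-sum (homogeneous-0 (term zero)) term
    where
    term : ∀ j → IsMultihomogeneous (addDegrees e) (A.sign j :* (B zero j :* L.det (λ i l → B (suc i) (punchIn j l))))
    term j = homogeneous-sign j :* (h zero j :* homogeneous-det (e ∘ suc) (λ i l → h (suc i) (punchIn j l)))

  homogeneous-scatter : ∀ {e} → IsMultihomogeneous e (con K.0#) → ∀ {q m} (U : Fin q → Fin m) {a} →
                        (∀ i → IsMultihomogeneous e (a i)) → ∀ x → IsMultihomogeneous e (A.scatter U a x)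
  homogeneous-scatter h0 U {a} h x = homogeneous-sum h0 {f = λ i → A.δ[ U i , x ] a i} entry-homogeneous
    where
    entry-homogeneous : ∀ i → IsMultihomogeneous _ (A.δ[ U i , x ] a i)
    entry-homogeneous i with does (U i ≟ x)
    ... | true  = h i
    ... | false = h0

  homogeneous-cramer : ∀ {r m} (e : Fin r → D → ℕ) {w : Fin r → Fin m → Poly Coordinate} →
                       (∀ i j → IsMultihomogeneous (e i) (w i j)) → ∀ J l x →
                       IsMultihomogeneous (addDegrees e) (A.cramer w J l x)
  homogeneous-cramer e {w} h J l = homogeneous-scatter (homogeneous-0 (cofactor zero)) (l Vector.∷ J) cofactor
    where
    cofactor : ∀ i → IsMultihomogeneous (addDegrees e) (A.cofactors w (l Vector.∷ J) i)
    cofactor i = homogeneous-sign i :* homogeneous-det e (λ a b → h a _)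

  homogeneous-product : ∀ m (f : ℕ → Poly Coordinate) → (∀ p → ∃[ e ] IsMultihomogeneous e (f p)) →
                        ∃[ e ] IsMultihomogeneous e (productUpTo m f)
  homogeneous-product zero    f h = _ , con K.1#
  homogeneous-product (suc m) f h = _ , proj₂ (h m) :* proj₂ (homogeneous-product m f h)

  module Constructible (0<K′ : ∀ d → 0 ℕ.< N (deg d) ∸ R′ (deg d)) where

    RowIndex : Set
    RowIndex = Σ[ d ∈ D ] (Vec (Fin (N (deg d))) (N (deg d) ∸ R′ (deg d)) × Row (deg d))

    -- The linear equations on t that express that L lies in the kernels of tensor t.
    system : Point → Matrix RowIndex size
    system L (d , J , x) = scatter (position ∘ entry (deg d) x) (λ l → plücker (L d) (swapHead l J))

    systemₚ : RowIndex → Fin size → Poly Coordinate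
    systemₚ (d , J , x) = A.scatter (position ∘ entry (deg d) x) (λ l → var (d , swapHead l J))

    system-degree : RowIndex → D → ℕ
    system-degree (d , _) = unitDegree d

    systemₚ-homogeneous : ∀ x i → IsMultihomogeneous (system-degree x) (systemₚ x i)
    systemₚ-homogeneous (d , J , x) = homogeneous-scatter (homogeneous-0 (homogeneous-var d J))
      (position ∘ entry (deg d) x) (λ l → homogeneous-var d (swapHead l J))

    system-product : ∀ L t d J x → sum (λ i → t i Ω.* system L (d , J , x) i) Ω.≈
                     sum (λ l → plücker (L d) (swapHead l J) Ω.* M (deg d) (tensor t) x l)
    system-product L t d J x = Ω.trans (sum-cong-≋ λ i → Ω.*-comm (t i) (system L (d , J , x) i))
      (sum-scatter (position ∘ entry (deg d) x) (λ l → plücker (L d) (swapHead l J)) t)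

    -- The vectors `l ↦ plücker (L d) (swapHead l J)` span `L d`, so equations stated for them hold
    -- for a basis.
    Ker-system⇒ : ∀ L t → t ∈Ker system L → ∀ d j → Gr.basis (L d) j ∈Ker M (deg d) (tensor t)
    Ker-system⇒ L t t∈Ker d j x = swapHead-perp (0<K′ d) (Gr.basis (L d)) (Gr.independent (L d)) (M (deg d) (tensor t) x)
      (λ J → Ω.trans (Ω.sym (system-product L t d J x)) (t∈Ker (d , J , x)))
      (Gr.basis (L d) j) (InSpan-basis (Gr.basis (L d)) j)

    Ker-system⇐ : ∀ L t → (∀ d j → Gr.basis (L d) j ∈Ker M (deg d) (tensor t)) → t ∈Ker system L
    Ker-system⇐ L t b∈Ker (d , J , x) = Ω.trans (system-product L t d J x)
      (InSpan⇒Ker (M (deg d) (tensor t)) (b∈Ker d) (swapHead-InSpan (0<K′ d) (Gr.basis (L d)) J) x)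

    eval-systemₚ : ∀ L x i → eval (coordinates L) (systemₚ x i) Ω.≈ system L x i
    eval-systemₚ L (d , J , x) i = scatter-homo (position ∘ entry (deg d) x) (λ l → var (d , swapHead l J)) i
      where open RingHomomorphism Ωᶜ (eval-homomorphism (coordinates L))

    systemMinorₚ : ∀ {ρ} → (Fin ρ → RowIndex) → (Fin ρ → Fin size) → Poly Coordinate
    systemMinorₚ A U = A.minor U (systemₚ ∘ A)

    eval-systemMinorₚ : ∀ L {ρ} (A : Fin ρ → RowIndex) U → eval (coordinates L) (systemMinorₚ A U) Ω.≈ minor U (system L ∘ A)
    eval-systemMinorₚ L A U = Ω.trans (det-homo (λ i l → systemₚ (A i) (U l))) (det-cong λ i l → eval-systemₚ L (A i) (U l))
      where open RingHomomorphism Ωᶜ (eval-homomorphism (coordinates L))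

    systemMinorₚ-homogeneous : ∀ {ρ} (A : Fin ρ → RowIndex) U →
                               IsMultihomogeneous (addDegrees (system-degree ∘ A)) (systemMinorₚ A U)
    systemMinorₚ-homogeneous A U = homogeneous-det (system-degree ∘ A) λ i l → systemₚ-homogeneous (A i) (U l)

    -- The minor `A`, `U` makes Cramer's rule applicable to the system, `a` singles out one
    -- solution, and `σ` names the minors that certify this solution to be in `𝓤`.
    record Chart (ρ : ℕ) : Set c where
      field
        A         : Fin ρ → RowIndex
        U         : Fin ρ → Fin size
        injective : Injective _≡_ _≡_ U
        σ         : Selections
        a         : Fin (size ∸ ρ) → K.Carrier

      C : Complement U
      C = complement U injective
      open Complement C using () renaming (index to free)

      -- When the minor A, U attains the rank of the system, all solutions are of
      -- this form, with parameters a in Ω.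
      solutionₚ : V → Poly Coordinate
      solutionₚ v = sumₚ (λ i → con (a i) :* A.cramer (systemₚ ∘ A) U (free i) (position v))

      solution : Point → Fin size → Ω.Carrier
      solution L = combination (φ ∘ a) (cramer (system L ∘ A) U ∘ free)

      eval-solutionₚ : ∀ L v → eval (coordinates L) (solutionₚ v) Ω.≈ tensor (solution L) v
      eval-solutionₚ L v = Ω.trans (sum-homo (λ i → con (a i) :* A.cramer (systemₚ ∘ A) U (free i) (position v)))
        (sum-cong-≋ λ i → Ω.trans (eval-* (coordinates L) (con (a i)) (A.cramer (systemₚ ∘ A) U (free i) (position v)))
          (Ω.*-congˡ {φ (a i)} (Ω.trans (cramer-homo (systemₚ ∘ A) U (free i) (position v))
            (cramer-cong (λ j y → eval-systemₚ L (A j) y) U (free i) (position v)))))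
        where open RingHomomorphism Ωᶜ (eval-homomorphism (coordinates L))

      solutionₚ-homogeneous : ∀ v → IsMultihomogeneous (addDegrees (system-degree ∘ A)) (solutionₚ v)
      solutionₚ-homogeneous v = homogeneous-sum (homogeneous-0 (systemMinorₚ-homogeneous A U))
        {f = λ i → con (a i) :* A.cramer (systemₚ ∘ A) U (free i) (position v)}
        λ i → con (a i) :* homogeneous-cramer (system-degree ∘ A) (λ j y → systemₚ-homogeneous (A j) y) U (free i) (position v)

      selectionₚ : Poly Coordinate
      selectionₚ = productUpTo (suc n) (selectedₚ solutionₚ σ)

      -- One multihomogeneous polynomial whose nonvanishing says both that Cramer's rule applies and
      -- that the solution lies in `𝓤`. Existence of a suitable chart thus becomes the complement of
      -- a closed set.
      equation : Poly Coordinate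
      equation = systemMinorₚ A U :* selectionₚ

      equation-homogeneous : ∃[ e ] IsMultihomogeneous e equation
      equation-homogeneous = _ , systemMinorₚ-homogeneous A U :* proj₂ (homogeneous-product (suc n) (selectedₚ solutionₚ σ)
        λ p → _ , homogeneous-det (λ _ → addDegrees (system-degree ∘ A))
          {B = λ i l → solutionₚ (entry p (rows (σ p) i) (columns (σ p) l))} (λ i l → solutionₚ-homogeneous _))

      module _ (L : Point) where

        selected-solution : ∀ p → eval (coordinates L) (selectedₚ solutionₚ σ p) Ω.≈ selected (σ p) (tensor (solution L))
        selected-solution p = Ω.trans (eval-selectedₚ solutionₚ σ (coordinates L) p)
          (det-cong λ i l → eval-solutionₚ L (entry p (rows (σ p) i) (columns (σ p) l)))

        equation≉0⇒minor≉0 : ¬ eval (coordinates L) equation Ω.≈ Ω.0# → ¬ minor U (system L ∘ A) Ω.≈ Ω.0#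
        equation≉0⇒minor≉0 ne e = ne (Ω.trans (eval-* (coordinates L) (systemMinorₚ A U) selectionₚ)
          (0*x≈0 _ (Ω.trans (eval-systemMinorₚ L A U) e)))

        equation≉0⇒selected : ¬ eval (coordinates L) equation Ω.≈ Ω.0# → AllSelected σ (tensor (solution L))
        equation≉0⇒selected ne p p≤n e = productUpTo-factor (suc n) (selectedₚ solutionₚ σ)
          (λ e′ → ne (Ω.trans (eval-* (coordinates L) (systemMinorₚ A U) selectionₚ) (x*0≈0 _ e′)))
          p (s≤s p≤n) (Ω.trans (selected-solution p) e)

        equation≉0 : ¬ minor U (system L ∘ A) Ω.≈ Ω.0# → AllSelected σ (tensor (solution L)) →
                     ¬ eval (coordinates L) equation Ω.≈ Ω.0#
        equation≉0 D≉0 ne e = *-≉0 (λ e → D≉0 (Ω.trans (Ω.sym (eval-systemMinorₚ L A U)) e))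
          (productUpTo-≉0 (suc n) (selectedₚ solutionₚ σ) λ p p<1+n e →
            ne p (ℕ.≤-pred p<1+n) (Ω.trans (Ω.sym (selected-solution p)) e))
          (Ω.trans (Ω.sym (eval-* (coordinates L) (systemMinorₚ A U) selectionₚ)) e)

    lowRank : ℕ → ClosedSet
    lowRank ρ = record
      { Equation    = λ f → Lift (c ⊔ ℓ₁) (Σ[ A ∈ (Fin (suc ρ) → RowIndex) ] ∃[ U ] f ≡ systemMinorₚ A U)
      ; homogeneous = λ { (lift (A , U , ≡.refl)) → _ , systemMinorₚ-homogeneous A U }
      }

    -- On the locus where the system has rank ρ, there is a solution in 𝓤 if and
    -- only if some chart provides one; as K is infinite, parameters a in K
    -- suffice, so no elimination of quantifiers is needed.
    noGoodSolution : ℕ → ClosedSet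
    noGoodSolution ρ = record
      { Equation    = λ f → Lift (c ⊔ ℓ₁) (Σ[ χ ∈ Chart ρ ] f ≡ Chart.equation χ)
      ; homogeneous = λ { (lift (χ , ≡.refl)) → Chart.equation-homogeneous χ }
      }

    -- The first condition bounds the rank of the system above by `ρ`, and the second bounds it
    -- below, since each equation contains a minor of size `ρ` as a factor.
    Piece : ℕ → Pred Point _
    Piece ρ L = (L ∈ᵖ zeros (lowRank ρ)) × ¬ (L ∈ᵖ zeros (noGoodSolution ρ))

    lowRank⇒MinorsVanish : ∀ ρ L → L ∈ᵖ zeros (lowRank ρ) → MinorsVanish (system L) (suc ρ)
    lowRank⇒MinorsVanish ρ L L∈ A U = Ω.trans (Ω.sym (eval-systemMinorₚ L A U)) (L∈ _ (lift (A , U , ≡.refl)))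

    Piece⇒𝓜 : ∀ ρ L → Piece ρ L → L ∈ᵖ 𝓜
    Piece⇒𝓜 ρ L (L∈ , L∉) = fromEquation (∉zeros (noGoodSolution ρ) {L} L∉)
      where
      fromEquation : ∃[ f ] ClosedSet.Equation (noGoodSolution ρ) f × (¬ eval (coordinates L) f Ω.≈ Ω.0#) → L ∈ᵖ 𝓜
      fromEquation (_ , lift (χ , ≡.refl) , ne) = T , AllSelected⇒𝓤 σ T selected≉0 , λ d y → mk⇔
        (InSpan⇒Ker (M (deg d) T) (b∈Ker d))
        -- Containment of `L d` in the kernel is enough, because the basis of `L d` has as many
        -- vectors as a kernel basis.
        (Ker⇒InSpan-independent (σ (deg d)) T (selected≉0 (deg d) (deg≤n d)) (Gr.independent (L d)) (b∈Ker d))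
        where
        open Chart χ
        T : Tensor
        T = tensor (solution L)
        selected≉0 : AllSelected σ T
        selected≉0 = equation≉0⇒selected L ne
        module Solutions = KernelBasis (system L) A U C (equation≉0⇒minor≉0 L ne) (lowRank⇒MinorsVanish ρ L L∈)
        b∈Ker : ∀ d j → Gr.basis (L d) j ∈Ker M (deg d) T
        b∈Ker = Ker-system⇒ L (solution L) (Ker-combination (system L) (φ ∘ a) Solutions.κ Solutions.κ∈Ker)

    HasMinor : Point → ℕ → Set _
    HasMinor L ρ = Σ[ A ∈ (Fin ρ → RowIndex) ] ∃[ U ] ¬ minor U (system L ∘ A) Ω.≈ Ω.0#

    maximal : ∀ {ℓ} (P : ℕ → Set ℓ) → P 0 → ∀ m → ¬ P m → ∃[ ρ ] ρ ℕ.< m × P ρ × ¬ P (suc ρ)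
    maximal P p₀ zero    ¬Pm = ⊥-elim (¬Pm p₀)
    maximal P p₀ (suc m) ¬Pm with em {P = P m}
    ... | yes Pm = m , ℕ.≤-refl , Pm , ¬Pm
    ... | no ¬P with ρ , ρ<m , Pρ , ¬Pρ ← maximal P p₀ m ¬P = ρ , ℕ.m≤n⇒m≤1+n ρ<m , Pρ , ¬Pρ

    SystemRank : Point → Set _
    SystemRank L = ∃[ ρ ] ρ ℕ.< suc size × HasMinor L ρ × ¬ HasMinor L (suc ρ)

    systemRank : ∀ L → SystemRank L
    systemRank L = maximal (HasMinor L) ((λ ()) , (λ ()) , Ω.1≉0) (suc size) λ (A , U , ne) →
      ℕ.<-irrefl ≡.refl (injective⇒≤ (minor≉0⇒injectiveColumns U (system L ∘ A) ne))

    𝓜⇒Piece : ∀ L → L ∈ᵖ 𝓜 → ∃[ ρ ] ρ ℕ.< suc size × Piece ρ L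
    𝓜⇒Piece L (T , T∈𝓤 , ψ) = fromRank (systemRank L)
      where
      t₀ : Fin size → Ω.Carrier
      t₀ = toCoordinates T
      t₀∈Ker : t₀ ∈Ker system L
      t₀∈Ker = Ker-system⇐ L t₀ λ d j → Equivalence.to
        (Ψ↦-cong (λ v → ≡.sym (tensor-toCoordinates T v)) {L} ψ d (Gr.basis (L d) j)) (InSpan-basis (Gr.basis (L d)) j)
      σ : Selections
      σ = proj₁ (selections T T∈𝓤)
      t₀∈domain : ¬ eval t₀ (domainₚ σ) Ω.≈ Ω.0#
      t₀∈domain = selected⇒domain σ t₀ λ p p≤n e → proj₂ (selections T T∈𝓤) p p≤n
        (Ω.trans (Ω.sym (selected-cong (σ p) (tensor-toCoordinates T))) e)
      fromRank : SystemRank L → ∃[ ρ ] ρ ℕ.< suc size × Piece ρ L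
      fromRank (ρ , ρ≤ , (A , U , D≉0) , none) = ρ , ρ≤
        , (λ { _ (lift (A′ , U′ , ≡.refl)) → Ω.trans (eval-systemMinorₚ L A′ U′) (vanish′ A′ U′) })
        , λ L∈ → uncurry (atPoint L∈) goodSolution
        where
        vanish′ : MinorsVanish (system L) (suc ρ)
        vanish′ A′ U′ = ≈0-stable λ ne → none (A′ , U′ , ne)
        injective : Injective _≡_ _≡_ U
        injective = minor≉0⇒injectiveColumns U (system L ∘ A) D≉0
        module Solutions = KernelBasis (system L) A U (complement U injective) D≉0 vanish′
        t₀∈span : InSpan Solutions.κ t₀
        t₀∈span = Solutions.Ker⇒InSpan t₀∈Ker
        -- The given tensor is a solution with parameters in `Ω` at which the domain polynomial of
        -- `σ` is nonzero. As a polynomial in the parameters, it is then nonzero for some parameters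
        -- from `K`, as a chart requires.
        goodSolution : ∃[ a ] ¬ eval (combination (λ i → φ (a i)) Solutions.κ) (domainₚ σ) Ω.≈ Ω.0#
        goodSolution = nonvanishingAtPoint
          (IsPolynomial-eval (domainₚ σ) {ρ = λ v a → combination a Solutions.κ v}
            λ v → IsPolynomial-sum λ i → coordinate i ⊗ const (Solutions.κ i v))
          (List.allFin (size ∸ ρ)) ∈-allFin
          (proj₁ t₀∈span , λ e → t₀∈domain (Ω.trans (eval-cong (proj₂ t₀∈span) (domainₚ σ)) e))
        atPoint : L ∈ᵖ zeros (noGoodSolution ρ) → ∀ a → ¬ ¬ eval (combination (λ i → φ (a i)) Solutions.κ) (domainₚ σ) Ω.≈ Ω.0#
        atPoint L∈ a ne = Chart.equation≉0 χ L D≉0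
          (domain⇒selected σ (combination (λ i → φ (a i)) Solutions.κ) ne) (L∈ _ (lift (χ , ≡.refl)))
          where
          χ : Chart ρ
          χ = record { A = A ; U = U ; injective = injective ; σ = σ ; a = a }

    pieces : List (ClosedSet × ClosedSet)
    pieces = List.map (λ ρ → lowRank ρ , noGoodSolution ρ) (List.upTo (suc size))

    𝓜-constructible : IsConstructible 𝓜
    𝓜-constructible = pieces , λ L → mk⇔
      (λ L∈𝓜 → let ρ , ρ≤ , piece = 𝓜⇒Piece L L∈𝓜 in ListAny.map⁺ (lose (∈-upTo⁺ ρ≤) piece))
      (λ L∈pieces → let ρ , _ , piece = find (ListAny.map⁻ L∈pieces) in Piece⇒𝓜 ρ L piece)

-- Application to the diagonal simplicial tensor module

module KernelSequences (em : ∀ {a} → ExcludedMiddle a)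
  {c ℓ₁ ℓ₂ c′ ℓ₁′ ℓ₂′} (K : HeytingField c ℓ₁ ℓ₂) (K-infinite : IsInfinite K)
  {k} (s : Vec ℕ (suc k))
  (R′ : ℕ → ℕ) (R′-generic : ∀ p → Diagonal.IsGenericRank s K p (R′ p))
  (Ω : HeytingField c′ ℓ₁′ ℓ₂′)
  (φ : HeytingField.Carrier K → HeytingField.Carrier Ω)
  (φ-hom : IsRingHomomorphism (rawRing K) (rawRing Ω) φ)
  where

  open Diagonal s
  open DiagonalFacts s
  open Moduli K Ω φ R′

  -- Rescaling Plücker coordinates factor by factor needs a finite list of all factors.
  degreesBelow : ℕ → List Degree
  degreesBelow zero    = []
  degreesBelow (suc m) with m ℕ.≤? n | 0 ℕ.<? K′ m
  ... | yes m≤n | yes 0<K′ = degree m m≤n 0<K′ ∷ degreesBelow m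
  ... | yes _   | no _     = degreesBelow m
  ... | no _    | _        = degreesBelow m

  ∈-degreesBelow : ∀ m d → Degree.p d < m → d ∈ degreesBelow m
  ∈-degreesBelow (suc m) d@(degree p p≤n 0<K′) p<1+m with m ℕ.≤? n | 0 ℕ.<? K′ m | ℕ.m<1+n⇒m<n∨m≡n p<1+m
  ... | yes _  | yes _ | inj₁ p<m    = there (∈-degreesBelow m d p<m)
  ... | yes _  | yes _ | inj₂ ≡.refl = here ≡.refl
  ... | yes _  | no _  | inj₁ p<m    = ∈-degreesBelow m d p<m
  ... | yes _  | no ¬< | inj₂ ≡.refl = ⊥-elim (¬< (recompute (0 ℕ.<? K′ p) 0<K′))
  ... | no _   | _     | inj₁ p<m    = ∈-degreesBelow m d p<m
  ... | no ¬≤  | _     | inj₂ ≡.refl = ⊥-elim (¬≤ (recompute (p ℕ.≤? n) p≤n))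

  p≤n : ∀ d → Degree.p d ≤ n
  p≤n (degree p bound _) = recompute (p ℕ.≤? n) bound

  0<K′ : ∀ d → 0 < K′ (Degree.p d)
  0<K′ (degree p _ positive) = recompute (0 ℕ.<? K′ p) positive

  -- With these positions of the indeterminates, `𝓤`, `Ψ` and `𝓜` of `KernelModuli` unfold to those
  -- of `Moduli`.
  module KM = KernelModuli em K K-infinite Ω φ φ-hom (indices n) ∈-indices
    n I S (λ p m j → I∙ (lookup (column p j)) m) R′ R′-generic
    Degree.p p≤n (degreesBelow (suc n)) (λ d → ∈-degreesBelow (suc n) d (s≤s (p≤n d)))

  -- The kernel of a simplicial map is stable under faces. In a degree with `K′ p ≡ 0` the target
  -- kernel is zero, as its basis is empty.
  𝓜⊆Grˢⁱᵐᵖ : 𝓜 ⊆ Grˢⁱᵐᵖ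
  𝓜⊆Grˢⁱᵐᵖ {L} (T , T∈𝓤 , ψ) p p<n 0<K′ i y y∈L =
    (λ p≤n 0<K′ → Equivalence.from (ψ (degree p p≤n 0<K′) _) dy∈Ker)
    , λ K′≡0 → KM.trivialKernel T T∈𝓤 p (ℕ.<⇒≤ p<n) K′≡0 dy∈Ker
    where
    open LinearAlgebra (rawRing Ω)
    dy∈Ker : face (rawRing Ω) p i y ∈Ker realization T p
    dy∈Ker = face-Ker (commutativeRing Ω) T p i {y} (Equivalence.to (ψ (degree (suc p) p<n 0<K′) y) y∈L)

  projectionIsDominant : ∀ (h : 0 < K′ 0) → ProjectionIsDominant h
  projectionIsDominant h = KM.Projection.project₀-dominant (degree 0 z≤n h)
    (λ {m} {m′} {l} {l′} → vertex-injective l l′ m m′)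

theorem8p13 : (∀ {a} → ExcludedMiddle a) →
    ∀ {c ℓ₁ ℓ₂ c′ ℓ₁′ ℓ₂′}
    (K : HeytingField c ℓ₁ ℓ₂) → IsInfinite K →
    ∀ {k} (s : Vec ℕ (suc k)) → All (1 ≤_) s →
    (let open Diagonal s) →
    (R′ : ℕ → ℕ) → (∀ p → IsGenericRank K p (R′ p)) →
    (Ω : HeytingField c′ ℓ₁′ ℓ₂′) → IsAlgebraicallyClosed Ω →
    (φ : HeytingField.Carrier K → HeytingField.Carrier Ω) →
    IsRingHomomorphism (rawRing K) (rawRing Ω) φ →
    (let open Moduli K Ω φ R′) (let open GrProduct) →
    IsConstructible 𝓜 ×
    𝓜 ⊆ Grˢⁱᵐᵖ ×
    (∀ (h : 0 < K′ 0) → ProjectionIsDominant h) ×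
    IsIrreducible 𝓜 ×
    IsUnirational 𝓜
theorem8p13 em K K-infinite s _ R′ R′-generic Ω _ φ φ-hom =
    KM.Constructible.𝓜-constructible 0<K′
  , (λ {L} → 𝓜⊆Grˢⁱᵐᵖ {L})
  , projectionIsDominant
  , KM.𝓜-irreducible
  , KM.𝓜-unirational
  where open KernelSequences em K K-infinite s R′ R′-generic Ω φ φ-hom
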